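{- As $N\to\infty$, the number of $3$-flimsy numbers in the interval $[2^{N-1}, 2^N)$ is $$2^N \left(\frac{1}{4} - cN^{ -1/2} + O(N^{ -3/2}) \right),$$ where $c = \frac{7\sqrt{6}}{24 \sqrt{\pi}}$ (numerically, $c \doteq 0.4030765$).
   Context: For a non-negative integer $m$, $s_2(m)$ denotes the sum of the binary digits of $m$. For a positive integer $k$, a positive integer $n$ is $k$-flimsy (in base $2$) if $s_2(kn) < s_2(n)$. -}

module Defs where

open import Data.Digit using (toDigits)
open import Data.Fin.Base using (toℕ)
open import Data.Integer.Base as ℤ using (+_)
import Data.Integer.Properties as ℤ
open import Data.Integer.Solver using (module +-*-Solver)
open import Data.List.Base using (filter; length; map; upTo)
open import Data.Nat.Base as ℕ using (ℕ; zero; suc; NonZero)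
open import Data.Nat.ListAction using (sum)
import Data.Nat.DivMod as ℕ
import Data.Nat.Properties as ℕ
open import Data.Product.Base using (_×_; _,_; ∃-syntax; proj₁)
open import Data.Rational.Base as ℚ using (ℚ; mkℚ; 0ℚ; 1ℚ; ½; ↥_; ↧ₙ_)
import Data.Rational.Properties as ℚ
open import Data.Rational.Solver using () renaming (module +-*-Solver to ℚ-Solver)
open import Data.Rational.Unnormalised.Base as ℚᵘ using (mkℚᵘ)
import Data.Rational.Unnormalised.Properties as ℚᵘ
open import Data.Sum.Base using (inj₁; inj₂)
open import Relation.Binary.PropositionalEquality
open import Relation.Nullary.Decidable using (yes; no; _×-dec_)
open import Relation.Nullary.Negation using (contradiction)
open import Relation.Unary using (Decidable)

------------------------------------------------------------------------
-- Flimsy numbers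

s₂ : ℕ → ℕ
s₂ m = sum (map toℕ (proj₁ (toDigits 2 m)))

-- Intended for k, n ≥ 1.  Since s₂ 0 = 0, no condition on n is needed
-- to exclude n = 0.
Flimsy : ℕ → ℕ → Set
Flimsy k n = s₂ (k ℕ.* n) ℕ.< s₂ n

flimsy? : ∀ k → Decidable (Flimsy k)
flimsy? k n = s₂ (k ℕ.* n) ℕ.<? s₂ n

-- The number of k-flimsy n with 2^(N-1) ≤ n < 2^N, for N ≥ 1.
flimsyCount : ℕ → ℕ → ℕ
flimsyCount k N =
  length (filter (λ n → (2 ℕ.^ (N ℕ.∸ 1) ℕ.≤? n) ×-dec flimsy? k n) (upTo (2 ℕ.^ N)))

------------------------------------------------------------------------
-- Auxiliary facts about rational numbers

∣p∣≤q : ∀ {p q} → p ℚ.≤ q → ℚ.- p ℚ.≤ q → ℚ.∣ p ∣ ℚ.≤ q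
∣p∣≤q {p} p≤q -p≤q with ℚ.∣p∣≡p∨∣p∣≡-p p
... | inj₁ eq = subst (ℚ._≤ _) (sym eq) p≤q
... | inj₂ eq = subst (ℚ._≤ _) (sym eq) -p≤q

p≤∣p∣ : ∀ p → p ℚ.≤ ℚ.∣ p ∣
p≤∣p∣ p with ℚ.≤-total 0ℚ p
... | inj₁ 0≤p = ℚ.≤-reflexive (sym (ℚ.0≤p⇒∣p∣≡p 0≤p))
... | inj₂ p≤0 = ℚ.≤-trans p≤0 (ℚ.0≤∣p∣ p)

∣p-q∣≡∣q-p∣ : ∀ p q → ℚ.∣ p ℚ.- q ∣ ≡ ℚ.∣ q ℚ.- p ∣
∣p-q∣≡∣q-p∣ p q = trans (sym (ℚ.∣-p∣≡∣p∣ (p ℚ.- q))) (cong ℚ.∣_∣ eq)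
  where
  open ℚ-Solver
  eq : ℚ.- (p ℚ.- q) ≡ q ℚ.- p
  eq = solve 2 (λ p q → :- (p :- q) := q :- p) refl p q

p≤q+r⇒p-q≤r : ∀ p q {r} → p ℚ.≤ q ℚ.+ r → p ℚ.- q ℚ.≤ r
p≤q+r⇒p-q≤r p q {r} h = subst (p ℚ.- q ℚ.≤_) eq (ℚ.+-monoˡ-≤ (ℚ.- q) h)
  where
  open ℚ-Solver
  eq : q ℚ.+ r ℚ.- q ≡ r
  eq = solve 2 (λ q r → q :+ r :- q := r) refl q r

p-q≤r⇒p≤q+r : ∀ p q {r} → p ℚ.- q ℚ.≤ r → p ℚ.≤ q ℚ.+ r
p-q≤r⇒p≤q+r p q {r} h = subst (ℚ._≤ q ℚ.+ r) eq (ℚ.+-monoʳ-≤ q h)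
  where
  open ℚ-Solver
  eq : q ℚ.+ (p ℚ.- q) ≡ p
  eq = solve 2 (λ p q → q :+ (p :- q) := p) refl p q

∣p-q∣≤r : ∀ p q {r} → p ℚ.≤ q ℚ.+ r → q ℚ.≤ p ℚ.+ r → ℚ.∣ p ℚ.- q ∣ ℚ.≤ r
∣p-q∣≤r p q {r} p≤q+r q≤p+r = ∣p∣≤q (p≤q+r⇒p-q≤r p q p≤q+r)
  (subst (ℚ._≤ r) (solve 2 (λ p q → q :- p := :- (p :- q)) refl p q) (p≤q+r⇒p-q≤r q p q≤p+r))
  where open ℚ-Solver

p≤q+∣p-q∣ : ∀ p q → p ℚ.≤ q ℚ.+ ℚ.∣ p ℚ.- q ∣
p≤q+∣p-q∣ p q = p-q≤r⇒p≤q+r p q (p≤∣p∣ (p ℚ.- q))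

∣p⊔q-p⊔r∣≤∣q-r∣ : ∀ p q r → ℚ.∣ (p ℚ.⊔ q) ℚ.- (p ℚ.⊔ r) ∣ ℚ.≤ ℚ.∣ q ℚ.- r ∣
∣p⊔q-p⊔r∣≤∣q-r∣ p q r =
  ∣p-q∣≤r (p ℚ.⊔ q) (p ℚ.⊔ r) (half q r)
    (subst (λ x → p ℚ.⊔ r ℚ.≤ p ℚ.⊔ q ℚ.+ x) (∣p-q∣≡∣q-p∣ r q) (half r q))
  where
  half : ∀ q r → p ℚ.⊔ q ℚ.≤ p ℚ.⊔ r ℚ.+ ℚ.∣ q ℚ.- r ∣
  half q r = ℚ.⊔-lub
    (ℚ.≤-trans (ℚ.≤-reflexive (sym (ℚ.+-identityʳ p)))
      (ℚ.+-mono-≤ (ℚ.p≤p⊔q p r) (ℚ.0≤∣p∣ (q ℚ.- r))))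
    (ℚ.≤-trans (p≤q+∣p-q∣ q r) (ℚ.+-monoˡ-≤ ℚ.∣ q ℚ.- r ∣ (ℚ.p≤q⊔p p r)))

0<p*q : ∀ {p q} → 0ℚ ℚ.< p → 0ℚ ℚ.< q → 0ℚ ℚ.< p ℚ.* q
0<p*q {p} {q} 0<p 0<q =
  ℚ.positive⁻¹ (p ℚ.* q) {{ℚ.pos*pos⇒pos p {{ℚ.positive 0<p}} q {{ℚ.positive 0<q}}}}

0<p+q : ∀ {p q} → 0ℚ ℚ.< p → 0ℚ ℚ.≤ q → 0ℚ ℚ.< p ℚ.+ q
0<p+q {p} 0<p 0≤q = ℚ.<-≤-trans 0<p (ℚ.≤-trans (ℚ.≤-reflexive (sym (ℚ.+-identityʳ p))) (ℚ.+-monoʳ-≤ p 0≤q))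

*-mono-≤ : ∀ {p q r s} → 0ℚ ℚ.≤ p → 0ℚ ℚ.≤ s → p ℚ.≤ q → r ℚ.≤ s → p ℚ.* r ℚ.≤ q ℚ.* s
*-mono-≤ {p} {q} {r} {s} 0≤p 0≤s p≤q r≤s = ℚ.≤-trans
  (ℚ.*-monoˡ-≤-nonNeg p {{ℚ.nonNegative 0≤p}} r≤s)
  (ℚ.*-monoʳ-≤-nonNeg s {{ℚ.nonNegative 0≤s}} p≤q)

0<1/ : ∀ {p} (0<p : 0ℚ ℚ.< p) → 0ℚ ℚ.< (ℚ.1/ p) {{ℚ.>-nonZero 0<p}}
0<1/ {p} 0<p =
  ℚ.positive⁻¹ ((ℚ.1/ p) {{ℚ.>-nonZero 0<p}}) {{ℚ.1/pos⇒pos p {{ℚ.positive 0<p}}}}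

1/-antimono : ∀ {p q} (0<p : 0ℚ ℚ.< p) (0<q : 0ℚ ℚ.< q) → p ℚ.≤ q →
              (ℚ.1/ q) {{ℚ.>-nonZero 0<q}} ℚ.≤ (ℚ.1/ p) {{ℚ.>-nonZero 0<p}}
1/-antimono {p} {q} 0<p 0<q p≤q = begin
  q⁻¹                   ≡⟨ ℚ.*-identityʳ q⁻¹ ⟨
  q⁻¹ ℚ.* 1ℚ            ≡⟨ cong (q⁻¹ ℚ.*_) (ℚ.*-inverseʳ p) ⟨
  q⁻¹ ℚ.* (p ℚ.* p⁻¹)   ≡⟨ ℚ.*-assoc q⁻¹ p p⁻¹ ⟨
  q⁻¹ ℚ.* p ℚ.* p⁻¹     ≤⟨ *-mono-≤ (ℚ.<⇒≤ (0<p*q (0<1/ 0<q) 0<p)) (ℚ.<⇒≤ (0<1/ 0<p))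
                             (ℚ.*-monoˡ-≤-nonNeg q⁻¹ {{ℚ.nonNegative (ℚ.<⇒≤ (0<1/ 0<q))}} p≤q)
                             ℚ.≤-refl ⟩
  q⁻¹ ℚ.* q ℚ.* p⁻¹     ≡⟨ cong (ℚ._* p⁻¹) (ℚ.*-inverseˡ q) ⟩
  1ℚ ℚ.* p⁻¹            ≡⟨ ℚ.*-identityˡ p⁻¹ ⟩
  p⁻¹                   ∎
  where
  open ℚ.≤-Reasoning
  instance
    _ = ℚ.>-nonZero 0<p
    _ = ℚ.>-nonZero 0<q
  p⁻¹ = ℚ.1/ p
  q⁻¹ = ℚ.1/ q

-- Non-negative fractions in terms of natural numbers.

i/n≃ᵘ : ∀ i n → ℚ.toℚᵘ (i ℚ./ suc n) ℚᵘ.≃ mkℚᵘ i n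
i/n≃ᵘ i n = ℚ.toℚᵘ-fromℚᵘ (mkℚᵘ i n)

/-mono-≤ : ∀ i m j n → i ℕ.* suc n ℕ.≤ j ℕ.* suc m → + i ℚ./ suc m ℚ.≤ + j ℚ./ suc n
/-mono-≤ i m j n h = ℚ.toℚᵘ-cancel-≤ (begin
  ℚ.toℚᵘ (+ i ℚ./ suc m)  ≃⟨ i/n≃ᵘ (+ i) m ⟩
  mkℚᵘ (+ i) m            ≤⟨ ℚᵘ.*≤* (subst₂ ℤ._≤_ (ℤ.pos-* i (suc n)) (ℤ.pos-* j (suc m)) (ℤ.+≤+ h)) ⟩
  mkℚᵘ (+ j) n            ≃⟨ i/n≃ᵘ (+ j) n ⟨
  ℚ.toℚᵘ (+ j ℚ./ suc n)  ∎)
  where open ℚᵘ.≤-Reasoning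

0≤/ : ∀ i m → 0ℚ ℚ.≤ + i ℚ./ suc m
0≤/ i m = /-mono-≤ 0 0 i m ℕ.z≤n

0</ : ∀ i m → 0ℚ ℚ.< + suc i ℚ./ suc m
0</ i m = ℚ.positive⁻¹ (+ suc i ℚ./ suc m) {{ℚ.normalize-pos (suc i) (suc m)}}

suc/ : ∀ j n → + suc j ℚ./ suc n ≡ + j ℚ./ suc n ℚ.+ + 1 ℚ./ suc n
suc/ j n = ℚ.toℚᵘ-injective (begin-equality
  ℚ.toℚᵘ (+ suc j ℚ./ suc n)
    ≃⟨ i/n≃ᵘ (+ suc j) n ⟩
  mkℚᵘ (+ suc j) n
    ≃⟨ ℚᵘ.*≡* (solve 2 (λ j d → (con (+ 1) :+ j) :* (d :* d) := (j :* d :+ con (+ 1) :* d) :* d)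
               refl (+ j) (+ suc n)) ⟩
  mkℚᵘ (+ j) n ℚᵘ.+ mkℚᵘ (+ 1) n
    ≃⟨ ℚᵘ.+-cong (i/n≃ᵘ (+ j) n) (i/n≃ᵘ (+ 1) n) ⟨
  ℚ.toℚᵘ (+ j ℚ./ suc n) ℚᵘ.+ ℚ.toℚᵘ (+ 1 ℚ./ suc n)
    ≃⟨ ℚ.toℚᵘ-homo-+ (+ j ℚ./ suc n) (+ 1 ℚ./ suc n) ⟨
  ℚ.toℚᵘ (+ j ℚ./ suc n ℚ.+ + 1 ℚ./ suc n)
    ∎)
  where
  open ℚᵘ.≤-Reasoning
  open +-*-Solver

-- 1/(n+1) is at most the positive rational ε once n is at least the
-- denominator of ε.
archimedean : ∀ {ε} → 0ℚ ℚ.< ε → ∀ n → ↧ₙ ε ℕ.≤ n → + 1 ℚ./ suc n ℚ.≤ ε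
archimedean {ε@(mkℚ (+ suc p) d _)} _ n d≤n =
  subst (+ 1 ℚ./ suc n ℚ.≤_) (ℚ.↥p/↧p≡p ε)
    (/-mono-≤ 1 n (suc p) d
      (ℕ.≤-trans (ℕ.≤-reflexive (ℕ.*-identityˡ (suc d)))
        (ℕ.≤-trans (ℕ.≤-trans d≤n (ℕ.n≤1+n n)) (ℕ.m≤n*m (suc n) (suc p)))))
archimedean {mkℚ (+ 0) d _} (ℚ.*<* (ℤ.+<+ ())) _ _
archimedean {mkℚ ℤ.-[1+ _ ] d _} (ℚ.*<* ()) _ _

------------------------------------------------------------------------
-- Real numbers, as Cauchy sequences of rationals

IsCauchy : (ℕ → ℚ) → Set
IsCauchy s = ∀ ε → 0ℚ ℚ.< ε →
  ∃[ N ] (∀ m n → N ℕ.≤ m → N ℕ.≤ n → ℚ.∣ s m ℚ.- s n ∣ ℚ.≤ ε)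

-- Without η, and with every operation below defined by copatterns, the
-- operations do not unfold, so that instances of Positive are found.
record ℝ : Set where
  no-eta-equality
  constructor mkℝ
  field
    seq    : ℕ → ℚ
    cauchy : IsCauchy seq

open ℝ public

infix 4 _≃_ _≤_

_≃_ : ℝ → ℝ → Set
x ≃ y = ∀ ε → 0ℚ ℚ.< ε →
  ∃[ N ] (∀ n → N ℕ.≤ n → ℚ.∣ seq x n ℚ.- seq y n ∣ ℚ.≤ ε)

_≤_ : ℝ → ℝ → Set
x ≤ y = ∀ ε → 0ℚ ℚ.< ε →
  ∃[ N ] (∀ n → N ℕ.≤ n → seq x n ℚ.≤ seq y n ℚ.+ ε)

-- It suffices to bound the differences by a fixed multiple of ε.
cauchy-scaled : ∀ {s} K → 0ℚ ℚ.< K →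
  (∀ ε → 0ℚ ℚ.< ε → ∃[ N ] (∀ m n → N ℕ.≤ m → N ℕ.≤ n → ℚ.∣ s m ℚ.- s n ∣ ℚ.≤ K ℚ.* ε)) →
  IsCauchy s
cauchy-scaled {s} K 0<K h ε 0<ε with h (K⁻¹ ℚ.* ε) (0<p*q (0<1/ 0<K) 0<ε)
  where K⁻¹ = (ℚ.1/ K) {{ℚ.>-nonZero 0<K}}
... | N , b = N , λ m n N≤m N≤n → subst (ℚ.∣ s m ℚ.- s n ∣ ℚ.≤_) eq (b m n N≤m N≤n)
  where
  instance _ = ℚ.>-nonZero 0<K
  open ≡-Reasoning
  eq : K ℚ.* (ℚ.1/ K ℚ.* ε) ≡ ε
  eq = begin
    K ℚ.* (ℚ.1/ K ℚ.* ε)  ≡⟨ ℚ.*-assoc K (ℚ.1/ K) ε ⟨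
    K ℚ.* ℚ.1/ K ℚ.* ε    ≡⟨ cong (ℚ._* ε) (ℚ.*-inverseʳ K) ⟩
    1ℚ ℚ.* ε              ≡⟨ ℚ.*-identityˡ ε ⟩
    ε                     ∎

bounded : ∀ x → ∃[ B ] (0ℚ ℚ.< B × ∃[ N ] (∀ n → N ℕ.≤ n → ℚ.∣ seq x n ∣ ℚ.≤ B))
bounded x with cauchy x 1ℚ (ℚ.positive⁻¹ 1ℚ)
... | N , b = 1ℚ ℚ.+ ℚ.∣ seq x N ∣ , 0<p+q (ℚ.positive⁻¹ 1ℚ) (ℚ.0≤∣p∣ (seq x N)) , N , λ n N≤n → begin
    ℚ.∣ seq x n ∣
      ≡⟨ cong ℚ.∣_∣ (solve 2 (λ a c → a := a :- c :+ c) refl (seq x n) (seq x N)) ⟩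
    ℚ.∣ seq x n ℚ.- seq x N ℚ.+ seq x N ∣
      ≤⟨ ℚ.∣p+q∣≤∣p∣+∣q∣ (seq x n ℚ.- seq x N) (seq x N) ⟩
    ℚ.∣ seq x n ℚ.- seq x N ∣ ℚ.+ ℚ.∣ seq x N ∣
      ≤⟨ ℚ.+-monoˡ-≤ ℚ.∣ seq x N ∣ (b n N N≤n ℕ.≤-refl) ⟩
    1ℚ ℚ.+ ℚ.∣ seq x N ∣
      ∎
  where
  open ℚ.≤-Reasoning
  open ℚ-Solver

fromℚ : ℚ → ℝ
seq    (fromℚ q) _ = q
cauchy (fromℚ q) ε 0<ε = 0 , λ _ _ _ _ →
  subst (ℚ._≤ ε) (sym (cong ℚ.∣_∣ (ℚ.+-inverseʳ q))) (ℚ.<⇒≤ 0<ε)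

fromℕ : ℕ → ℝ
seq    (fromℕ n) _ = + n ℚ./ 1
cauchy (fromℕ n)   = cauchy (fromℚ (+ n ℚ./ 1))

infixl 6 _+_ _-_
infixl 7 _*_ _÷_
infix  8 -_ _⁻¹

_+_ : ℝ → ℝ → ℝ
seq    (x + y) n = seq x n ℚ.+ seq y n
cauchy (x + y) = cauchy-scaled {λ n → seq x n ℚ.+ seq y n} 2ℚ (ℚ.positive⁻¹ 2ℚ) λ ε 0<ε →
  let M , b = cauchy x ε 0<ε
      N , c = cauchy y ε 0<ε
  in M ℕ.⊔ N , λ m n h k → begin
    ℚ.∣ (seq x m ℚ.+ seq y m) ℚ.- (seq x n ℚ.+ seq y n) ∣
      ≡⟨ cong ℚ.∣_∣ (solve 4 (λ p q r s → (p :+ q) :- (r :+ s) := (p :- r) :+ (q :- s))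
                       refl (seq x m) (seq y m) (seq x n) (seq y n)) ⟩
    ℚ.∣ (seq x m ℚ.- seq x n) ℚ.+ (seq y m ℚ.- seq y n) ∣
      ≤⟨ ℚ.∣p+q∣≤∣p∣+∣q∣ (seq x m ℚ.- seq x n) (seq y m ℚ.- seq y n) ⟩
    ℚ.∣ seq x m ℚ.- seq x n ∣ ℚ.+ ℚ.∣ seq y m ℚ.- seq y n ∣
      ≤⟨ ℚ.+-mono-≤
           (b m n (ℕ.m⊔n≤o⇒m≤o M N h) (ℕ.m⊔n≤o⇒m≤o M N k))
           (c m n (ℕ.m⊔n≤o⇒n≤o M N h) (ℕ.m⊔n≤o⇒n≤o M N k)) ⟩
    ε ℚ.+ ε
      ≡⟨ solve 1 (λ e → e :+ e := con 2ℚ :* e) refl ε ⟩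
    2ℚ ℚ.* ε
      ∎
  where
  open ℚ.≤-Reasoning
  open ℚ-Solver
  2ℚ = + 2 ℚ./ 1

-_ : ℝ → ℝ
seq    (- x) n = ℚ.- seq x n
cauchy (- x) ε 0<ε =
  let N , b = cauchy x ε 0<ε
  in N , λ m n h k → subst (ℚ._≤ ε) (eq (seq x m) (seq x n)) (b m n h k)
  where
  open ℚ-Solver
  eq : ∀ p q → ℚ.∣ p ℚ.- q ∣ ≡ ℚ.∣ ℚ.- p ℚ.- ℚ.- q ∣
  eq p q = trans (∣p-q∣≡∣q-p∣ p q) (cong ℚ.∣_∣ (solve 2 (λ p q → q :- p := :- p :- :- q) refl p q))

_-_ : ℝ → ℝ → ℝ
x - y = x + - y

_*_ : ℝ → ℝ → ℝ
seq    (x * y) n = seq x n ℚ.* seq y n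
cauchy (x * y) =
  let A , 0<A , I , a = bounded x
      D , 0<D , J , d = bounded y
  in cauchy-scaled {λ n → seq x n ℚ.* seq y n} (A ℚ.+ D) (0<p+q 0<A (ℚ.<⇒≤ 0<D)) λ ε 0<ε →
  let M , b = cauchy x ε 0<ε
      N , c = cauchy y ε 0<ε
  in (I ℕ.⊔ J) ℕ.⊔ (M ℕ.⊔ N) , λ m n h k →
  let h₁ = ℕ.m⊔n≤o⇒m≤o (I ℕ.⊔ J) (M ℕ.⊔ N) h
      h₂ = ℕ.m⊔n≤o⇒n≤o (I ℕ.⊔ J) (M ℕ.⊔ N) h
      k₁ = ℕ.m⊔n≤o⇒m≤o (I ℕ.⊔ J) (M ℕ.⊔ N) k
      k₂ = ℕ.m⊔n≤o⇒n≤o (I ℕ.⊔ J) (M ℕ.⊔ N) k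
      p = seq x m
      q = seq y m
      r = seq x n
      s = seq y n
  in begin
    ℚ.∣ p ℚ.* q ℚ.- r ℚ.* s ∣
      ≡⟨ cong ℚ.∣_∣ (solve 4 (λ p q r s → p :* q :- r :* s := p :* (q :- s) :+ (p :- r) :* s)
                       refl p q r s) ⟩
    ℚ.∣ p ℚ.* (q ℚ.- s) ℚ.+ (p ℚ.- r) ℚ.* s ∣
      ≤⟨ ℚ.∣p+q∣≤∣p∣+∣q∣ (p ℚ.* (q ℚ.- s)) ((p ℚ.- r) ℚ.* s) ⟩
    ℚ.∣ p ℚ.* (q ℚ.- s) ∣ ℚ.+ ℚ.∣ (p ℚ.- r) ℚ.* s ∣
      ≡⟨ cong₂ ℚ._+_ (ℚ.∣p*q∣≡∣p∣*∣q∣ p (q ℚ.- s)) (ℚ.∣p*q∣≡∣p∣*∣q∣ (p ℚ.- r) s) ⟩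
    ℚ.∣ p ∣ ℚ.* ℚ.∣ q ℚ.- s ∣ ℚ.+ ℚ.∣ p ℚ.- r ∣ ℚ.* ℚ.∣ s ∣
      ≤⟨ ℚ.+-mono-≤
           (*-mono-≤ (ℚ.0≤∣p∣ p) (ℚ.<⇒≤ 0<ε) (a m (ℕ.m⊔n≤o⇒m≤o I J h₁))
             (c m n (ℕ.m⊔n≤o⇒n≤o M N h₂) (ℕ.m⊔n≤o⇒n≤o M N k₂)))
           (*-mono-≤ (ℚ.0≤∣p∣ (p ℚ.- r)) (ℚ.<⇒≤ 0<D)
             (b m n (ℕ.m⊔n≤o⇒m≤o M N h₂) (ℕ.m⊔n≤o⇒m≤o M N k₂))
             (d n (ℕ.m⊔n≤o⇒n≤o I J k₁))) ⟩
    A ℚ.* ε ℚ.+ ε ℚ.* D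
      ≡⟨ solve 3 (λ A D e → A :* e :+ e :* D := (A :+ D) :* e) refl A D ε ⟩
    (A ℚ.+ D) ℚ.* ε
      ∎
  where
  open ℚ.≤-Reasoning
  open ℚ-Solver

∣_∣ : ℝ → ℝ
seq    ∣ x ∣ n = ℚ.∣ seq x n ∣
cauchy ∣ x ∣ ε 0<ε =
  let N , b = cauchy x ε 0<ε
  in N , λ m n h k → ∣p-q∣≤r ℚ.∣ seq x m ∣ ℚ.∣ seq x n ∣
    (half (seq x m) (seq x n) (b m n h k)) (half (seq x n) (seq x m) (b n m k h))
  where
  open ℚ.≤-Reasoning
  open ℚ-Solver
  half : ∀ p q {ε} → ℚ.∣ p ℚ.- q ∣ ℚ.≤ ε → ℚ.∣ p ∣ ℚ.≤ ℚ.∣ q ∣ ℚ.+ ε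
  half p q {ε} h = begin
    ℚ.∣ p ∣                        ≡⟨ cong ℚ.∣_∣ (solve 2 (λ p q → p := q :+ (p :- q)) refl p q) ⟩
    ℚ.∣ q ℚ.+ (p ℚ.- q) ∣          ≤⟨ ℚ.∣p+q∣≤∣p∣+∣q∣ q (p ℚ.- q) ⟩
    ℚ.∣ q ∣ ℚ.+ ℚ.∣ p ℚ.- q ∣      ≤⟨ ℚ.+-monoʳ-≤ ℚ.∣ q ∣ h ⟩
    ℚ.∣ q ∣ ℚ.+ ε                  ∎

------------------------------------------------------------------------
-- Positive reals and division

record Positive (x : ℝ) : Set where
  field
    bound   : ℚ
    0<bound : 0ℚ ℚ.< bound
    index   : ℕ
    bound≤  : ∀ n → index ℕ.≤ n → bound ℚ.≤ seq x n

open Positive public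

-- 1/ max(b,xₙ), where b is the given lower bound: it equals 1/xₙ for
-- all n ≥ index.
module Inverse (x : ℝ) (pos : Positive x) where

  s : ℕ → ℚ
  s n = bound pos ℚ.⊔ seq x n

  b≤s : ∀ n → bound pos ℚ.≤ s n
  b≤s n = ℚ.p≤p⊔q (bound pos) (seq x n)

  0<s : ∀ n → 0ℚ ℚ.< s n
  0<s n = ℚ.<-≤-trans (0<bound pos) (b≤s n)

  inv : ℕ → ℚ
  inv n = (ℚ.1/ s n) {{ℚ.>-nonZero (0<s n)}}

  0<inv : ∀ n → 0ℚ ℚ.< inv n
  0<inv n = 0<1/ (0<s n)

  b⁻¹ : ℚ
  b⁻¹ = (ℚ.1/ bound pos) {{ℚ.>-nonZero (0<bound pos)}}

  0<b⁻¹ : 0ℚ ℚ.< b⁻¹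
  0<b⁻¹ = 0<1/ (0<bound pos)

  inv≤ : ∀ n → inv n ℚ.≤ b⁻¹
  inv≤ n = 1/-antimono (0<bound pos) (0<s n) (b≤s n)

  open ℚ.≤-Reasoning

  difference : ∀ m n → inv m ℚ.- inv n ≡ inv m ℚ.* inv n ℚ.* (s n ℚ.- s m)
  difference m n = sym (begin-equality
    inv m ℚ.* inv n ℚ.* (s n ℚ.- s m)
      ≡⟨ solve 4 (λ a b c d → a :* b :* (c :- d) := a :* (c :* b) :- b :* (d :* a))
           refl (inv m) (inv n) (s n) (s m) ⟩
    inv m ℚ.* (s n ℚ.* inv n) ℚ.- inv n ℚ.* (s m ℚ.* inv m)
      ≡⟨ cong₂ (λ a b → inv m ℚ.* a ℚ.- inv n ℚ.* b)
           (ℚ.*-inverseʳ (s n) {{ℚ.>-nonZero (0<s n)}})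
           (ℚ.*-inverseʳ (s m) {{ℚ.>-nonZero (0<s m)}}) ⟩
    inv m ℚ.* 1ℚ ℚ.- inv n ℚ.* 1ℚ
      ≡⟨ cong₂ ℚ._-_ (ℚ.*-identityʳ (inv m)) (ℚ.*-identityʳ (inv n)) ⟩
    inv m ℚ.- inv n
      ∎)
    where open ℚ-Solver

  inv-cauchy : IsCauchy inv
  inv-cauchy = cauchy-scaled {inv} (b⁻¹ ℚ.* b⁻¹) (0<p*q 0<b⁻¹ 0<b⁻¹) λ ε 0<ε →
    let N , c = cauchy x ε 0<ε
    in N , λ m n h k → begin
      ℚ.∣ inv m ℚ.- inv n ∣
        ≡⟨ cong ℚ.∣_∣ (difference m n) ⟩
      ℚ.∣ inv m ℚ.* inv n ℚ.* (s n ℚ.- s m) ∣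
        ≡⟨ ℚ.∣p*q∣≡∣p∣*∣q∣ (inv m ℚ.* inv n) (s n ℚ.- s m) ⟩
      ℚ.∣ inv m ℚ.* inv n ∣ ℚ.* ℚ.∣ s n ℚ.- s m ∣
        ≡⟨ cong (ℚ._* ℚ.∣ s n ℚ.- s m ∣) (ℚ.0≤p⇒∣p∣≡p (ℚ.<⇒≤ (0<p*q (0<inv m) (0<inv n)))) ⟩
      inv m ℚ.* inv n ℚ.* ℚ.∣ s n ℚ.- s m ∣
        ≤⟨ *-mono-≤ (ℚ.<⇒≤ (0<p*q (0<inv m) (0<inv n))) (ℚ.<⇒≤ 0<ε)
             (*-mono-≤ (ℚ.<⇒≤ (0<inv m)) (ℚ.<⇒≤ 0<b⁻¹) (inv≤ m) (inv≤ n))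
             (ℚ.≤-trans (∣p⊔q-p⊔r∣≤∣q-r∣ (bound pos) (seq x n) (seq x m)) (c n m k h)) ⟩
      b⁻¹ ℚ.* b⁻¹ ℚ.* ε
        ∎

_⁻¹ : (x : ℝ) {{_ : Positive x}} → ℝ
seq    ((x ⁻¹) {{pos}}) = Inverse.inv x pos
cauchy ((x ⁻¹) {{pos}}) = Inverse.inv-cauchy x pos

_÷_ : (x y : ℝ) {{_ : Positive y}} → ℝ
x ÷ y = x * y ⁻¹

instance
  fromℕ-positive : ∀ {n} .{{_ : NonZero n}} → Positive (fromℕ n)
  fromℕ-positive {suc n} = record
    { bound   = + suc n ℚ./ 1
    ; 0<bound = 0</ n 0
    ; index   = 0
    ; bound≤  = λ _ _ → ℚ.≤-refl
    }

  *-positive : ∀ {x y} {{_ : Positive x}} {{_ : Positive y}} → Positive (x * y)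
  *-positive {{p}} {{q}} = record
    { bound   = bound p ℚ.* bound q
    ; 0<bound = 0<p*q (0<bound p) (0<bound q)
    ; index   = index p ℕ.⊔ index q
    ; bound≤  = λ n h →
        let yₙ≥ = bound≤ q n (ℕ.m⊔n≤o⇒n≤o (index p) (index q) h)
        in *-mono-≤ (ℚ.<⇒≤ (0<bound p)) (ℚ.≤-trans (ℚ.<⇒≤ (0<bound q)) yₙ≥)
             (bound≤ p n (ℕ.m⊔n≤o⇒m≤o (index p) (index q) h)) yₙ≥
    }

------------------------------------------------------------------------
-- Square roots

isqrt : ℕ → ℕ
isqrt zero    = 0
isqrt (suc m) = step (isqrt m)
  module ISqrt where
  step : ℕ → ℕ
  step r with suc r ℕ.* suc r ℕ.≤? suc m
  ... | yes _ = suc r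
  ... | no  _ = r

isqrt-lower : ∀ m → isqrt m ℕ.* isqrt m ℕ.≤ m
isqrt-lower zero    = ℕ.z≤n
isqrt-lower (suc m) with suc (isqrt m) ℕ.* suc (isqrt m) ℕ.≤? suc m
... | yes h = h
... | no  _ = ℕ.m≤n⇒m≤1+n (isqrt-lower m)

isqrt-upper : ∀ m → m ℕ.< suc (isqrt m) ℕ.* suc (isqrt m)
isqrt-upper zero    = ℕ.s≤s ℕ.z≤n
isqrt-upper (suc m) with suc (isqrt m) ℕ.* suc (isqrt m) ℕ.≤? suc m
... | yes _ = ℕ.≤-<-trans (isqrt-upper m)
                (ℕ.*-mono-< (ℕ.n<1+n (suc (isqrt m))) (ℕ.n<1+n (suc (isqrt m))))
... | no  h = ℕ.≰⇒> h

scaledFloor : ℚ → ℕ → ℕ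
scaledFloor p n = ℤ.∣ ↥ p ∣ ℕ.* (suc n ℕ.* suc n) ℕ./ ↧ₙ p

-- The greatest multiple of 1/(n+1) whose square is at most max(0,q):
-- with max(0,q) = a/b and d = n+1 it is ⌊√⌊ad²/b⌋⌋ / d.
sqrtℚ : ℚ → ℕ → ℚ
sqrtℚ q n = + isqrt (scaledFloor (0ℚ ℚ.⊔ q) n) ℚ./ suc n

/*/≃ᵘ : ∀ i n → ℚ.toℚᵘ ((i ℚ./ suc n) ℚ.* (i ℚ./ suc n)) ℚᵘ.≃ mkℚᵘ i n ℚᵘ.* mkℚᵘ i n
/*/≃ᵘ i n = ℚᵘ.≃-trans (ℚ.toℚᵘ-homo-* (i ℚ./ suc n) (i ℚ./ suc n))
                       (ℚᵘ.*-cong (i/n≃ᵘ i n) (i/n≃ᵘ i n))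

sqrtℚ-spec : ∀ q n →
  0ℚ ℚ.≤ sqrtℚ q n ×
  sqrtℚ q n ℚ.* sqrtℚ q n ℚ.≤ 0ℚ ℚ.⊔ q ×
  0ℚ ℚ.⊔ q ℚ.< (sqrtℚ q n ℚ.+ + 1 ℚ./ suc n) ℚ.* (sqrtℚ q n ℚ.+ + 1 ℚ./ suc n)
sqrtℚ-spec q n = 0≤/ (isqrt (scaledFloor (0ℚ ℚ.⊔ q) n)) n , spec (0ℚ ℚ.⊔ q) (ℚ.p≤p⊔q 0ℚ q)
  where
  spec : ∀ p → 0ℚ ℚ.≤ p →
    let r = + isqrt (scaledFloor p n) ℚ./ suc n in
    r ℚ.* r ℚ.≤ p × p ℚ.< (r ℚ.+ + 1 ℚ./ suc n) ℚ.* (r ℚ.+ + 1 ℚ./ suc n)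
  spec (mkℚ ℤ.-[1+ _ ] _ _) (ℚ.*≤* ())
  spec p@(mkℚ (+ a) b _) _ =
      ℚ.toℚᵘ-cancel-≤ (ℚᵘ.≤-respˡ-≃ (ℚᵘ.≃-sym (/*/≃ᵘ (+ j) n)) (ℚᵘ.*≤* lower))
    , subst (λ r → p ℚ.< r ℚ.* r) (suc/ j n)
        (ℚ.toℚᵘ-cancel-< (ℚᵘ.<-respʳ-≃ (ℚᵘ.≃-sym (/*/≃ᵘ (+ suc j) n)) (ℚᵘ.*<* upper)))
    where
    D = suc n ℕ.* suc n
    t = a ℕ.* D ℕ./ suc b
    j = isqrt t
    lower : (+ j ℤ.* + j) ℤ.* + suc b ℤ.≤ + a ℤ.* + D
    lower = subst₂ ℤ._≤_
      (trans (ℤ.pos-* (j ℕ.* j) (suc b)) (cong (ℤ._* + suc b) (ℤ.pos-* j j)))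
      (ℤ.pos-* a D)
      (ℤ.+≤+ (ℕ.≤-trans (ℕ.*-monoˡ-≤ (suc b) (isqrt-lower t)) (ℕ.m/n*n≤m (a ℕ.* D) (suc b))))
    upperℕ : a ℕ.* D ℕ.< suc j ℕ.* suc j ℕ.* suc b
    upperℕ = begin-strict
      a ℕ.* D                                 ≡⟨ ℕ.m≡m%n+[m/n]*n (a ℕ.* D) (suc b) ⟩
      a ℕ.* D ℕ.% suc b ℕ.+ t ℕ.* suc b       <⟨ ℕ.+-monoˡ-< (t ℕ.* suc b) (ℕ.m%n<n (a ℕ.* D) (suc b)) ⟩
      suc t ℕ.* suc b                         ≤⟨ ℕ.*-monoˡ-≤ (suc b) (isqrt-upper t) ⟩
      suc j ℕ.* suc j ℕ.* suc b               ∎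
      where open ℕ.≤-Reasoning
    upper : + a ℤ.* + D ℤ.< (+ suc j ℤ.* + suc j) ℤ.* + suc b
    upper = subst₂ ℤ._<_
      (ℤ.pos-* a D)
      (trans (ℤ.pos-* (suc j ℕ.* suc j) (suc b)) (cong (ℤ._* + suc b) (ℤ.pos-* (suc j) (suc j))))
      (ℤ.+<+ upperℕ)

-- r ≤ √p and √q < s + δ ≤ s + ε, where p ≤ q + ε².
sqrt-close : ∀ {ε p q r s δ} → 0ℚ ℚ.< ε → δ ℚ.≤ ε → 0ℚ ℚ.≤ δ → 0ℚ ℚ.≤ s →
  r ℚ.* r ℚ.≤ p → q ℚ.< (s ℚ.+ δ) ℚ.* (s ℚ.+ δ) → p ℚ.≤ q ℚ.+ ε ℚ.* ε →
  r ℚ.≤ s ℚ.+ (ε ℚ.+ ε)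
sqrt-close {ε} {p} {q} {r} {s} {δ} 0<ε δ≤ε 0≤δ 0≤s r²≤p q<[s+δ]² p≤q+ε² with ℚ.≤-total r (s ℚ.+ (ε ℚ.+ ε))
... | inj₁ h = h
... | inj₂ h = contradiction
  (begin-strict
    p                                              ≤⟨ p≤q+ε² ⟩
    q ℚ.+ ε ℚ.* ε                                  <⟨ ℚ.+-monoˡ-< (ε ℚ.* ε) q<[s+δ]² ⟩
    (s ℚ.+ δ) ℚ.* (s ℚ.+ δ) ℚ.+ ε ℚ.* ε            ≤⟨ ℚ.+-monoˡ-≤ (ε ℚ.* ε)
                                                        (*-mono-≤ 0≤s+δ (ℚ.≤-trans 0≤s+δ s+δ≤s+ε) s+δ≤s+ε s+δ≤s+ε) ⟩
    (s ℚ.+ ε) ℚ.* (s ℚ.+ ε) ℚ.+ ε ℚ.* ε            ≡⟨ ℚ.+-identityʳ _ ⟨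
    (s ℚ.+ ε) ℚ.* (s ℚ.+ ε) ℚ.+ ε ℚ.* ε ℚ.+ 0ℚ     ≤⟨ ℚ.+-monoʳ-≤ ((s ℚ.+ ε) ℚ.* (s ℚ.+ ε) ℚ.+ ε ℚ.* ε) 0≤ε*2[s+ε] ⟩
    (s ℚ.+ ε) ℚ.* (s ℚ.+ ε) ℚ.+ ε ℚ.* ε ℚ.+ ε ℚ.* ((s ℚ.+ ε) ℚ.+ (s ℚ.+ ε))
      ≡⟨ solve 2 (λ s e → (s :+ e) :* (s :+ e) :+ e :* e :+ e :* ((s :+ e) :+ (s :+ e))
                        := (s :+ (e :+ e)) :* (s :+ (e :+ e))) refl s ε ⟩
    (s ℚ.+ (ε ℚ.+ ε)) ℚ.* (s ℚ.+ (ε ℚ.+ ε))        ≤⟨ *-mono-≤ 0≤s+2ε (ℚ.≤-trans 0≤s+2ε h) h h ⟩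
    r ℚ.* r                                        ≤⟨ r²≤p ⟩
    p                                              ∎)
  (ℚ.<-irrefl refl)
  where
  open ℚ.≤-Reasoning
  open ℚ-Solver
  0≤ε = ℚ.<⇒≤ 0<ε
  0≤s+δ : 0ℚ ℚ.≤ s ℚ.+ δ
  0≤s+δ = ℚ.+-mono-≤ 0≤s 0≤δ
  s+δ≤s+ε : s ℚ.+ δ ℚ.≤ s ℚ.+ ε
  s+δ≤s+ε = ℚ.+-monoʳ-≤ s δ≤ε
  0≤s+ε : 0ℚ ℚ.≤ s ℚ.+ ε
  0≤s+ε = ℚ.+-mono-≤ 0≤s 0≤ε
  0≤s+2ε : 0ℚ ℚ.≤ s ℚ.+ (ε ℚ.+ ε)
  0≤s+2ε = ℚ.+-mono-≤ 0≤s (ℚ.+-mono-≤ 0≤ε 0≤ε)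
  0≤ε*2[s+ε] : 0ℚ ℚ.≤ ε ℚ.* ((s ℚ.+ ε) ℚ.+ (s ℚ.+ ε))
  0≤ε*2[s+ε] = ℚ.≤-trans (ℚ.≤-reflexive (sym (ℚ.*-zeroʳ ε)))
    (ℚ.*-monoˡ-≤-nonNeg ε {{ℚ.nonNegative 0≤ε}} (ℚ.+-mono-≤ 0≤s+ε 0≤s+ε))

infix 9 √_

-- The square root of max(0,x).
√_ : ℝ → ℝ
seq    (√ x) n = sqrtℚ (seq x n) n
cauchy (√ x) = cauchy-scaled {λ n → sqrtℚ (seq x n) n} 2ℚ (ℚ.positive⁻¹ 2ℚ) λ ε 0<ε →
  let N , b = cauchy x (ε ℚ.* ε) (0<p*q 0<ε 0<ε)
      M = N ℕ.⊔ ↧ₙ ε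
      half : ∀ m n → M ℕ.≤ m → M ℕ.≤ n →
             sqrtℚ (seq x m) m ℚ.≤ sqrtℚ (seq x n) n ℚ.+ 2ℚ ℚ.* ε
      half m n h k =
        let _ , lower , _ = sqrtℚ-spec (seq x m) m
            0≤s , _ , upper = sqrtℚ-spec (seq x n) n
            close = ℚ.≤-trans (∣p⊔q-p⊔r∣≤∣q-r∣ 0ℚ (seq x m) (seq x n))
                      (b m n (ℕ.m⊔n≤o⇒m≤o N (↧ₙ ε) h) (ℕ.m⊔n≤o⇒m≤o N (↧ₙ ε) k))
        in subst (λ t → sqrtℚ (seq x m) m ℚ.≤ sqrtℚ (seq x n) n ℚ.+ t)
             (solve 1 (λ e → e :+ e := con 2ℚ :* e) refl ε)
             (sqrt-close 0<ε (archimedean 0<ε n (ℕ.m⊔n≤o⇒n≤o N (↧ₙ ε) k)) (0≤/ 1 n)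
               0≤s lower upper
               (p-q≤r⇒p≤q+r _ _ (ℚ.≤-trans (p≤∣p∣ _) close)))
  in M , λ m n h k → ∣p-q∣≤r (sqrtℚ (seq x m) m) (sqrtℚ (seq x n) n) (half m n h k) (half n m k h)
  where
  open ℚ-Solver
  2ℚ = + 2 ℚ./ 1

-- If 0 < δ ≤ min(1,p) and √p < r + e with e ≤ δ/2, then δ ≤ √p gives δ/2 ≤ r.
sqrt-lower : ∀ {δ p r e} → 0ℚ ℚ.< δ → δ ℚ.≤ 1ℚ → δ ℚ.≤ p → 0ℚ ℚ.≤ r → 0ℚ ℚ.≤ e →
  e ℚ.≤ ½ ℚ.* δ → p ℚ.< (r ℚ.+ e) ℚ.* (r ℚ.+ e) → ½ ℚ.* δ ℚ.≤ r
sqrt-lower {δ} {p} {r} {e} 0<δ δ≤1 δ≤p 0≤r 0≤e e≤½δ p<[r+e]² with ℚ.≤-total (½ ℚ.* δ) r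
... | inj₁ ½δ≤r = ½δ≤r
... | inj₂ r≤½δ = contradiction p<p (ℚ.<-irrefl refl)
  where
  open ℚ.≤-Reasoning
  open ℚ-Solver
  0≤r+e : 0ℚ ℚ.≤ r ℚ.+ e
  0≤r+e = ℚ.+-mono-≤ 0≤r 0≤e
  r+e≤δ : r ℚ.+ e ℚ.≤ δ
  r+e≤δ = begin
    r ℚ.+ e              ≤⟨ ℚ.+-mono-≤ r≤½δ e≤½δ ⟩
    ½ ℚ.* δ ℚ.+ ½ ℚ.* δ  ≡⟨ solve 1 (λ d → con ½ :* d :+ con ½ :* d := d) refl δ ⟩
    δ                    ∎
  p<p : p ℚ.< p
  p<p = begin-strict
    p                        <⟨ p<[r+e]² ⟩
    (r ℚ.+ e) ℚ.* (r ℚ.+ e)  ≤⟨ *-mono-≤ 0≤r+e (ℚ.<⇒≤ 0<δ) r+e≤δ r+e≤δ ⟩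
    δ ℚ.* δ                  ≤⟨ ℚ.*-monoˡ-≤-nonNeg δ {{ℚ.nonNegative (ℚ.<⇒≤ 0<δ)}} δ≤1 ⟩
    δ ℚ.* 1ℚ                 ≡⟨ ℚ.*-identityʳ δ ⟩
    δ                        ≤⟨ δ≤p ⟩
    p                        ∎

0<p⊓q : ∀ {p q} → 0ℚ ℚ.< p → 0ℚ ℚ.< q → 0ℚ ℚ.< p ℚ.⊓ q
0<p⊓q {p} {q} 0<p 0<q with ℚ.⊓-sel p q
... | inj₁ eq = subst (0ℚ ℚ.<_) (sym eq) 0<p
... | inj₂ eq = subst (0ℚ ℚ.<_) (sym eq) 0<q

instance
  √-positive : ∀ {x} {{_ : Positive x}} → Positive (√ x)
  √-positive {x} {{pos}} = record
    { bound   = ½ ℚ.* δ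
    ; 0<bound = 0<½δ
    ; index   = index pos ℕ.⊔ ↧ₙ (½ ℚ.* δ)
    ; bound≤  = λ n h →
        let 0≤r , _ , upper = sqrtℚ-spec (seq x n) n
        in sqrt-lower 0<δ (ℚ.p⊓q≤q (bound pos) 1ℚ)
             (ℚ.≤-trans (ℚ.p⊓q≤p (bound pos) 1ℚ)
               (ℚ.≤-trans (bound≤ pos n (ℕ.m⊔n≤o⇒m≤o (index pos) (↧ₙ (½ ℚ.* δ)) h))
                 (ℚ.p≤q⊔p 0ℚ (seq x n))))
             0≤r (0≤/ 1 n)
             (archimedean 0<½δ n (ℕ.m⊔n≤o⇒n≤o (index pos) (↧ₙ (½ ℚ.* δ)) h))
             upper
    }
    where
    δ : ℚ
    δ = bound pos ℚ.⊓ 1ℚ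
    0<δ : 0ℚ ℚ.< δ
    0<δ = 0<p⊓q (0<bound pos) (ℚ.positive⁻¹ 1ℚ)
    0<½δ : 0ℚ ℚ.< ½ ℚ.* δ
    0<½δ = 0<p*q (ℚ.positive⁻¹ ½) 0<δ

------------------------------------------------------------------------
-- π, as the sum of the Leibniz series

odd⁻¹ : ℕ → ℚ
odd⁻¹ k = + 1 ℚ./ suc (2 ℕ.* k)

-- leibniz k n = Σ_{i<n} (-1)^i / (2(k+i)+1)
leibniz : ℕ → ℕ → ℚ
leibniz k zero    = 0ℚ
leibniz k (suc n) = odd⁻¹ k ℚ.- leibniz (suc k) n

odd⁻¹-antimono : ∀ {k l} → k ℕ.≤ l → odd⁻¹ l ℚ.≤ odd⁻¹ k
odd⁻¹-antimono {k} {l} k≤l = /-mono-≤ 1 (2 ℕ.* l) 1 (2 ℕ.* k)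
  (ℕ.*-monoʳ-≤ 1 (ℕ.s≤s (ℕ.*-monoʳ-≤ 2 k≤l)))

leibniz-bounds : ∀ k n → 0ℚ ℚ.≤ leibniz k n × leibniz k n ℚ.≤ odd⁻¹ k
leibniz-bounds k zero    = ℚ.≤-refl , 0≤/ 1 (2 ℕ.* k)
leibniz-bounds k (suc n) =
  let 0≤l , l≤ = leibniz-bounds (suc k) n
      l = leibniz (suc k) n
  in ℚ.≤-trans (ℚ.≤-reflexive (sym (ℚ.+-inverseʳ l)))
       (ℚ.+-monoˡ-≤ (ℚ.- l) (ℚ.≤-trans l≤ (odd⁻¹-antimono (ℕ.n≤1+n k))))
   , ℚ.≤-trans (ℚ.+-monoʳ-≤ (odd⁻¹ k) (ℚ.neg-antimono-≤ 0≤l))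
       (ℚ.≤-reflexive (ℚ.+-identityʳ (odd⁻¹ k)))

leibniz-tail : ∀ k m n → m ℕ.≤ n → ℚ.∣ leibniz k m ℚ.- leibniz k n ∣ ℚ.≤ odd⁻¹ m
leibniz-tail k m n m≤n = ℚ.≤-trans (tail k m n m≤n) (odd⁻¹-antimono (ℕ.m≤n+m m k))
  where
  open ℚ-Solver
  tail : ∀ k m n → m ℕ.≤ n → ℚ.∣ leibniz k m ℚ.- leibniz k n ∣ ℚ.≤ odd⁻¹ (k ℕ.+ m)
  tail k zero n _ =
    let 0≤l , l≤ = leibniz-bounds k n
        l = leibniz k n
    in subst₂ ℚ._≤_
         (trans (sym (ℚ.0≤p⇒∣p∣≡p 0≤l)) (trans (sym (ℚ.∣-p∣≡∣p∣ l)) (cong ℚ.∣_∣ (sym (ℚ.+-identityˡ (ℚ.- l))))))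
         (cong odd⁻¹ (sym (ℕ.+-identityʳ k))) l≤
  tail k (suc m) (suc n) (ℕ.s≤s m≤n) =
    subst₂ ℚ._≤_
      (trans (∣p-q∣≡∣q-p∣ (leibniz (suc k) m) (leibniz (suc k) n))
        (cong ℚ.∣_∣ (solve 3 (λ o a b → b :- a := (o :- a) :- (o :- b)) refl
           (odd⁻¹ k) (leibniz (suc k) m) (leibniz (suc k) n))))
      (cong odd⁻¹ (sym (ℕ.+-suc k m)))
      (tail (suc k) m n m≤n)

π/4 : ℝ
seq    π/4 = leibniz 0
cauchy π/4 ε 0<ε =
  let small : ∀ m → ↧ₙ ε ℕ.≤ m → odd⁻¹ m ℚ.≤ ε
      small m h = archimedean 0<ε (2 ℕ.* m) (ℕ.≤-trans h (ℕ.m≤n*m m 2))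
      ordered : ∀ m n → ↧ₙ ε ℕ.≤ m → m ℕ.≤ n → ℚ.∣ leibniz 0 m ℚ.- leibniz 0 n ∣ ℚ.≤ ε
      ordered m n h m≤n = ℚ.≤-trans (leibniz-tail 0 m n m≤n) (small m h)
  in ↧ₙ ε , λ m n h k → case ε m n (ordered m n h) (ordered n m k)
  where
  case : ∀ ε m n →
         (m ℕ.≤ n → ℚ.∣ leibniz 0 m ℚ.- leibniz 0 n ∣ ℚ.≤ ε) →
         (n ℕ.≤ m → ℚ.∣ leibniz 0 n ℚ.- leibniz 0 m ∣ ℚ.≤ ε) →
         ℚ.∣ leibniz 0 m ℚ.- leibniz 0 n ∣ ℚ.≤ ε
  case ε m n f g with ℕ.≤-total m n
  ... | inj₁ m≤n = f m≤n
  ... | inj₂ n≤m = subst (ℚ._≤ ε) (∣p-q∣≡∣q-p∣ (leibniz 0 n) (leibniz 0 m)) (g n≤m)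

instance
  π/4-positive : Positive π/4
  π/4-positive = record
    { bound   = + 2 ℚ./ 3
    ; 0<bound = ℚ.positive⁻¹ (+ 2 ℚ./ 3)
    ; index   = 1
    ; bound≤  = λ { (suc n) _ → let _ , l≤ = leibniz-bounds 1 n in ℚ.+-monoʳ-≤ 1ℚ (ℚ.neg-antimono-≤ l≤) }
    }

π : ℝ
π = fromℕ 4 * π/4

------------------------------------------------------------------------
-- Asymptotics in a positive integer N

Seq⁺ : Set
Seq⁺ = (N : ℕ) .{{_ : NonZero N}} → ℝ

infix 4 _∈O[_]

_∈O[_] : Seq⁺ → Seq⁺ → Set
f ∈O[ g ] = ∃[ C ] ∃[ N₀ ] (∀ N .{{_ : NonZero N}} → N₀ ℕ.≤ N → ∣ f N ∣ ≤ C * ∣ g N ∣)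

_^-½ : Seq⁺
N ^-½ = (√ fromℕ N) ⁻¹

_^-3/2 : Seq⁺
N ^-3/2 = (fromℕ N * √ fromℕ N) ⁻¹

c : ℝ
c = (fromℕ 7 * √ fromℕ 6) ÷ (fromℕ 24 * √ π)

-- Reading n from its least significant digit, the carry of the
-- multiplication by 3 is 0, 1 or 2, and s₂(3n) - s₂(n) changes only when
-- the carry leaves 1, by +1 or -1 with equal probability.  By symmetry the
-- proportion of flimsy numbers is therefore 1/4 minus a combination T of
-- probabilities that this walk ends at or next to 0.
--
-- The walk ends at 0 with the probabilities that have the generating
-- function v = 1/√((1-X)Q), where Q = 1 + X²(1+X)/4.  Hence v = g ⋆ p with
-- p = 1/√(1-X), whose coefficients are binomial(2n,n)/4ⁿ, and g = 1/√Q,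
-- whose coefficients decay geometrically.  So the coefficients of v are
-- those of p times the partial sums of g, up to a relative error O(1/n),
-- and the square of these partial sums tends to 1/Q(1) = 2/3.
--
-- It remains to compare n p(n)² with the Leibniz series for 1/π.  With
-- weights ρ m j = Π_{i≤j} (m-i)/(m+i), which tend to 1, the weighted series
-- Σ_j (-1)^j ρ m j / (2j+1) is exactly 1/(4 m p(m)²).
--
-- Finally c² = 49/(96π), so all real inequalities are reduced to rational
-- ones by squaring, and π is bounded numerically by the Leibniz series
-- with a continued fraction correction of its tail.

module Submission where

import Data.Integer.Base as ℤ
open import Data.Nat.Base as ℕ using (ℕ; zero; suc; NonZero; _^_)
import Data.Nat.Properties as ℕ
open import Data.Product.Base using (_×_; _,_; ∃-syntax; proj₁; proj₂)
open import Data.Sum.Base using (inj₁; inj₂)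
open import Relation.Binary.PropositionalEquality
  using (_≡_; refl; sym; trans; cong; cong₂; subst; subst₂; module ≡-Reasoning)
open import Relation.Nullary.Negation using (¬_; contradiction)

-- An error O(N^(-3/2)) asks for relative accuracy O(1/N) in each factor of the leading term. For
-- the convolution with `p` it comes from n (p(n-i) - p(n)) ≤ i(i+1) p(n), a bound that the
-- geometric decay of the other factor makes summable. The partial sums `G` of `g` tend to an
-- irrational limit, so only their square is estimated, through the partial sums `E` of g² = 1/Q,
-- which satisfy a linear recurrence with a rational fixed point. For `p` no rate of convergence is
-- needed: n p(n)² increases and (n + 1/2) p(n)² decreases, so the bare convergence of the weighted
-- series, used at indices tending to infinity, already encloses 1/π between the two values at every
-- fixed n. The generating function of the walk is obtained without its algebraic characteristic
-- root: a quadratic expression in two neighbouring series is conserved along the recurrence and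
-- vanishes, and together with the boundary equation it determines `V 0`.

-- Rational arithmetic: the embedded naturals, order and squares

module Rationals where

  open import Data.Rational.Base
  open import Data.Rational.Properties
  open import Data.Rational.Solver using (module +-*-Solver)
  open import Relation.Binary.Definitions using (tri<; tri≈; tri>)
  open import Defs using (*-mono-≤; p≤∣p∣; suc/; 0≤/; 0</; /-mono-≤)

  open +-*-Solver

  -- By recursion rather than as a fraction, so that `ι (suc n)` is `ι n + 1ℚ` by definition and the
  -- ring solver can treat `ι n` as an indeterminate.
  ι : ℕ → ℚ
  ι zero    = 0ℚ
  ι (suc n) = ι n + 1ℚ

  ι≡/1 : ∀ n → ι n ≡ ℤ.+ n / 1
  ι≡/1 zero    = refl
  ι≡/1 (suc n) = trans (cong (_+ 1ℚ) (ι≡/1 n)) (sym (suc/ n 0))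

  0≤+ : ∀ {p q} → 0ℚ ≤ p → 0ℚ ≤ q → 0ℚ ≤ p + q
  0≤+ = +-mono-≤

  0≤* : ∀ {p q} → 0ℚ ≤ p → 0ℚ ≤ q → 0ℚ ≤ p * q
  0≤* 0≤p 0≤q = *-mono-≤ ≤-refl 0≤q 0≤p 0≤q

  0≤1 : 0ℚ ≤ 1ℚ
  0≤1 = nonNegative⁻¹ 1ℚ

  0<1 : 0ℚ < 1ℚ
  0<1 = positive⁻¹ 1ℚ

  0≤ι : ∀ n → 0ℚ ≤ ι n
  0≤ι zero    = ≤-refl
  0≤ι (suc n) = 0≤+ (0≤ι n) 0≤1

  0<ι : ∀ n → 0ℚ < ι (suc n)
  0<ι n = +-mono-≤-< (0≤ι n) 0<1

  ι-+ : ∀ m n → ι (m ℕ.+ n) ≡ ι m + ι n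
  ι-+ zero    n = sym (+-identityˡ (ι n))
  ι-+ (suc m) n = trans (cong (_+ 1ℚ) (ι-+ m n))
    (solve 2 (λ a b → a :+ b :+ con 1ℚ := a :+ con 1ℚ :+ b) refl (ι m) (ι n))

  ι-* : ∀ m n → ι (m ℕ.* n) ≡ ι m * ι n
  ι-* zero    n = sym (*-zeroˡ (ι n))
  ι-* (suc m) n = trans (ι-+ n (m ℕ.* n)) (trans (cong (ι n +_) (ι-* m n))
    (solve 2 (λ a b → b :+ a :* b := (a :+ con 1ℚ) :* b) refl (ι m) (ι n)))

  ι-mono-≤ : ∀ {m n} → m ℕ.≤ n → ι m ≤ ι n
  ι-mono-≤ {n = n} ℕ.z≤n = 0≤ι n
  ι-mono-≤ (ℕ.s≤s m≤n)   = +-monoˡ-≤ 1ℚ (ι-mono-≤ m≤n)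

  -- Most polynomial inequalities below are proved by exhibiting their nonnegative difference `d`,
  -- which leaves an equation to the ring solver.
  ≤-by : ∀ {a b} d → 0ℚ ≤ d → a + d ≡ b → a ≤ b
  ≤-by {a} d 0≤d eq = subst₂ _≤_ (+-identityʳ a) eq (+-monoʳ-≤ a 0≤d)

  diff≥0 : ∀ {a b} → a ≤ b → 0ℚ ≤ b - a
  diff≥0 {a} {b} a≤b = subst (_≤ b - a) (+-inverseʳ a) (+-monoˡ-≤ (- a) a≤b)

  diff≥0⁻¹ : ∀ {a b} → 0ℚ ≤ b - a → a ≤ b
  diff≥0⁻¹ {a} {b} h = ≤-by (b - a) h (solve 2 (λ a b → a :+ (b :- a) := b) refl a b)

  *-monoˡ : ∀ {p q r} → 0ℚ ≤ r → p ≤ q → r * p ≤ r * q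
  *-monoˡ {r = r} 0≤r p≤q = *-monoˡ-≤-nonNeg r {{nonNegative 0≤r}} p≤q

  *-monoʳ : ∀ {p q r} → 0ℚ ≤ r → p ≤ q → p * r ≤ q * r
  *-monoʳ {r = r} 0≤r p≤q = *-monoʳ-≤-nonNeg r {{nonNegative 0≤r}} p≤q

  *-cancelˡ-≤ : ∀ {p q r} → 0ℚ < r → r * p ≤ r * q → p ≤ q
  *-cancelˡ-≤ {r = r} 0<r h = *-cancelˡ-≤-pos r {{positive 0<r}} h

  *-cancelˡ-≡ : ∀ {p q r} → 0ℚ < r → r * p ≡ r * q → p ≡ q
  *-cancelˡ-≡ 0<r h = ≤-antisym (*-cancelˡ-≤ 0<r (≤-reflexive h)) (*-cancelˡ-≤ 0<r (≤-reflexive (sym h)))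

  0≤p² : ∀ p → 0ℚ ≤ p * p
  0≤p² p with ≤-total 0ℚ p
  ... | inj₁ 0≤p = 0≤* 0≤p 0≤p
  ... | inj₂ p≤0 = subst (0ℚ ≤_) (solve 1 (λ p → :- p :* :- p := p :* p) refl p)
                     (0≤* (neg-antimono-≤ p≤0) (neg-antimono-≤ p≤0))

  ∣p∣² : ∀ p → ∣ p ∣ * ∣ p ∣ ≡ p * p
  ∣p∣² p with ∣p∣≡p∨∣p∣≡-p p
  ... | inj₁ eq = cong (λ a → a * a) eq
  ... | inj₂ eq = trans (cong (λ a → a * a) eq) (solve 1 (λ p → :- p :* :- p := p :* p) refl p)

  square-mono : ∀ {p q} → 0ℚ ≤ p → p ≤ q → p * p ≤ q * q
  square-mono 0≤p p≤q = *-mono-≤ 0≤p (≤-trans 0≤p p≤q) p≤q p≤q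

  square-cancel-≤ : ∀ {p q} → 0ℚ ≤ q → p * p ≤ q * q → p ≤ q
  square-cancel-≤ {p} {q} 0≤q p²≤q² with <-cmp p q
  ... | tri< p<q _ _ = <⇒≤ p<q
  ... | tri≈ _ p≡q _ = ≤-reflexive p≡q
  ... | tri> _ _ q<p = contradiction (<-≤-trans q²<p² p²≤q²) (<-irrefl refl)
    where
    0<p : 0ℚ < p
    0<p = ≤-<-trans 0≤q q<p
    q²<p² : q * q < p * p
    q²<p² = ≤-<-trans (*-monoˡ 0≤q (<⇒≤ q<p)) (*-monoˡ-<-pos p {{positive 0<p}} q<p)

  ∣p∣≤-upper : ∀ {p q} → ∣ p ∣ ≤ q → p ≤ q
  ∣p∣≤-upper {p} h = ≤-trans (p≤∣p∣ p) h

  ∣p+q∣≤ : ∀ {p q a b} → ∣ p ∣ ≤ a → ∣ q ∣ ≤ b → ∣ p + q ∣ ≤ a + b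
  ∣p+q∣≤ {p} {q} h k = ≤-trans (∣p+q∣≤∣p∣+∣q∣ p q) (+-mono-≤ h k)

  ∣p-q∣≤ : ∀ {p q a b} → ∣ p ∣ ≤ a → ∣ q ∣ ≤ b → ∣ p - q ∣ ≤ a + b
  ∣p-q∣≤ {q = q} h k = ∣p+q∣≤ h (subst (_≤ _) (sym (∣-p∣≡∣p∣ q)) k)

  ∣p*q∣≤ : ∀ {p q a b} → ∣ p ∣ ≤ a → ∣ q ∣ ≤ b → ∣ p * q ∣ ≤ a * b
  ∣p*q∣≤ {p} {q} {a} {b} h k = subst (_≤ a * b) (sym (∣p*q∣≡∣p∣*∣q∣ p q))
    (*-mono-≤ (0≤∣p∣ p) (≤-trans (0≤∣p∣ q) k) h k)

  /≡ι* : ∀ i n → ℤ.+ i / suc n ≡ ι i * (ℤ.+ 1 / suc n)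
  /≡ι* zero    n = trans (≤-antisym (/-mono-≤ 0 n 0 0 ℕ.z≤n) (0≤/ 0 n)) (sym (*-zeroˡ (ℤ.+ 1 / suc n)))
  /≡ι* (suc i) n = trans (suc/ i n) (trans (cong (_+ (ℤ.+ 1 / suc n)) (/≡ι* i n))
    (solve 2 (λ a b → a :* b :+ b := (a :+ con 1ℚ) :* b) refl (ι i) (ℤ.+ 1 / suc n)))

  recip : ℕ → ℚ
  recip n = ℤ.+ 1 / suc n

  ι*recip : ∀ n → ι (suc n) * recip n ≡ 1ℚ
  ι*recip n = trans (sym (/≡ι* (suc n) n))
    (≤-antisym (/-mono-≤ (suc n) n 1 0 (ℕ.≤-reflexive (ℕ.*-comm (suc n) 1)))
               (/-mono-≤ 1 0 (suc n) n (ℕ.≤-reflexive (ℕ.*-comm 1 (suc n)))))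

  0<recip : ∀ n → 0ℚ < recip n
  0<recip n = 0</ 0 n

-- The ring of formal power series over ℚ and its Euler derivation

module PowerSeries where

  open import Algebra.Bundles using (CommutativeRing)
  open import Algebra.Structures using (IsCommutativeRing)
  import Algebra.Solver.Ring as RingSolver
  open import Algebra.Solver.Ring.AlmostCommutativeRing
    using (AlmostCommutativeRing; fromCommutativeRing; _-Raw-AlmostCommutative⟶_)
  open import Data.Maybe.Base using (Maybe; just; nothing)
  open import Data.Rational.Base using (ℚ; 0ℚ; 1ℚ)
  import Data.Rational.Base as ℚ
  import Data.Rational.Properties as ℚ
  open import Data.Rational.Solver using () renaming (module +-*-Solver to ℚ-Solver)
  open import Level using (0ℓ)
  open import Relation.Nullary.Decidable using (yes; no)
  open Rationals

  infix  4 _≈_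
  infixl 6 _⊕_
  infixl 7 _⋆_
  infix  8 ⊖_

  Series : Set
  Series = ℕ → ℚ

  -- A record rather than a function type, so that `f` and `g` can be inferred from a proof.
  record _≈_ (f g : Series) : Set where
    constructor pointwise
    field at : ∀ n → f n ≡ g n
  open _≈_ public

  tail : Series → Series
  tail f n = f (suc n)

  _⊕_ : Series → Series → Series
  (f ⊕ g) n = f n ℚ.+ g n

  ⊖_ : Series → Series
  (⊖ f) n = ℚ.- f n

  _⋆_ : Series → Series → Series
  (f ⋆ g) zero    = f 0 ℚ.* g 0
  (f ⋆ g) (suc n) = f 0 ℚ.* g (suc n) ℚ.+ (tail f ⋆ g) n

  C : ℚ → Series
  C a zero    = a
  C a (suc n) = 0ℚ

  ⋆-cong-at : ∀ {f f′ g g′} → (∀ n → f n ≡ f′ n) → (∀ n → g n ≡ g′ n) → ∀ n → (f ⋆ g) n ≡ (f′ ⋆ g′) n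
  ⋆-cong-at p q zero    = cong₂ ℚ._*_ (p 0) (q 0)
  ⋆-cong-at p q (suc n) = cong₂ ℚ._+_ (cong₂ ℚ._*_ (p 0) (q (suc n))) (⋆-cong-at (λ n → p (suc n)) q n)

  0⋆ : ∀ f g → (∀ n → f n ≡ 0ℚ) → ∀ n → (f ⋆ g) n ≡ 0ℚ
  0⋆ f g f≡0 zero    = trans (cong (ℚ._* g 0) (f≡0 0)) (ℚ.*-zeroˡ (g 0))
  0⋆ f g f≡0 (suc n) = trans (cong₂ ℚ._+_ (trans (cong (ℚ._* g (suc n)) (f≡0 0)) (ℚ.*-zeroˡ (g (suc n))))
    (0⋆ (tail f) g (λ n → f≡0 (suc n)) n)) refl

  C⋆-at : ∀ a f n → (C a ⋆ f) n ≡ a ℚ.* f n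
  C⋆-at a f zero    = refl
  C⋆-at a f (suc n) = trans (cong (a ℚ.* f (suc n) ℚ.+_) (0⋆ (tail (C a)) f (λ _ → refl) n)) (ℚ.+-identityʳ (a ℚ.* f (suc n)))

  ⊕⋆-at : ∀ f g h n → ((f ⊕ g) ⋆ h) n ≡ (f ⋆ h) n ℚ.+ (g ⋆ h) n
  ⊕⋆-at f g h zero    = ℚ.*-distribʳ-+ (h 0) (f 0) (g 0)
  ⊕⋆-at f g h (suc n) = trans (cong ((f 0 ℚ.+ g 0) ℚ.* h (suc n) ℚ.+_) (⊕⋆-at (tail f) (tail g) h n))
    (solve 5 (λ a b c d e → (a :+ b) :* c :+ (d :+ e) := a :* c :+ d :+ (b :* c :+ e)) refl
      (f 0) (g 0) (h (suc n)) ((tail f ⋆ h) n) ((tail g ⋆ h) n))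
    where open ℚ-Solver

  scale⋆-at : ∀ a f g n → ((λ n → a ℚ.* f n) ⋆ g) n ≡ a ℚ.* (f ⋆ g) n
  scale⋆-at a f g zero    = ℚ.*-assoc a (f 0) (g 0)
  scale⋆-at a f g (suc n) = trans (cong (a ℚ.* f 0 ℚ.* g (suc n) ℚ.+_) (scale⋆-at a (tail f) g n))
    (solve 4 (λ a b c d → a :* b :* c :+ a :* d := a :* (b :* c :+ d)) refl
      a (f 0) (g (suc n)) ((tail f ⋆ g) n))
    where open ℚ-Solver

  -- The recursion of `_⋆_` peels the left factor; commutativity needs this mirrored recursion,
  -- which peels the right one.
  ⋆-suc : ∀ f g n → (f ⋆ g) (suc n) ≡ f (suc n) ℚ.* g 0 ℚ.+ (f ⋆ tail g) n
  ⋆-suc f g zero    = ℚ.+-comm (f 0 ℚ.* g 1) (f 1 ℚ.* g 0)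
  ⋆-suc f g (suc n) = trans (cong (f 0 ℚ.* g (suc (suc n)) ℚ.+_) (⋆-suc (tail f) g n))
    (solve 3 (λ a b c → a :+ (b :+ c) := b :+ (a :+ c)) refl
      (f 0 ℚ.* g (suc (suc n))) (f (suc (suc n)) ℚ.* g 0) ((tail f ⋆ tail g) n))
    where open ℚ-Solver

  ⋆-comm-at : ∀ f g n → (f ⋆ g) n ≡ (g ⋆ f) n
  ⋆-comm-at f g zero    = ℚ.*-comm (f 0) (g 0)
  ⋆-comm-at f g (suc n) = trans (cong₂ ℚ._+_ (ℚ.*-comm (f 0) (g (suc n))) (⋆-comm-at (tail f) g n)) (sym (⋆-suc g f n))

  ⋆-assoc-at : ∀ f g h n → ((f ⋆ g) ⋆ h) n ≡ (f ⋆ (g ⋆ h)) n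
  ⋆-assoc-at f g h zero    = ℚ.*-assoc (f 0) (g 0) (h 0)
  ⋆-assoc-at f g h (suc n) = begin
    f 0 ℚ.* g 0 ℚ.* h (suc n) ℚ.+ (tail (f ⋆ g) ⋆ h) n
      ≡⟨ cong (f 0 ℚ.* g 0 ℚ.* h (suc n) ℚ.+_) (⊕⋆-at (λ n → f 0 ℚ.* tail g n) (tail f ⋆ g) h n) ⟩
    f 0 ℚ.* g 0 ℚ.* h (suc n) ℚ.+ (((λ n → f 0 ℚ.* tail g n) ⋆ h) n ℚ.+ ((tail f ⋆ g) ⋆ h) n)
      ≡⟨ cong₂ (λ a b → f 0 ℚ.* g 0 ℚ.* h (suc n) ℚ.+ (a ℚ.+ b))
           (scale⋆-at (f 0) (tail g) h n) (⋆-assoc-at (tail f) g h n) ⟩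
    f 0 ℚ.* g 0 ℚ.* h (suc n) ℚ.+ (f 0 ℚ.* (tail g ⋆ h) n ℚ.+ (tail f ⋆ (g ⋆ h)) n)
      ≡⟨ solve 5 (λ a b c d e → a :* b :* c :+ (a :* d :+ e) := a :* (b :* c :+ d) :+ e) refl
           (f 0) (g 0) (h (suc n)) ((tail g ⋆ h) n) ((tail f ⋆ (g ⋆ h)) n) ⟩
    f 0 ℚ.* (g ⋆ h) (suc n) ℚ.+ (tail f ⋆ (g ⋆ h)) n ∎
    where
    open ≡-Reasoning
    open ℚ-Solver

  isCommutativeRing : IsCommutativeRing _≈_ _⊕_ _⋆_ ⊖_ (C 0ℚ) (C 1ℚ)
  isCommutativeRing = record
    { isRing = record
      { +-isAbelianGroup = record
        { isGroup = record
          { isMonoid = record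
            { isSemigroup = record
              { isMagma = record
                { isEquivalence = record
                  { refl  = pointwise λ _ → refl
                  ; sym   = λ p → pointwise λ n → sym (at p n)
                  ; trans = λ p q → pointwise λ n → trans (at p n) (at q n)
                  }
                ; ∙-cong = λ p q → pointwise λ n → cong₂ ℚ._+_ (at p n) (at q n)
                }
              ; assoc = λ f g h → pointwise λ n → ℚ.+-assoc (f n) (g n) (h n)
              }
            ; identity = (λ f → pointwise λ n → trans (cong (ℚ._+ f n) (C0 n)) (ℚ.+-identityˡ (f n)))
                       , (λ f → pointwise λ n → trans (cong (f n ℚ.+_) (C0 n)) (ℚ.+-identityʳ (f n)))
            }
          ; inverse = (λ f → pointwise λ n → trans (ℚ.+-inverseˡ (f n)) (sym (C0 n)))
                    , (λ f → pointwise λ n → trans (ℚ.+-inverseʳ (f n)) (sym (C0 n)))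
          ; ⁻¹-cong = λ p → pointwise λ n → cong ℚ.-_ (at p n)
          }
        ; comm = λ f g → pointwise λ n → ℚ.+-comm (f n) (g n)
        }
      ; *-cong = λ p q → pointwise (⋆-cong-at (at p) (at q))
      ; *-assoc = λ f g h → pointwise (⋆-assoc-at f g h)
      ; *-identity = (λ f → pointwise λ n → trans (C⋆-at 1ℚ f n) (ℚ.*-identityˡ (f n)))
                   , (λ f → pointwise λ n → trans (⋆-comm-at f (C 1ℚ) n) (trans (C⋆-at 1ℚ f n) (ℚ.*-identityˡ (f n))))
      ; distrib = (λ f g h → pointwise λ n → trans (⋆-comm-at f (g ⊕ h) n)
                     (trans (⊕⋆-at g h f n) (cong₂ ℚ._+_ (⋆-comm-at g f n) (⋆-comm-at h f n))))
                , (λ f g h → pointwise (⊕⋆-at g h f))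
      }
    ; *-comm = λ f g → pointwise (⋆-comm-at f g)
    }
    where
    C0 : ∀ n → C 0ℚ n ≡ 0ℚ
    C0 zero    = refl
    C0 (suc n) = refl

  seriesRing : CommutativeRing 0ℓ 0ℓ
  seriesRing = record { isCommutativeRing = isCommutativeRing }

  open CommutativeRing seriesRing public using (setoid)
    renaming (refl to ≈-refl; sym to ≈-sym; trans to ≈-trans)

  ⊖-cong : ∀ {f g} → f ≈ g → ⊖ f ≈ ⊖ g
  ⊖-cong p = pointwise λ n → cong ℚ.-_ (at p n)

  ⊕-congˡ : ∀ f {g h} → g ≈ h → f ⊕ g ≈ f ⊕ h
  ⊕-congˡ f p = pointwise λ n → cong (f n ℚ.+_) (at p n)

  ⊕-congʳ : ∀ h {f g} → f ≈ g → f ⊕ h ≈ g ⊕ h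
  ⊕-congʳ h p = pointwise λ n → cong (ℚ._+ h n) (at p n)

  ⋆-congˡ : ∀ f {g h} → g ≈ h → f ⋆ g ≈ f ⋆ h
  ⋆-congˡ f p = pointwise (⋆-cong-at {f} (λ _ → refl) (at p))

  ⋆-congʳ : ∀ h {f g} → f ≈ g → f ⋆ h ≈ g ⋆ h
  ⋆-congʳ h p = pointwise (⋆-cong-at (at p) (λ _ → refl))

  C-morphism : CommutativeRing.rawRing ℚ.+-*-commutativeRing -Raw-AlmostCommutative⟶ fromCommutativeRing seriesRing
  C-morphism = record
    { ⟦_⟧    = C
    ; +-homo = λ a b → pointwise λ { zero → refl ; (suc n) → refl }
    ; *-homo = λ a b → pointwise λ { zero → refl ; (suc n) → sym (trans (C⋆-at a (C b) (suc n)) (ℚ.*-zeroʳ a)) }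
    ; -‿homo = λ a → pointwise λ { zero → refl ; (suc n) → refl }
    ; 0-homo = ≈-refl
    ; 1-homo = ≈-refl
    }

  C-equal? : ∀ a b → Maybe (C a ≈ C b)
  C-equal? a b with a ℚ.≟ b
  ... | yes refl = just ≈-refl
  ... | no  _    = nothing

  module Solver = RingSolver (CommutativeRing.rawRing ℚ.+-*-commutativeRing) (fromCommutativeRing seriesRing)
    C-morphism C-equal?

  X : Series
  X 1 = 1ℚ
  X _ = 0ℚ

  X⋆-suc : ∀ f n → (X ⋆ f) (suc n) ≡ f n
  X⋆-suc f n = trans (cong₂ ℚ._+_ (ℚ.*-zeroˡ (f (suc n)))
      (trans (⋆-cong-at {tail X} {C 1ℚ} {f} (λ { zero → refl ; (suc n) → refl }) (λ _ → refl) n) (C⋆-at 1ℚ f n)))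
    (trans (ℚ.+-identityˡ (1ℚ ℚ.* f n)) (ℚ.*-identityˡ (f n)))

  X⋆-zero : ∀ f → (X ⋆ f) 0 ≡ 0ℚ
  X⋆-zero f = ℚ.*-zeroˡ (f 0)

  -- The derivation X d/dX. It turns equations for squares of series into linear recurrences for the
  -- coefficients.
  ϑ : Series → Series
  ϑ f n = ι n ℚ.* f n

  ϑ-⋆ : ∀ f g → ϑ (f ⋆ g) ≈ ϑ f ⋆ g ⊕ f ⋆ ϑ g
  ϑ-⋆ f g = pointwise (go f)
    where
    open ≡-Reasoning
    open ℚ-Solver
    tail-ϑ : ∀ f n → tail (ϑ f) n ≡ ϑ (tail f) n ℚ.+ tail f n
    tail-ϑ f n = solve 2 (λ a b → (a :+ con 1ℚ) :* b := a :* b :+ b) refl (ι n) (f (suc n))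
    go : ∀ f n → ϑ (f ⋆ g) n ≡ (ϑ f ⋆ g ⊕ f ⋆ ϑ g) n
    go f zero    = solve 2 (λ a b → con 0ℚ :* (a :* b) := con 0ℚ :* a :* b :+ a :* (con 0ℚ :* b)) refl (f 0) (g 0)
    go f (suc n) = begin
      ι (suc n) ℚ.* (f 0 ℚ.* g (suc n) ℚ.+ (tail f ⋆ g) n)
        ≡⟨ solve 4 (λ i a b c → (i :+ con 1ℚ) :* (a :* b :+ c)
             := i :* c :+ (c :+ a :* ((i :+ con 1ℚ) :* b))) refl (ι n) (f 0) (g (suc n)) ((tail f ⋆ g) n) ⟩
      ϑ (tail f ⋆ g) n ℚ.+ ((tail f ⋆ g) n ℚ.+ f 0 ℚ.* ϑ g (suc n))
        ≡⟨ cong (ℚ._+ ((tail f ⋆ g) n ℚ.+ f 0 ℚ.* ϑ g (suc n))) (go (tail f) n) ⟩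
      (ϑ (tail f) ⋆ g) n ℚ.+ (tail f ⋆ ϑ g) n ℚ.+ ((tail f ⋆ g) n ℚ.+ f 0 ℚ.* ϑ g (suc n))
        ≡⟨ solve 5 (λ a b c d e → a :+ b :+ (c :+ d) := con 0ℚ :* e :+ (a :+ c) :+ (d :+ b)) refl
             ((ϑ (tail f) ⋆ g) n) ((tail f ⋆ ϑ g) n) ((tail f ⋆ g) n) (f 0 ℚ.* ϑ g (suc n)) (f 0 ℚ.* g (suc n)) ⟩
      0ℚ ℚ.* (f 0 ℚ.* g (suc n)) ℚ.+ ((ϑ (tail f) ⋆ g) n ℚ.+ (tail f ⋆ g) n) ℚ.+ (f 0 ℚ.* ϑ g (suc n) ℚ.+ (tail f ⋆ ϑ g) n)
        ≡⟨ cong₂ (λ a b → a ℚ.+ b ℚ.+ (f 0 ℚ.* ϑ g (suc n) ℚ.+ (tail f ⋆ ϑ g) n))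
             (sym (ℚ.*-assoc 0ℚ (f 0) (g (suc n))))
             (sym (trans (⋆-cong-at {g = g} (tail-ϑ f) (λ _ → refl) n) (⊕⋆-at (ϑ (tail f)) (tail f) g n))) ⟩
      (ϑ f ⋆ g ⊕ f ⋆ ϑ g) (suc n) ∎

  ϑ≈0⇒const : ∀ f → (∀ n → ϑ f n ≡ 0ℚ) → f ≈ C (f 0)
  ϑ≈0⇒const f h = pointwise λ
    { zero    → refl
    ; (suc n) → *-cancelˡ-≡ (0<ι n) (trans (h (suc n)) (sym (ℚ.*-zeroʳ (ι (suc n))))) }

  ϑ-⊕ : ∀ f g → ϑ (f ⊕ g) ≈ ϑ f ⊕ ϑ g
  ϑ-⊕ f g = pointwise λ n → ℚ.*-distribˡ-+ (ι n) (f n) (g n)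

  ϑ-C : ∀ a → ϑ (C a) ≈ C 0ℚ
  ϑ-C a = pointwise λ { zero → ℚ.*-zeroˡ a ; (suc n) → ℚ.*-zeroʳ (ι (suc n)) }

  ϑ-X : ϑ X ≈ X
  ϑ-X = pointwise λ { 0 → refl ; 1 → refl ; (suc (suc n)) → ℚ.*-zeroʳ (ι (suc (suc n))) }

  ϑ-cong : ∀ {f g} → f ≈ g → ϑ f ≈ ϑ g
  ϑ-cong p = pointwise λ n → cong (ι n ℚ.*_) (at p n)

  ones : Series
  ones _ = 1ℚ

  ones⋆[1-X] : ones ⋆ (C 1ℚ ⊕ ⊖ X) ≈ C 1ℚ
  ones⋆[1-X] = ≈-trans (solve 2 (λ o x → o :* (con 1ℚ :- x) := o :- x :* o) ≈-refl ones X) (pointwise λ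
    { zero    → cong (λ a → 1ℚ ℚ.- a) (X⋆-zero ones)
    ; (suc n) → cong (λ a → 1ℚ ℚ.- a) (X⋆-suc ones n) })
    where open Solver

-- The generating functions of the walk

module WalkSeries where

  open import Data.Rational.Base using (ℚ; 0ℚ; 1ℚ; ½; _/_)
  import Data.Rational.Base as ℚ
  import Data.Rational.Properties as ℚ
  open import Data.Rational.Solver using () renaming (module +-*-Solver to ℚ-Solver)
  import Relation.Binary.Reasoning.Setoid as SetoidReasoning
  open import Defs using (0<p*q)
  open Rationals
  open PowerSeries

  ¼ ⅔ ⅜ : ℚ
  ¼ = ℤ.+ 1 / 4
  ⅔ = ℤ.+ 2 / 3
  ⅜ = ℤ.+ 3 / 8

  -- The coefficient of zⁿ xʲ in 1/(1 - z/2 - (z²/4)(x + 1/x)), which is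
  -- invariant under x ↦ 1/x, so that j ≥ 0 suffices.
  W : ℕ → ℕ → ℚ
  W 0             zero    = 1ℚ
  W 0             (suc j) = 0ℚ
  W 1             zero    = ½
  W 1             (suc j) = 0ℚ
  W (suc (suc n)) zero    = ½ ℚ.* W (suc n) 0 ℚ.+ ½ ℚ.* W n 1
  W (suc (suc n)) (suc j) = ½ ℚ.* W (suc n) (suc j) ℚ.+ ¼ ℚ.* (W n j ℚ.+ W n (suc (suc j)))

  0≤W : ∀ n j → 0ℚ ℚ.≤ W n j
  0≤W 0             zero    = 0≤1
  0≤W 0             (suc j) = ℚ.≤-refl
  0≤W 1             zero    = ℚ.nonNegative⁻¹ ½
  0≤W 1             (suc j) = ℚ.≤-refl
  0≤W (suc (suc n)) zero    = 0≤+ (0≤* (ℚ.nonNegative⁻¹ ½) (0≤W (suc n) 0)) (0≤* (ℚ.nonNegative⁻¹ ½) (0≤W n 1))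
  0≤W (suc (suc n)) (suc j) = 0≤+ (0≤* (ℚ.nonNegative⁻¹ ½) (0≤W (suc n) (suc j)))
    (0≤* (ℚ.nonNegative⁻¹ ¼) (0≤+ (0≤W n j) (0≤W n (suc (suc j)))))

  V : ℕ → Series
  V j n = W n j

  V-zero : V 0 ≈ C 1ℚ ⊕ C ½ ⋆ (X ⋆ V 0) ⊕ C ½ ⋆ (X ⋆ (X ⋆ V 1))
  V-zero = pointwise λ n → sym (trans
    (cong₂ (λ a b → C 1ℚ n ℚ.+ a ℚ.+ b) (C⋆-at ½ (X ⋆ V 0) n) (C⋆-at ½ (X ⋆ (X ⋆ V 1)) n)) (go n))
    where
    open ℚ-Solver
    go : ∀ n → C 1ℚ n ℚ.+ ½ ℚ.* (X ⋆ V 0) n ℚ.+ ½ ℚ.* (X ⋆ (X ⋆ V 1)) n ≡ V 0 n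
    go 0             = refl
    go 1             = refl
    go (suc (suc n)) rewrite X⋆-suc (V 0) (suc n) | X⋆-suc (X ⋆ V 1) (suc n) | X⋆-suc (V 1) n =
      cong (ℚ._+ ½ ℚ.* W n 1) (ℚ.+-identityˡ (½ ℚ.* W (suc n) 0))

  V-suc : ∀ j → V (suc j) ≈ C ½ ⋆ (X ⋆ V (suc j)) ⊕ C ¼ ⋆ (X ⋆ (X ⋆ (V j ⊕ V (suc (suc j)))))
  V-suc j = pointwise λ n → sym (trans
    (cong₂ ℚ._+_ (C⋆-at ½ (X ⋆ V (suc j)) n) (C⋆-at ¼ (X ⋆ (X ⋆ (V j ⊕ V (suc (suc j))))) n)) (go n))
    where
    U = V j ⊕ V (suc (suc j))
    go : ∀ n → ½ ℚ.* (X ⋆ V (suc j)) n ℚ.+ ¼ ℚ.* (X ⋆ (X ⋆ U)) n ≡ V (suc j) n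
    go 0 rewrite X⋆-zero (V (suc j)) | X⋆-zero (X ⋆ U) = refl
    go 1 rewrite X⋆-suc (V (suc j)) 0 | X⋆-suc (X ⋆ U) 0 | X⋆-zero U = refl
    go (suc (suc n)) rewrite X⋆-suc (V (suc j)) (suc n) | X⋆-suc (X ⋆ U) (suc n) | X⋆-suc U n = refl

  V-vanishes : ∀ n j → n ℕ.< j → W n j ≡ 0ℚ
  V-vanishes 0             (suc j) _         = refl
  V-vanishes 1             (suc j) _         = refl
  V-vanishes (suc (suc n)) (suc (suc j)) (ℕ.s≤s (ℕ.s≤s n<j))
    rewrite V-vanishes (suc n) (suc (suc j)) (ℕ.s≤s (ℕ.m≤n⇒m≤1+n n<j))
          | V-vanishes n (suc j) (ℕ.m≤n⇒m≤1+n n<j)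
          | V-vanishes n (suc (suc (suc j))) (ℕ.m≤n⇒m≤1+n (ℕ.m≤n⇒m≤1+n (ℕ.m≤n⇒m≤1+n n<j))) = refl

  ⋆-vanishes : ∀ f g n → (∀ i → i ℕ.≤ n → f i ≡ 0ℚ) → (f ⋆ g) n ≡ 0ℚ
  ⋆-vanishes f g zero    h rewrite h 0 ℕ.z≤n = ℚ.*-zeroˡ (g 0)
  ⋆-vanishes f g (suc n) h rewrite h 0 ℕ.z≤n | ⋆-vanishes (tail f) g n (λ i i≤n → h (suc i) (ℕ.s≤s i≤n)) =
    cong (ℚ._+ 0ℚ) (ℚ.*-zeroˡ (g (suc n)))

  -- A first integral of the recurrence (X²/4)(V (j-1) + V (j+1)) = (1 - X/2) V j.
  -- It is 0 because the order of V j in X tends to infinity with j.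
  J : ℕ → Series
  J j = V j ⋆ (C ¼ ⋆ X ⋆ X ⋆ V j ⊕ ⊖ ((C 1ℚ ⊕ ⊖ (C ½ ⋆ X)) ⋆ V (suc j))) ⊕ V (suc j) ⋆ (C ¼ ⋆ X ⋆ X ⋆ V (suc j))

  -- The difference of the two sides is V (j+2) - V j times the recurrence for V (j+1), written with
  -- everything on one side.
  J-suc : ∀ j → J (suc j) ≈ J j
  J-suc j = begin
    J (suc j)
      ≈⟨ solve 4 (λ x a b c →
           b :* (con ¼ :* x :* x :* b :+ :- ((con 1ℚ :+ :- (con ½ :* x)) :* c)) :+ c :* (con ¼ :* x :* x :* c)
           := a :* (con ¼ :* x :* x :* a :+ :- ((con 1ℚ :+ :- (con ½ :* x)) :* b)) :+ b :* (con ¼ :* x :* x :* b)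
              :+ (c :- a) :* (con ½ :* (x :* b) :+ con ¼ :* (x :* (x :* (a :+ c))) :- b))
           ≈-refl X (V j) (V (suc j)) (V (suc (suc j))) ⟩
    J j ⊕ (V (suc (suc j)) ⊕ ⊖ V j) ⋆ (R ⊕ ⊖ V (suc j))
      ≈⟨ ⊕-congˡ (J j) (⋆-congˡ (V (suc (suc j)) ⊕ ⊖ V j) (⊕-congʳ (⊖ V (suc j)) (≈-sym (V-suc j)))) ⟩
    J j ⊕ (V (suc (suc j)) ⊕ ⊖ V j) ⋆ (V (suc j) ⊕ ⊖ V (suc j))
      ≈⟨ solve 3 (λ a b c → a :+ c :* (b :- b) := a) ≈-refl (J j) (V (suc j)) (V (suc (suc j)) ⊕ ⊖ V j) ⟩
    J j ∎
    where
    open Solver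
    open SetoidReasoning setoid
    R = C ½ ⋆ (X ⋆ V (suc j)) ⊕ C ¼ ⋆ (X ⋆ (X ⋆ (V j ⊕ V (suc (suc j)))))

  J≈0 : J 0 ≈ C 0ℚ
  -- The coefficient of Xⁿ is read off at `J (suc n)`, both of whose terms have order greater than
  -- n.
  J≈0 = pointwise λ n → trans (descend n (suc n)) (trans
    (cong₂ ℚ._+_ (⋆-vanishes (V (suc n)) _ n (λ i i≤n → V-vanishes i (suc n) (ℕ.s≤s i≤n)))
                 (⋆-vanishes (V (suc (suc n))) _ n (λ i i≤n → V-vanishes i (suc (suc n)) (ℕ.m≤n⇒m≤1+n (ℕ.s≤s i≤n)))))
    (C0 n))
    where
    descend : ∀ n j → J 0 n ≡ J j n
    descend n zero    = refl
    descend n (suc j) = trans (descend n j) (sym (at (J-suc j) n))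
    C0 : ∀ n → 0ℚ ≡ C 0ℚ n
    C0 zero    = refl
    C0 (suc n) = refl

  Q : Series
  Q = C 1ℚ ⊕ C ¼ ⋆ (X ⋆ X ⋆ (C 1ℚ ⊕ X))

  1-X : Series
  1-X = C 1ℚ ⊕ ⊖ X

  -- The boundary equation `V-zero` expresses X² V 1 through V 0. Inserted into J 0 = 0 it gives V
  -- 0² ((1 - X/2)² - X⁴/4) = 1, and the bracket factors as (1 - X) Q.
  V²⋆[1-X]⋆Q : V 0 ⋆ V 0 ⋆ (1-X ⋆ Q) ≈ C 1ℚ
  V²⋆[1-X]⋆Q = begin
    V 0 ⋆ V 0 ⋆ (1-X ⋆ Q)
      ≈⟨ solve 3 (λ x v w →
           v :* v :* ((con 1ℚ :+ :- x) :* (con 1ℚ :+ con ¼ :* (x :* x :* (con 1ℚ :+ x))))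
           := con 1ℚ :+ (v :- (con 1ℚ :+ con ½ :* (x :* v) :+ con ½ :* (x :* (x :* w))))
                          :* (v :- con ½ :* x :* v :+ con 1ℚ :- con ½ :* x :* x :* w)
                     :- x :* x :* (v :* (con ¼ :* x :* x :* v :+ :- ((con 1ℚ :+ :- (con ½ :* x)) :* w))
                                    :+ w :* (con ¼ :* x :* x :* w)))
           ≈-refl X (V 0) (V 1) ⟩
    C 1ℚ ⊕ (V 0 ⊕ ⊖ R) ⋆ S ⊕ ⊖ (X ⋆ X ⋆ J 0)
      ≈⟨ ⊕-congʳ (⊖ (X ⋆ X ⋆ J 0)) (⊕-congˡ (C 1ℚ) (⋆-congʳ S (⊕-congˡ (V 0) (⊖-cong (≈-sym V-zero))))) ⟩
    C 1ℚ ⊕ (V 0 ⊕ ⊖ V 0) ⋆ S ⊕ ⊖ (X ⋆ X ⋆ J 0)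
      ≈⟨ ⊕-congˡ (C 1ℚ ⊕ (V 0 ⊕ ⊖ V 0) ⋆ S) (⊖-cong (⋆-congˡ (X ⋆ X) J≈0)) ⟩
    C 1ℚ ⊕ (V 0 ⊕ ⊖ V 0) ⋆ S ⊕ ⊖ (X ⋆ X ⋆ C 0ℚ)
      ≈⟨ solve 3 (λ x v s → con 1ℚ :+ (v :- v) :* s :- x :* x :* con 0ℚ := con 1ℚ) ≈-refl X (V 0) S ⟩
    C 1ℚ ∎
    where
    open Solver
    open SetoidReasoning setoid
    R = C 1ℚ ⊕ C ½ ⋆ (X ⋆ V 0) ⊕ C ½ ⋆ (X ⋆ (X ⋆ V 1))
    S = V 0 ⊕ ⊖ (C ½ ⋆ X ⋆ V 0) ⊕ C 1ℚ ⊕ ⊖ (C ½ ⋆ X ⋆ X ⋆ V 1)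

  -- The factors p = 1/√(1-X) and g = 1/√Q

  -- p n = binomial(2n,n)/4ⁿ
  p : Series
  p zero    = 1ℚ
  p (suc n) = (ι n ℚ.+ ½) ℚ.* recip n ℚ.* p n

  p-suc : ∀ n → ι (suc n) ℚ.* p (suc n) ≡ (ι n ℚ.+ ½) ℚ.* p n
  p-suc n = begin
    ι (suc n) ℚ.* ((ι n ℚ.+ ½) ℚ.* recip n ℚ.* p n)
      ≡⟨ solve 4 (λ a b c d → a :* (b :* c :* d) := a :* c :* (b :* d)) refl (ι (suc n)) (ι n ℚ.+ ½) (recip n) (p n) ⟩
    ι (suc n) ℚ.* recip n ℚ.* ((ι n ℚ.+ ½) ℚ.* p n)
      ≡⟨ cong (ℚ._* ((ι n ℚ.+ ½) ℚ.* p n)) (ι*recip n) ⟩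
    1ℚ ℚ.* ((ι n ℚ.+ ½) ℚ.* p n)
      ≡⟨ ℚ.*-identityˡ ((ι n ℚ.+ ½) ℚ.* p n) ⟩
    (ι n ℚ.+ ½) ℚ.* p n ∎
    where
    open ≡-Reasoning
    open ℚ-Solver

  0<p : ∀ n → 0ℚ ℚ.< p n
  0<p zero    = 0<1
  0<p (suc n) = 0<p*q (0<p*q (ℚ.+-mono-≤-< (0≤ι n) (ℚ.positive⁻¹ ½)) (0<recip n)) (0<p n)

  0≤p : ∀ n → 0ℚ ℚ.≤ p n
  0≤p n = ℚ.<⇒≤ (0<p n)

  ϑp : ϑ p ≈ X ⋆ (ϑ p ⊕ C ½ ⋆ p)
  ϑp = pointwise λ
    { zero    → trans (ℚ.*-zeroˡ 1ℚ) (sym (X⋆-zero (ϑ p ⊕ C ½ ⋆ p)))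
    ; (suc n) → trans (p-suc n) (trans (ℚ.*-distribʳ-+ (p n) (ι n) ½)
        (trans (cong (ι n ℚ.* p n ℚ.+_) (sym (C⋆-at ½ p n))) (sym (X⋆-suc (ϑ p ⊕ C ½ ⋆ p) n)))) }

  ϑ-1-X : ϑ 1-X ≈ ⊖ X
  ϑ-1-X = pointwise λ { 0 → refl ; 1 → refl ; (suc (suc n)) → ℚ.*-zeroʳ (ι (suc (suc n))) }

  -- By the recurrence `ϑp` the left side is annihilated by `ϑ`, so it equals its constant term.
  p²⋆[1-X] : p ⋆ p ⋆ 1-X ≈ C 1ℚ
  p²⋆[1-X] = ϑ≈0⇒const (p ⋆ p ⋆ 1-X) (λ n → trans (at eq n) (C0 n))
    where
    C0 : ∀ n → C 0ℚ n ≡ 0ℚ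
    C0 zero    = refl
    C0 (suc n) = refl
    open Solver
    open SetoidReasoning setoid
    eq : ϑ (p ⋆ p ⋆ 1-X) ≈ C 0ℚ
    eq = begin
      ϑ (p ⋆ p ⋆ 1-X)
        ≈⟨ ϑ-⋆ (p ⋆ p) 1-X ⟩
      ϑ (p ⋆ p) ⋆ 1-X ⊕ p ⋆ p ⋆ ϑ 1-X
        ≈⟨ ⊕-congʳ (p ⋆ p ⋆ ϑ 1-X) (⋆-congʳ 1-X (ϑ-⋆ p p)) ⟩
      (ϑ p ⋆ p ⊕ p ⋆ ϑ p) ⋆ 1-X ⊕ p ⋆ p ⋆ ϑ 1-X
        ≈⟨ ⊕-congˡ ((ϑ p ⋆ p ⊕ p ⋆ ϑ p) ⋆ 1-X) (⋆-congˡ (p ⋆ p) ϑ-1-X) ⟩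
      (ϑ p ⋆ p ⊕ p ⋆ ϑ p) ⋆ 1-X ⊕ p ⋆ p ⋆ ⊖ X
        ≈⟨ solve 3 (λ x p d → (d :* p :+ p :* d) :* (con 1ℚ :+ :- x) :+ p :* p :* (:- x)
                     := (p :+ p) :* (d :- x :* (d :+ con ½ :* p))) ≈-refl X p (ϑ p) ⟩
      (p ⊕ p) ⋆ (ϑ p ⊕ ⊖ (X ⋆ (ϑ p ⊕ C ½ ⋆ p)))
        ≈⟨ ⋆-congˡ (p ⊕ p) (⊕-congˡ (ϑ p) (⊖-cong (≈-sym ϑp))) ⟩
      (p ⊕ p) ⋆ (ϑ p ⊕ ⊖ ϑ p)
        ≈⟨ solve 2 (λ p d → (p :+ p) :* (d :- d) := con 0ℚ) ≈-refl p (ϑ p) ⟩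
      C 0ℚ ∎

  -- g = 1/√Q, the quotient of V 0 = 1/√((1-X)Q) by p = 1/√(1-X).
  g : Series
  g = V 0 ⋆ p ⋆ 1-X

  g⋆p : g ⋆ p ≈ V 0
  g⋆p = begin
    V 0 ⋆ p ⋆ 1-X ⋆ p      ≈⟨ solve 3 (λ v p d → v :* p :* d :* p := v :* (p :* p :* d)) ≈-refl (V 0) p 1-X ⟩
    V 0 ⋆ (p ⋆ p ⋆ 1-X)    ≈⟨ ⋆-congˡ (V 0) p²⋆[1-X] ⟩
    V 0 ⋆ C 1ℚ             ≈⟨ solve 1 (λ v → v :* con 1ℚ := v) ≈-refl (V 0) ⟩
    V 0 ∎
    where
    open Solver
    open SetoidReasoning setoid

  g²⋆Q : g ⋆ g ⋆ Q ≈ C 1ℚ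
  g²⋆Q = begin
    g ⋆ g ⋆ Q
      ≈⟨ solve 4 (λ v p d q → v :* p :* d :* (v :* p :* d) :* q := v :* v :* (d :* q) :* (p :* p :* d))
           ≈-refl (V 0) p 1-X Q ⟩
    V 0 ⋆ V 0 ⋆ (1-X ⋆ Q) ⋆ (p ⋆ p ⋆ 1-X)
      ≈⟨ ⋆-congˡ (V 0 ⋆ V 0 ⋆ (1-X ⋆ Q)) p²⋆[1-X] ⟩
    V 0 ⋆ V 0 ⋆ (1-X ⋆ Q) ⋆ C 1ℚ
      ≈⟨ ⋆-congʳ (C 1ℚ) V²⋆[1-X]⋆Q ⟩
    C 1ℚ ⋆ C 1ℚ
      ≈⟨ solve 0 (con 1ℚ :* con 1ℚ := con 1ℚ) ≈-refl ⟩
    C 1ℚ ∎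
    where
    open Solver
    open SetoidReasoning setoid

  ϑQ : ϑ Q ≈ C ½ ⋆ (X ⋆ X) ⊕ C (ℤ.+ 3 / 4) ⋆ (X ⋆ X ⋆ X)
  ϑQ = begin
    ϑ Q
      ≈⟨ ϑ-⊕ (C 1ℚ) (C ¼ ⋆ m) ⟩
    ϑ (C 1ℚ) ⊕ ϑ (C ¼ ⋆ m)
      ≈⟨ ⊕-congʳ (ϑ (C ¼ ⋆ m)) (ϑ-C 1ℚ) ⟩
    C 0ℚ ⊕ ϑ (C ¼ ⋆ m)
      ≈⟨ ⊕-congˡ (C 0ℚ) (ϑ-⋆ (C ¼) m) ⟩
    C 0ℚ ⊕ (ϑ (C ¼) ⋆ m ⊕ C ¼ ⋆ ϑ m)
      ≈⟨ ⊕-congˡ (C 0ℚ) (⊕-congʳ (C ¼ ⋆ ϑ m) (⋆-congʳ m (ϑ-C ¼))) ⟩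
    C 0ℚ ⊕ (C 0ℚ ⋆ m ⊕ C ¼ ⋆ ϑ m)
      ≈⟨ ⊕-congˡ (C 0ℚ) (⊕-congˡ (C 0ℚ ⋆ m) (⋆-congˡ (C ¼) ϑm)) ⟩
    C 0ℚ ⊕ (C 0ℚ ⋆ m ⊕ C ¼ ⋆ ((X ⋆ X ⊕ X ⋆ X) ⋆ (C 1ℚ ⊕ X) ⊕ X ⋆ X ⋆ X))
      ≈⟨ solve 2 (λ x m → con 0ℚ :+ (con 0ℚ :* m :+ con ¼ :* ((x :* x :+ x :* x) :* (con 1ℚ :+ x) :+ x :* x :* x))
                   := con ½ :* (x :* x) :+ con (ℤ.+ 3 / 4) :* (x :* x :* x)) ≈-refl X m ⟩
    C ½ ⋆ (X ⋆ X) ⊕ C (ℤ.+ 3 / 4) ⋆ (X ⋆ X ⋆ X) ∎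
    where
    open Solver
    open SetoidReasoning setoid
    m = X ⋆ X ⋆ (C 1ℚ ⊕ X)
    ϑX² : ϑ (X ⋆ X) ≈ X ⋆ X ⊕ X ⋆ X
    ϑX² = ≈-trans (ϑ-⋆ X X) (≈-trans (⊕-congʳ (X ⋆ ϑ X) (⋆-congʳ X ϑ-X)) (⊕-congˡ (X ⋆ X) (⋆-congˡ X ϑ-X)))
    ϑ[1+X] : ϑ (C 1ℚ ⊕ X) ≈ X
    ϑ[1+X] = pointwise λ { 0 → refl ; 1 → refl ; (suc (suc n)) → ℚ.*-zeroʳ (ι (suc (suc n))) }
    ϑm : ϑ m ≈ (X ⋆ X ⊕ X ⋆ X) ⋆ (C 1ℚ ⊕ X) ⊕ X ⋆ X ⋆ X
    ϑm = ≈-trans (ϑ-⋆ (X ⋆ X) (C 1ℚ ⊕ X)) (≈-trans (⊕-congʳ (X ⋆ X ⋆ ϑ (C 1ℚ ⊕ X)) (⋆-congʳ (C 1ℚ ⊕ X) ϑX²))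
           (⊕-congˡ ((X ⋆ X ⊕ X ⋆ X) ⋆ (C 1ℚ ⊕ X)) (⋆-congˡ (X ⋆ X) ϑ[1+X])))

  -- The logarithmic derivative of g²Q = 1.
  ϑg : ϑ g ⋆ Q ⊕ C ½ ⋆ ϑ Q ⋆ g ≈ C 0ℚ
  ϑg = begin
    a
      -- Splitting off the factor 1 - g²Q, which is 0, avoids cancelling 2g from ϑ(g²Q) = 2g (ϑg Q +
      -- ½ ϑQ g) = 0.
      ≈⟨ solve 4 (λ g d q e → d :* q :+ con ½ :* e :* g
            := (d :* q :+ con ½ :* e :* g) :* (con 1ℚ :- g :* g :* q)
               :+ con ½ :* (g :* q) :* ((d :* g :+ g :* d) :* q :+ g :* g :* e)) ≈-refl g (ϑ g) Q (ϑ Q) ⟩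
    a ⋆ (C 1ℚ ⊕ ⊖ (g ⋆ g ⋆ Q)) ⊕ b ⋆ ((ϑ g ⋆ g ⊕ g ⋆ ϑ g) ⋆ Q ⊕ g ⋆ g ⋆ ϑ Q)
      ≈⟨ ⊕-congˡ (a ⋆ (C 1ℚ ⊕ ⊖ (g ⋆ g ⋆ Q))) (⋆-congˡ b (≈-sym
           (≈-trans (ϑ-⋆ (g ⋆ g) Q) (⊕-congʳ (g ⋆ g ⋆ ϑ Q) (⋆-congʳ Q (ϑ-⋆ g g)))))) ⟩
    a ⋆ (C 1ℚ ⊕ ⊖ (g ⋆ g ⋆ Q)) ⊕ b ⋆ ϑ (g ⋆ g ⋆ Q)
      ≈⟨ ⊕-congˡ (a ⋆ (C 1ℚ ⊕ ⊖ (g ⋆ g ⋆ Q))) (⋆-congˡ b (≈-trans (ϑ-cong g²⋆Q) (ϑ-C 1ℚ))) ⟩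
    a ⋆ (C 1ℚ ⊕ ⊖ (g ⋆ g ⋆ Q)) ⊕ b ⋆ C 0ℚ
      ≈⟨ ⊕-congʳ (b ⋆ C 0ℚ) (⋆-congˡ a (⊕-congˡ (C 1ℚ) (⊖-cong g²⋆Q))) ⟩
    a ⋆ (C 1ℚ ⊕ ⊖ C 1ℚ) ⊕ b ⋆ C 0ℚ
      ≈⟨ solve 2 (λ a b → a :* (con 1ℚ :- con 1ℚ) :+ b :* con 0ℚ := con 0ℚ) ≈-refl a b ⟩
    C 0ℚ ∎
    where
    open Solver
    open SetoidReasoning setoid
    a = ϑ g ⋆ Q ⊕ C ½ ⋆ ϑ Q ⋆ g
    b = C ½ ⋆ (g ⋆ Q)

  X²⋆-at : ∀ f n → (X ⋆ (X ⋆ f)) (suc (suc n)) ≡ f n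
  X²⋆-at f n = trans (X⋆-suc (X ⋆ f) (suc n)) (X⋆-suc f n)

  X³⋆-at : ∀ f n → (X ⋆ (X ⋆ (X ⋆ f))) (suc (suc (suc n))) ≡ f n
  X³⋆-at f n = trans (X⋆-suc (X ⋆ (X ⋆ f)) (suc (suc n))) (X²⋆-at f n)

  -- The coefficient of X^(n+3) in `ϑg`.
  g-recurrence : ∀ n → ι (3 ℕ.+ n) ℚ.* g (3 ℕ.+ n)
    ≡ ℚ.- (¼ ℚ.* (ι (2 ℕ.+ n) ℚ.* g (1 ℕ.+ n)) ℚ.+ (¼ ℚ.* ι n ℚ.+ ⅜) ℚ.* g n)
  g-recurrence n = begin
    ϑ g (3 ℕ.+ n)
      ≡⟨ solve 3 (λ a b c → a := (a :+ b :+ c) :- b :- c) refl (ϑ g (3 ℕ.+ n)) (X²f (3 ℕ.+ n)) (X³h (3 ℕ.+ n)) ⟩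
    ϑ g (3 ℕ.+ n) ℚ.+ X²f (3 ℕ.+ n) ℚ.+ X³h (3 ℕ.+ n) ℚ.- X²f (3 ℕ.+ n) ℚ.- X³h (3 ℕ.+ n)
      ≡⟨ cong (λ a → a ℚ.- X²f (3 ℕ.+ n) ℚ.- X³h (3 ℕ.+ n)) (at eq (3 ℕ.+ n)) ⟩
    0ℚ ℚ.- X²f (3 ℕ.+ n) ℚ.- X³h (3 ℕ.+ n)
      ≡⟨ cong₂ (λ a b → 0ℚ ℚ.- a ℚ.- b)
           (trans (X²⋆-at (C ¼ ⋆ (ϑ g ⊕ g)) (suc n)) (C⋆-at ¼ (ϑ g ⊕ g) (suc n)))
           (trans (X³⋆-at (C ¼ ⋆ ϑ g ⊕ C ⅜ ⋆ g) n) (cong₂ ℚ._+_ (C⋆-at ¼ (ϑ g) n) (C⋆-at ⅜ g n))) ⟩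
    0ℚ ℚ.- ¼ ℚ.* (ι (suc n) ℚ.* g (suc n) ℚ.+ g (suc n)) ℚ.- (¼ ℚ.* (ι n ℚ.* g n) ℚ.+ ⅜ ℚ.* g n)
      ≡⟨ solve 3 (λ i a b → con 0ℚ :- con ¼ :* ((i :+ con 1ℚ) :* a :+ a) :- (con ¼ :* (i :* b) :+ con ⅜ :* b)
            := :- (con ¼ :* ((i :+ con 1ℚ :+ con 1ℚ) :* a) :+ (con ¼ :* i :+ con ⅜) :* b)) refl (ι n) (g (suc n)) (g n) ⟩
    ℚ.- (¼ ℚ.* (ι (2 ℕ.+ n) ℚ.* g (1 ℕ.+ n)) ℚ.+ (¼ ℚ.* ι n ℚ.+ ⅜) ℚ.* g n) ∎
    where
    open ≡-Reasoning
    open ℚ-Solver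
    X²f = X ⋆ (X ⋆ (C ¼ ⋆ (ϑ g ⊕ g)))
    X³h = X ⋆ (X ⋆ (X ⋆ (C ¼ ⋆ ϑ g ⊕ C ⅜ ⋆ g)))
    eq : ϑ g ⊕ X²f ⊕ X³h ≈ C 0ℚ
    eq = ≈-trans (Solver.solve 3 (λ x g d →
             d S.:+ x S.:* (x S.:* (S.con ¼ S.:* (d S.:+ g))) S.:+ x S.:* (x S.:* (x S.:* (S.con ¼ S.:* d S.:+ S.con ⅜ S.:* g)))
             S.:= d S.:* (S.con 1ℚ S.:+ S.con ¼ S.:* (x S.:* x S.:* (S.con 1ℚ S.:+ x)))
                  S.:+ S.con ½ S.:* (S.con ½ S.:* (x S.:* x) S.:+ S.con (ℤ.+ 3 / 4) S.:* (x S.:* x S.:* x)) S.:* g)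
             ≈-refl X g (ϑ g))
           (≈-trans (⊕-congˡ (ϑ g ⋆ Q) (⋆-congʳ g (⋆-congˡ (C ½) (≈-sym ϑQ)))) ϑg)
      where module S = Solver

  -- Since `ones` is 1/(1 - X), these are the partial sums of g and of g² = 1/Q.
  G E : Series
  G = g ⋆ ones
  E = g ⋆ G

  Q⋆E : Q ⋆ E ≈ ones
  Q⋆E = begin
    Q ⋆ (g ⋆ (g ⋆ ones))  ≈⟨ solve 3 (λ q g o → q :* (g :* (g :* o)) := g :* g :* q :* o) ≈-refl Q g ones ⟩
    g ⋆ g ⋆ Q ⋆ ones      ≈⟨ ⋆-congʳ ones g²⋆Q ⟩
    C 1ℚ ⋆ ones           ≈⟨ solve 1 (λ o → con 1ℚ :* o := o) ≈-refl ones ⟩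
    ones                  ∎
    where
    open Solver
    open SetoidReasoning setoid

  -- The coefficient of X^(n+3) in Q E = 1/(1 - X). The constant solution is 1/Q(1) = 2/3.
  E-recurrence : ∀ n → E (3 ℕ.+ n) ℚ.+ ¼ ℚ.* E (1 ℕ.+ n) ℚ.+ ¼ ℚ.* E n ≡ 1ℚ
  E-recurrence n = trans (sym (cong₂ (λ a b → E (3 ℕ.+ n) ℚ.+ a ℚ.+ b)
      (trans (X²⋆-at (C ¼ ⋆ E) (suc n)) (C⋆-at ¼ E (suc n)))
      (trans (X³⋆-at (C ¼ ⋆ E) n) (C⋆-at ¼ E n))))
    (at (≈-trans (solve 2 (λ x e → e :+ x :* (x :* (con ¼ :* e)) :+ x :* (x :* (x :* (con ¼ :* e)))
        := (con 1ℚ :+ con ¼ :* (x :* x :* (con 1ℚ :+ x))) :* e) ≈-refl X E) Q⋆E) (3 ℕ.+ n))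
    where open Solver

-- Geometric decay of coefficients, and sums with geometric weights

module GeometricDecay where

  open import Data.Rational.Base
  open import Data.Rational.Properties
  open import Data.Rational.Solver using (module +-*-Solver)
  open Rationals
  open PowerSeries using (Series; tail; _⋆_; ones; ⋆-suc)
  open WalkSeries

  open +-*-Solver

  ⅘ : ℚ
  ⅘ = ℤ.+ 4 / 5

  ⅘^_ : ℕ → ℚ
  ⅘^ zero    = 1ℚ
  ⅘^ (suc n) = ⅘ * ⅘^ n

  0≤⅘^ : ∀ n → 0ℚ ≤ ⅘^ n
  0≤⅘^ zero    = 0≤1
  0≤⅘^ (suc n) = 0≤* (nonNegative⁻¹ ⅘) (0≤⅘^ n)

  ⅘^-+ : ∀ m n → ⅘^ (m ℕ.+ n) ≡ ⅘^ m * ⅘^ n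
  ⅘^-+ zero    n = sym (*-identityˡ (⅘^ n))
  ⅘^-+ (suc m) n = trans (cong (⅘ *_) (⅘^-+ m n)) (sym (*-assoc ⅘ (⅘^ m) (⅘^ n)))

  -- x³ ≥ (x + 1)/4 for x = 4/5.
  decay : ∀ (f : ℕ → ℚ) → ∣ f 0 ∣ ≤ ⅘^ 0 → ∣ f 1 ∣ ≤ ⅘^ 1 → ∣ f 2 ∣ ≤ ⅘^ 2 →
    (∀ n → ∣ f (3 ℕ.+ n) ∣ ≤ ¼ * (∣ f (1 ℕ.+ n) ∣ + ∣ f n ∣)) → ∀ n → ∣ f n ∣ ≤ ⅘^ n
  decay f h₀ h₁ h₂ h 0 = h₀
  decay f h₀ h₁ h₂ h 1 = h₁
  decay f h₀ h₁ h₂ h 2 = h₂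
  decay f h₀ h₁ h₂ h (suc (suc (suc n))) = begin
    ∣ f (3 ℕ.+ n) ∣                     ≤⟨ h n ⟩
    ¼ * (∣ f (1 ℕ.+ n) ∣ + ∣ f n ∣)     ≤⟨ *-monoˡ (nonNegative⁻¹ ¼) (+-mono-≤ (decay f h₀ h₁ h₂ h (suc n)) (decay f h₀ h₁ h₂ h n)) ⟩
    ¼ * (⅘ * ⅘^ n + ⅘^ n)               ≤⟨ ≤-by (ℤ.+ 31 / 500 * ⅘^ n) (0≤* (nonNegative⁻¹ (ℤ.+ 31 / 500)) (0≤⅘^ n))
                                             (solve 1 (λ a → con ¼ :* (con ⅘ :* a :+ a) :+ con (ℤ.+ 31 / 500) :* a
                                                          := con ⅘ :* (con ⅘ :* (con ⅘ :* a))) refl (⅘^ n)) ⟩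
    ⅘^ (3 ℕ.+ n)                        ∎
    where open ≤-Reasoning

  -- Divided by n + 3, both coefficients of `g-recurrence` are at most ¼ in absolute value.
  g-decay : ∀ n → ∣ g n ∣ ≤ ⅘^ n
  g-decay = decay g ≤-refl (nonNegative⁻¹ ⅘) (≤-by (⅘^ 2 - ℤ.+ 1 / 8) (nonNegative⁻¹ (⅘^ 2 - ℤ.+ 1 / 8)) refl) λ n →
    *-cancelˡ-≤ (0<ι (2 ℕ.+ n)) (begin
      ι (3 ℕ.+ n) * ∣ g (3 ℕ.+ n) ∣
        ≡⟨ cong (_* ∣ g (3 ℕ.+ n) ∣) (sym (0≤p⇒∣p∣≡p (0≤ι (3 ℕ.+ n)))) ⟩
      ∣ ι (3 ℕ.+ n) ∣ * ∣ g (3 ℕ.+ n) ∣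
        ≡⟨ ∣p*q∣≡∣p∣*∣q∣ (ι (3 ℕ.+ n)) (g (3 ℕ.+ n)) ⟨
      ∣ ι (3 ℕ.+ n) * g (3 ℕ.+ n) ∣
        ≡⟨ cong ∣_∣ (g-recurrence n) ⟩
      ∣ - (¼ * (ι (2 ℕ.+ n) * g (1 ℕ.+ n)) + (¼ * ι n + ⅜) * g n) ∣
        ≡⟨ trans (∣-p∣≡∣p∣ (¼ * (ι (2 ℕ.+ n) * g (1 ℕ.+ n)) + (¼ * ι n + ⅜) * g n))
             (cong (λ a → ∣ a + (¼ * ι n + ⅜) * g n ∣) (sym (*-assoc ¼ (ι (2 ℕ.+ n)) (g (1 ℕ.+ n))))) ⟩
      ∣ ¼ * ι (2 ℕ.+ n) * g (1 ℕ.+ n) + (¼ * ι n + ⅜) * g n ∣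
        ≤⟨ ∣p+q∣≤∣p∣+∣q∣ (¼ * ι (2 ℕ.+ n) * g (1 ℕ.+ n)) ((¼ * ι n + ⅜) * g n) ⟩
      ∣ ¼ * ι (2 ℕ.+ n) * g (1 ℕ.+ n) ∣ + ∣ (¼ * ι n + ⅜) * g n ∣
        ≡⟨ cong₂ _+_ (∣*∣ (g (1 ℕ.+ n)) (0≤* (nonNegative⁻¹ ¼) (0≤ι (2 ℕ.+ n))))
                     (∣*∣ (g n) (0≤+ (0≤* (nonNegative⁻¹ ¼) (0≤ι n)) (nonNegative⁻¹ ⅜))) ⟩
      ¼ * ι (2 ℕ.+ n) * ∣ g (1 ℕ.+ n) ∣ + (¼ * ι n + ⅜) * ∣ g n ∣
        ≤⟨ ≤-by (¼ * ∣ g (1 ℕ.+ n) ∣ + ⅜ * ∣ g n ∣)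
             (0≤+ (0≤* (nonNegative⁻¹ ¼) (0≤∣p∣ (g (1 ℕ.+ n)))) (0≤* (nonNegative⁻¹ ⅜) (0≤∣p∣ (g n))))
             (solve 3 (λ i a b → con ¼ :* (i :+ con 1ℚ :+ con 1ℚ) :* a :+ (con ¼ :* i :+ con ⅜) :* b :+ (con ¼ :* a :+ con ⅜ :* b)
               := (i :+ con 1ℚ :+ con 1ℚ :+ con 1ℚ) :* (con ¼ :* (a :+ b))) refl (ι n) ∣ g (1 ℕ.+ n) ∣ ∣ g n ∣) ⟩
      ι (3 ℕ.+ n) * (¼ * (∣ g (1 ℕ.+ n) ∣ + ∣ g n ∣)) ∎)
    where
    open ≤-Reasoning
    ∣*∣ : ∀ {a} b → 0ℚ ≤ a → ∣ a * b ∣ ≡ a * ∣ b ∣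
    ∣*∣ {a} b 0≤a = trans (∣p*q∣≡∣p∣*∣q∣ a b) (cong (_* ∣ b ∣) (0≤p⇒∣p∣≡p 0≤a))

  -- Subtracting the fixed point ⅔ makes `E-recurrence` homogeneous.
  E-decay : ∀ n → ∣ E n - ⅔ ∣ ≤ ⅘^ n
  E-decay = decay (λ n → E n - ⅔)
    (≤-by (ℤ.+ 2 / 3) (nonNegative⁻¹ (ℤ.+ 2 / 3)) refl)
    (≤-by (ℤ.+ 7 / 15) (nonNegative⁻¹ (ℤ.+ 7 / 15)) refl)
    (≤-by (⅘^ 2 - ℤ.+ 1 / 12) (nonNegative⁻¹ (⅘^ 2 - ℤ.+ 1 / 12)) refl) λ n → begin
      ∣ E (3 ℕ.+ n) - ⅔ ∣
        ≡⟨ cong ∣_∣ (trans (solve 3 (λ a b c → a :- con ⅔ := a :+ con ¼ :* b :+ con ¼ :* c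
                            :- con 1ℚ :+ :- (con ¼ :* (b :- con ⅔ :+ (c :- con ⅔)))) refl (E (3 ℕ.+ n)) (E (1 ℕ.+ n)) (E n))
             (trans (cong (λ a → a - 1ℚ + - (¼ * (E (1 ℕ.+ n) - ⅔ + (E n - ⅔)))) (E-recurrence n))
               (+-identityˡ (- (¼ * (E (1 ℕ.+ n) - ⅔ + (E n - ⅔))))))) ⟩
      ∣ - (¼ * (E (1 ℕ.+ n) - ⅔ + (E n - ⅔))) ∣
        ≡⟨ ∣-p∣≡∣p∣ (¼ * (E (1 ℕ.+ n) - ⅔ + (E n - ⅔))) ⟩
      ∣ ¼ * (E (1 ℕ.+ n) - ⅔ + (E n - ⅔)) ∣
        ≡⟨ ∣p*q∣≡∣p∣*∣q∣ ¼ (E (1 ℕ.+ n) - ⅔ + (E n - ⅔)) ⟩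
      ¼ * ∣ E (1 ℕ.+ n) - ⅔ + (E n - ⅔) ∣
        ≤⟨ *-monoˡ (nonNegative⁻¹ ¼) (∣p+q∣≤∣p∣+∣q∣ (E (1 ℕ.+ n) - ⅔) (E n - ⅔)) ⟩
      ¼ * (∣ E (1 ℕ.+ n) - ⅔ ∣ + ∣ E n - ⅔ ∣) ∎
    where open ≤-Reasoning

  ⋆ones-suc : ∀ f n → (f ⋆ ones) (suc n) ≡ f (suc n) + (f ⋆ ones) n
  ⋆ones-suc f n = trans (⋆-suc f ones n) (cong (_+ (f ⋆ ones) n) (*-identityʳ (f (suc n))))

  -- Bounds the i-th term of a convolution with `p`: the power of 4/5 comes from the decay of the
  -- left factor, i(i+1) from `p-ratio`.
  weight : Series
  weight n = ⅘^ n * (ι n * ι (suc n))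

  0≤weight : ∀ n → 0ℚ ≤ weight n
  0≤weight n = 0≤* (0≤⅘^ n) (0≤* (0≤ι n) (0≤ι (suc n)))

  Σ0≤ : ∀ f → (∀ n → 0ℚ ≤ f n) → ∀ n → 0ℚ ≤ (f ⋆ ones) n
  Σ0≤ f h zero    = 0≤* (h 0) 0≤1
  Σ0≤ f h (suc n) = subst (0ℚ ≤_) (sym (⋆ones-suc f n)) (0≤+ (h (suc n)) (Σ0≤ f h n))

  -- The second summand is the exact remainder of Σ i(i+1)xⁱ = 2x/(1-x)³, which is 200 at x = 4/5.
  Σweight : ∀ n → (weight ⋆ ones) n + ⅘^ n * (ι 4 * ι n * ι n + ι 44 * ι n + ι 200) ≡ ι 200
  Σweight zero    = refl
  Σweight (suc n) = begin
    (weight ⋆ ones) (suc n) + ⅘^ (suc n) * (ι 4 * ι (suc n) * ι (suc n) + ι 44 * ι (suc n) + ι 200)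
      ≡⟨ cong (_+ ⅘^ (suc n) * (ι 4 * ι (suc n) * ι (suc n) + ι 44 * ι (suc n) + ι 200)) (⋆ones-suc weight n) ⟩
    weight (suc n) + (weight ⋆ ones) n + ⅘^ (suc n) * (ι 4 * ι (suc n) * ι (suc n) + ι 44 * ι (suc n) + ι 200)
      ≡⟨ solve 3 (λ i a w → con ⅘ :* a :* ((i :+ con 1ℚ) :* (i :+ con 1ℚ :+ con 1ℚ)) :+ w
             :+ con ⅘ :* a :* (con (ι 4) :* (i :+ con 1ℚ) :* (i :+ con 1ℚ) :+ con (ι 44) :* (i :+ con 1ℚ) :+ con (ι 200))
           := w :+ a :* (con (ι 4) :* i :* i :+ con (ι 44) :* i :+ con (ι 200))) refl (ι n) (⅘^ n) ((weight ⋆ ones) n) ⟩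
    (weight ⋆ ones) n + ⅘^ n * (ι 4 * ι n * ι n + ι 44 * ι n + ι 200)
      ≡⟨ Σweight n ⟩
    ι 200 ∎
    where open ≡-Reasoning

  Σweight≤ : ∀ n → (weight ⋆ ones) n ≤ ι 200
  Σweight≤ n = ≤-by (⅘^ n * (ι 4 * ι n * ι n + ι 44 * ι n + ι 200))
    (0≤* (0≤⅘^ n) (0≤+ (0≤+ (0≤* (0≤* (0≤ι 4) (0≤ι n)) (0≤ι n)) (0≤* (0≤ι 44) (0≤ι n))) (0≤ι 200))) (Σweight n)

  -- Only the part 4n² + 4n of the quadratic polynomial in `Σweight` is kept, whence 200/4.
  ⅘^-bound : ∀ n → ⅘^ n * (ι n * ι (suc n)) ≤ ι 50
  ⅘^-bound n = *-cancelˡ-≤ (0<ι 3) (≤-by (((weight ⋆ ones) n + ⅘^ n * (ι 40 * ι n + ι 200)))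
    (0≤+ (Σ0≤ weight 0≤weight n) (0≤* (0≤⅘^ n) (0≤+ (0≤* (0≤ι 40) (0≤ι n)) (0≤ι 200))))
    (trans (solve 3 (λ a i w → con (ι 4) :* (a :* (i :* (i :+ con 1ℚ))) :+ (w :+ a :* (con (ι 40) :* i :+ con (ι 200)))
        := w :+ a :* (con (ι 4) :* i :* i :+ con (ι 44) :* i :+ con (ι 200))) refl (⅘^ n) (ι n) ((weight ⋆ ones) n))
      (Σweight n)))

  ⋆-bound : ∀ f h β n → (∀ i k → i ℕ.+ k ≡ n → ∣ f i * h k ∣ ≤ β i) → ∣ (f ⋆ h) n ∣ ≤ (β ⋆ ones) n
  ⋆-bound f h β zero    b = subst (∣ f 0 * h 0 ∣ ≤_) (sym (*-identityʳ (β 0))) (b 0 0 refl)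
  ⋆-bound f h β (suc n) b = ∣p+q∣≤ (subst (∣ f 0 * h (suc n) ∣ ≤_) (sym (*-identityʳ (β 0))) (b 0 (suc n) refl))
    (⋆-bound (tail f) h (tail β) n (λ i k eq → b (suc i) k (cong suc eq)))

  Σ-const : ∀ c n → ((λ _ → c) ⋆ ones) n ≡ ι (suc n) * c
  Σ-const c zero    = solve 1 (λ c → c :* con 1ℚ := (con 0ℚ :+ con 1ℚ) :* c) refl c
  Σ-const c (suc n) = trans (cong (c * 1ℚ +_) (Σ-const c n))
    (solve 2 (λ c i → c :* con 1ℚ :+ i :* c := (i :+ con 1ℚ) :* c) refl c (ι (suc n)))

  Σ-scale : ∀ c f n → ((λ i → f i * c) ⋆ ones) n ≡ (f ⋆ ones) n * c
  Σ-scale c f zero    = solve 2 (λ c a → a :* c :* con 1ℚ := a :* con 1ℚ :* c) refl c (f 0)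
  Σ-scale c f (suc n) = trans (cong (f 0 * c * 1ℚ +_) (Σ-scale c (tail f) n))
    (solve 3 (λ c a b → a :* c :* con 1ℚ :+ b :* c := (a :* con 1ℚ :+ b) :* c) refl c (f 0) ((tail f ⋆ ones) n))

  -- Isolates the main term of a convolution: what remains involves only the deviations of `h` from
  -- `c`, which in the applications is `h n`.
  ⋆-centre : ∀ f h c n → (f ⋆ h) n - (f ⋆ ones) n * c ≡ (f ⋆ (λ k → h k - c)) n
  ⋆-centre f h c zero    = solve 3 (λ a b c → a :* b :- a :* con 1ℚ :* c := a :* (b :- c)) refl (f 0) (h 0) c
  ⋆-centre f h c (suc n) = trans
    (solve 5 (λ a b c u v → a :* b :+ u :- (a :* con 1ℚ :+ v) :* c := a :* (b :- c) :+ (u :- v :* c)) refl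
      (f 0) (h (suc n)) c ((tail f ⋆ h) n) ((tail f ⋆ ones) n))
    (cong (f 0 * (h (suc n) - c) +_) (⋆-centre (tail f) h c n))

-- Asymptotics of G² and of the defect series T

module Asymptotics where

  open import Data.Rational.Base
  open import Data.Rational.Properties
  open import Data.Rational.Solver using (module +-*-Solver)
  open import Defs using (∣p-q∣≡∣q-p∣)
  open Rationals
  open PowerSeries hiding (module Solver)
  open WalkSeries
  open GeometricDecay

  open +-*-Solver

  -- The closed form of the geometric sum over k < j ≤ i + k; keeping the subtracted power lets the
  -- induction close.
  G-tail : ∀ i k → ∣ G (i ℕ.+ k) - G k ∣ ≤ ι 4 * ⅘^ k - ι 4 * ⅘^ (i ℕ.+ k)
  G-tail zero    k = ≤-reflexive (trans (cong ∣_∣ (+-inverseʳ (G k))) (sym (+-inverseʳ (ι 4 * ⅘^ k))))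
  G-tail (suc i) k = begin
    ∣ G (suc i ℕ.+ k) - G k ∣
      ≡⟨ cong ∣_∣ (trans (cong (_- G k) (⋆ones-suc g (i ℕ.+ k)))
           (+-assoc (g (suc i ℕ.+ k)) (G (i ℕ.+ k)) (- G k))) ⟩
    ∣ g (suc i ℕ.+ k) + (G (i ℕ.+ k) - G k) ∣
      ≤⟨ ∣p+q∣≤ (g-decay (suc i ℕ.+ k)) (G-tail i k) ⟩
    ⅘ * ⅘^ (i ℕ.+ k) + (ι 4 * ⅘^ k - ι 4 * ⅘^ (i ℕ.+ k))
      ≡⟨ solve 2 (λ a b → con ⅘ :* a :+ (con (ι 4) :* b :- con (ι 4) :* a) := con (ι 4) :* b :- con (ι 4) :* (con ⅘ :* a))
           refl (⅘^ (i ℕ.+ k)) (⅘^ k) ⟩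
    ι 4 * ⅘^ k - ι 4 * ⅘^ (suc i ℕ.+ k) ∎
    where open ≤-Reasoning

  -- The difference is the sum of g i (G k - G n) over i + k = n. The decay of g i and that of G k -
  -- G n multiply to the same power for every i, so each of the n + 1 terms has the same bound.
  ∣G²-E∣ : ∀ n → ∣ E n - G n * G n ∣ ≤ ι (suc n) * (ι 4 * ⅘^ n)
  ∣G²-E∣ n = begin
    ∣ E n - G n * G n ∣
      ≡⟨ cong ∣_∣ (⋆-centre g G (G n) n) ⟩
    ∣ (g ⋆ (λ k → G k - G n)) n ∣
      ≤⟨ ⋆-bound g (λ k → G k - G n) (λ _ → ι 4 * ⅘^ n) n bound ⟩
    ((λ _ → ι 4 * ⅘^ n) ⋆ ones) n
      ≡⟨ Σ-const (ι 4 * ⅘^ n) n ⟩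
    ι (suc n) * (ι 4 * ⅘^ n) ∎
    where
    open ≤-Reasoning
    bound : ∀ i k → i ℕ.+ k ≡ n → ∣ g i * (G k - G n) ∣ ≤ ι 4 * ⅘^ n
    bound i k refl = begin
      ∣ g i * (G k - G (i ℕ.+ k)) ∣
        ≤⟨ ∣p*q∣≤ (g-decay i) (subst (_≤ ι 4 * ⅘^ k) (∣p-q∣≡∣q-p∣ (G (i ℕ.+ k)) (G k)) (≤-trans (G-tail i k)
             (≤-by (ι 4 * ⅘^ (i ℕ.+ k)) (0≤* (0≤ι 4) (0≤⅘^ (i ℕ.+ k)))
               (solve 2 (λ a b → a :- b :+ b := a) refl (ι 4 * ⅘^ k) (ι 4 * ⅘^ (i ℕ.+ k)))))) ⟩
      ⅘^ i * (ι 4 * ⅘^ k)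
        ≡⟨ solve 3 (λ a b c → a :* (b :* c) := b :* (a :* c)) refl (⅘^ i) (ι 4) (⅘^ k) ⟩
      ι 4 * (⅘^ i * ⅘^ k)
        ≡⟨ cong (ι 4 *_) (⅘^-+ i k) ⟨
      ι 4 * ⅘^ (i ℕ.+ k) ∎

  n⅘^n≤50 : ∀ n → ι n * ⅘^ n ≤ ι 50
  n⅘^n≤50 n = ≤-trans (≤-by (⅘^ n * (ι n * ι n)) (0≤* (0≤⅘^ n) (0≤* (0≤ι n) (0≤ι n)))
    (solve 2 (λ a i → i :* a :+ a :* (i :* i) := a :* (i :* (i :+ con 1ℚ))) refl (⅘^ n) (ι n))) (⅘^-bound n)

  -- 250 is 50 from `n⅘^n≤50` plus 4 · 50 from `⅘^-bound`.
  G²-limit : ∀ n → ι n * ∣ G n * G n - ⅔ ∣ ≤ ι 250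
  G²-limit n = begin
    ι n * ∣ G n * G n - ⅔ ∣
      ≡⟨ cong (λ a → ι n * ∣ a ∣) (solve 2 (λ s e → s :- con ⅔ := e :- con ⅔ :- (e :- s)) refl (G n * G n) (E n)) ⟩
    ι n * ∣ E n - ⅔ - (E n - G n * G n) ∣
      ≤⟨ *-monoˡ (0≤ι n) (∣p-q∣≤ (E-decay n) (∣G²-E∣ n)) ⟩
    ι n * (⅘^ n + ι (suc n) * (ι 4 * ⅘^ n))
      ≡⟨ solve 3 (λ i j a → i :* (a :+ j :* (con (ι 4) :* a)) := i :* a :+ con (ι 4) :* (a :* (i :* j))) refl (ι n) (ι (suc n)) (⅘^ n) ⟩
    ι n * ⅘^ n + ι 4 * (⅘^ n * (ι n * ι (suc n)))
      ≤⟨ +-mono-≤ (n⅘^n≤50 n) (*-monoˡ (0≤ι 4) (⅘^-bound n)) ⟩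
    ι 250 ∎
    where open ≤-Reasoning

  p-antimono : ∀ i k → p (i ℕ.+ k) ≤ p k
  p-antimono zero    k = ≤-refl
  p-antimono (suc i) k = ≤-trans (*-cancelˡ-≤ (0<ι (i ℕ.+ k)) (≤-by (½ * p (i ℕ.+ k)) (0≤* (nonNegative⁻¹ ½) (0≤p (i ℕ.+ k)))
    (trans (cong (_+ ½ * p (i ℕ.+ k)) (p-suc (i ℕ.+ k)))
      (solve 2 (λ i a → (i :+ con ½) :* a :+ con ½ :* a := (i :+ con 1ℚ) :* a) refl (ι (i ℕ.+ k)) (p (i ℕ.+ k))))))
    (p-antimono i k)

  -- Equivalent to n (p k - p n) ≤ i(i+1) p n with n = i + k: over i steps `p` varies by a relative
  -- amount O(i²/n). In the induction on i the factor grows from n to n + 1, and the extra `p k` is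
  -- absorbed by the cruder `p≤-ratio`.
  p-ratio : ∀ i k → ι (i ℕ.+ k) * p k ≤ (ι (i ℕ.+ k) + ι i * ι (suc i)) * p (i ℕ.+ k)
  p≤-ratio : ∀ i k → p k ≤ ι (suc i) * p (i ℕ.+ k)

  p≤-ratio zero    k = ≤-reflexive (sym (*-identityˡ (p k)))
  p≤-ratio (suc i) k = ≤-trans (p≤-ratio i k) (*-cancelˡ-≤ (0<ι (i ℕ.+ k)) (≤-by
    ((½ * ι i + ι k) * p (i ℕ.+ k))
    (0≤* (0≤+ (0≤* (nonNegative⁻¹ ½) (0≤ι i)) (0≤ι k)) (0≤p (i ℕ.+ k)))
    (trans (cong (λ m → (m + 1ℚ) * (ι (suc i) * p (i ℕ.+ k)) + (½ * ι i + ι k) * p (i ℕ.+ k)) (ι-+ i k))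
    (trans (solve 3 (λ i k a → (i :+ k :+ con 1ℚ) :* ((i :+ con 1ℚ) :* a) :+ (con ½ :* i :+ k) :* a
        := (i :+ con 1ℚ :+ con 1ℚ) :* ((i :+ k :+ con ½) :* a)) refl (ι i) (ι k) (p (i ℕ.+ k)))
    (trans (cong (λ m → ι (2 ℕ.+ i) * ((m + ½) * p (i ℕ.+ k))) (sym (ι-+ i k)))
    (trans (cong (ι (2 ℕ.+ i) *_) (sym (p-suc (i ℕ.+ k))))
      (solve 3 (λ a b c → a :* (b :* c) := b :* (a :* c)) refl (ι (2 ℕ.+ i)) (ι (suc (i ℕ.+ k))) (p (suc i ℕ.+ k)))))))))

  p-ratio zero    k = ≤-reflexive (solve 2 (λ k a → k :* a := (k :+ con 0ℚ :* (con 0ℚ :+ con 1ℚ)) :* a) refl (ι k) (p k))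
  p-ratio (suc i) k = *-cancelˡ-≤ (0<ι m) (begin
    ι (suc m) * (ι (suc m) * p k)
      ≡⟨ cong (ι (suc m) *_) (*-distribʳ-+ (p k) (ι m) 1ℚ) ⟩
    ι (suc m) * (ι m * p k + 1ℚ * p k)
      ≤⟨ *-monoˡ (0≤ι (suc m)) (+-mono-≤ (p-ratio i k) (≤-trans (≤-reflexive (*-identityˡ (p k))) (p≤-ratio i k))) ⟩
    ι (suc m) * ((ι m + ι i * ι (suc i)) * p m + ι (suc i) * p m)
      ≤⟨ ≤-by (½ * (ι i * ι i + ι 2 * ι i + ι 2 * ι i * ι k + ι 3 * ι k + 1ℚ) * p m)
           (0≤* (0≤* (nonNegative⁻¹ ½) (0≤+ (0≤+ (0≤+ (0≤+ (0≤* (0≤ι i) (0≤ι i)) (0≤* (0≤ι 2) (0≤ι i)))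
             (0≤* (0≤* (0≤ι 2) (0≤ι i)) (0≤ι k))) (0≤* (0≤ι 3) (0≤ι k))) 0≤1)) (0≤p m))
           (subst (λ m′ → (m′ + 1ℚ) * ((m′ + ι i * ι (suc i)) * p m + ι (suc i) * p m)
                     + ½ * (ι i * ι i + ι 2 * ι i + ι 2 * ι i * ι k + ι 3 * ι k + 1ℚ) * p m
                     ≡ (m′ + 1ℚ + ι (suc i) * ι (2 ℕ.+ i)) * ((m′ + ½) * p m)) (sym (ι-+ i k))
             (solve 3 (λ i k a → (i :+ k :+ con 1ℚ) :* ((i :+ k :+ i :* (i :+ con 1ℚ)) :* a :+ (i :+ con 1ℚ) :* a)
                 :+ con ½ :* (i :* i :+ con (ι 2) :* i :+ con (ι 2) :* i :* k :+ con (ι 3) :* k :+ con 1ℚ) :* a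
                 := (i :+ k :+ con 1ℚ :+ (i :+ con 1ℚ) :* (i :+ con 1ℚ :+ con 1ℚ)) :* ((i :+ k :+ con ½) :* a))
               refl (ι i) (ι k) (p m))) ⟩
    (ι (suc m) + ι (suc i) * ι (2 ℕ.+ i)) * ((ι m + ½) * p m)
      ≡⟨ cong ((ι (suc m) + ι (suc i) * ι (2 ℕ.+ i)) *_) (p-suc m) ⟨
    (ι (suc m) + ι (suc i) * ι (2 ℕ.+ i)) * (ι (suc m) * p (suc m))
      ≡⟨ solve 3 (λ a b c → a :* (b :* c) := b :* (a :* c)) refl (ι (suc m) + ι (suc i) * ι (2 ℕ.+ i)) (ι (suc m)) (p (suc m)) ⟩
    ι (suc m) * ((ι (suc m) + ι (suc i) * ι (2 ℕ.+ i)) * p (suc m)) ∎)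
    where
    open ≤-Reasoning
    m = i ℕ.+ k

  record Decays (K : ℚ) (f : Series) : Set where
    constructor decays
    field bound : ∀ n → ∣ f n ∣ ≤ K * ⅘^ n
  open Decays

  decays-⊕ : ∀ {K L f h} → Decays K f → Decays L h → Decays (K + L) (f ⊕ h)
  decays-⊕ {K} {L} df dh = decays λ n →
    ≤-trans (∣p+q∣≤ (bound df n) (bound dh n)) (≤-reflexive (sym (*-distribʳ-+ (⅘^ n) K L)))

  decays-C : ∀ {K f} a → Decays K f → Decays (∣ a ∣ * K) (C a ⋆ f)
  decays-C {K} {f} a df = decays λ n → ≤-trans (≤-reflexive (cong ∣_∣ (C⋆-at a f n)))
    (≤-trans (∣p*q∣≤ {a} {f n} ≤-refl (bound df n)) (≤-reflexive (sym (*-assoc ∣ a ∣ K (⅘^ n)))))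

  decays-X : ∀ {K f} → 0ℚ ≤ K → Decays K f → Decays (ℤ.+ 5 / 4 * K) (X ⋆ f)
  decays-X {K} {f} 0≤K df = decays λ
    { zero    → subst (λ a → ∣ a ∣ ≤ ℤ.+ 5 / 4 * K * 1ℚ) (sym (X⋆-zero f))
                  (0≤* (0≤* (nonNegative⁻¹ (ℤ.+ 5 / 4)) 0≤K) 0≤1)
    ; (suc n) → subst₂ _≤_ (cong ∣_∣ (sym (X⋆-suc f n)))
                  (solve 2 (λ k a → k :* a := con (ℤ.+ 5 / 4) :* k :* (con ⅘ :* a)) refl K (⅘^ n)) (bound df n) }

  decays-≤ : ∀ {K L f} → K ≤ L → Decays K f → Decays L f
  decays-≤ K≤L df = decays λ n → ≤-trans (bound df n) (*-monoʳ (0≤⅘^ n) K≤L)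

  ⋆-scaleʳ : ∀ c f h n → (f ⋆ (λ k → c * h k)) n ≡ c * (f ⋆ h) n
  ⋆-scaleʳ c f h n = trans (⋆-comm-at f (λ k → c * h k) n) (trans (scale⋆-at c h f n) (cong (c *_) (⋆-comm-at h f n)))

  -- Since p varies slowly, the coefficients of f ⋆ p are asymptotic to p
  -- times the partial sums of f.
  ⋆p-asymptotic : ∀ {K} f → 0ℚ ≤ K → Decays K f →
    ∀ n → ι n * ∣ (f ⋆ p) n - (f ⋆ ones) n * p n ∣ ≤ ι 200 * K * p n
  ⋆p-asymptotic {K} f 0≤K df n = begin
    ι n * ∣ (f ⋆ p) n - (f ⋆ ones) n * p n ∣
      ≡⟨ cong (λ a → ι n * ∣ a ∣) (⋆-centre f p (p n) n) ⟩
    ι n * ∣ (f ⋆ (λ k → p k - p n)) n ∣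
      ≡⟨ cong (_* ∣ (f ⋆ (λ k → p k - p n)) n ∣) (sym (0≤p⇒∣p∣≡p (0≤ι n))) ⟩
    ∣ ι n ∣ * ∣ (f ⋆ (λ k → p k - p n)) n ∣
      ≡⟨ ∣p*q∣≡∣p∣*∣q∣ (ι n) ((f ⋆ (λ k → p k - p n)) n) ⟨
    ∣ ι n * (f ⋆ (λ k → p k - p n)) n ∣
      ≡⟨ cong ∣_∣ (⋆-scaleʳ (ι n) f (λ k → p k - p n) n) ⟨
    ∣ (f ⋆ (λ k → ι n * (p k - p n))) n ∣
      ≤⟨ ⋆-bound f (λ k → ι n * (p k - p n)) (λ i → weight i * (K * p n)) n term ⟩
    ((λ i → weight i * (K * p n)) ⋆ ones) n
      ≡⟨ Σ-scale (K * p n) weight n ⟩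
    (weight ⋆ ones) n * (K * p n)
      ≤⟨ *-monoʳ (0≤* 0≤K (0≤p n)) (Σweight≤ n) ⟩
    ι 200 * (K * p n)
      ≡⟨ *-assoc (ι 200) K (p n) ⟨
    ι 200 * K * p n ∎
    where
    open ≤-Reasoning
    term : ∀ i k → i ℕ.+ k ≡ n → ∣ f i * (ι n * (p k - p n)) ∣ ≤ weight i * (K * p n)
    term i k refl = begin
      ∣ f i * (ι m * (p k - p m)) ∣
        ≤⟨ ∣p*q∣≤ (bound df i) (≤-trans (≤-reflexive (0≤p⇒∣p∣≡p (0≤* (0≤ι m) (diff≥0 (p-antimono i k)))))
             (subst₂ _≤_ (solve 3 (λ i a b → i :* a :- i :* b := i :* (a :- b)) refl (ι m) (p k) (p m))
                         (solve 3 (λ i w b → (i :+ w) :* b :- i :* b := w :* b) refl (ι m) (ι i * ι (suc i)) (p m))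
               (+-monoˡ-≤ (- (ι m * p m)) (p-ratio i k)))) ⟩
      K * ⅘^ i * (ι i * ι (suc i) * p m)
        ≡⟨ solve 4 (λ k a w b → k :* a :* (w :* b) := a :* w :* (k :* b)) refl K (⅘^ i) (ι i * ι (suc i)) (p m) ⟩
      weight i * (K * p m) ∎
      where m = i ℕ.+ k

  ⅞ ⅛ : ℚ
  ⅞ = ℤ.+ 7 / 8
  ⅛ = ℤ.+ 1 / 8

  -- Multiplication by 1 - X/2 + X²/4 + X³/8, whose coefficients are those of `defect` divided by 4.
  κ : Series → Series
  κ f = f ⊕ C (- ½) ⋆ (X ⋆ f) ⊕ C ¼ ⋆ (X ⋆ (X ⋆ f)) ⊕ C ⅛ ⋆ (X ⋆ (X ⋆ (X ⋆ f)))

  -- The proportion of flimsy numbers is 1/4 - T (N + 1).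
  T : Series
  T = κ (V 0)

  -- κ(X) = 7/8 + (1 - X)(1/8 - 3/8 X - 1/8 X²)
  r : Series
  r = C ⅛ ⋆ g ⊕ C (- ⅜) ⋆ (X ⋆ g) ⊕ C (- ⅛) ⋆ (X ⋆ (X ⋆ g))

  κg⋆p : κ g ⋆ p ≈ T
  κg⋆p = ≈-trans (PowerSeries.Solver.solve 3 (λ x g p →
       (g S.:+ S.con (- ½) S.:* (x S.:* g) S.:+ S.con ¼ S.:* (x S.:* (x S.:* g)) S.:+ S.con ⅛ S.:* (x S.:* (x S.:* (x S.:* g)))) S.:* p
       S.:= g S.:* p S.:+ S.con (- ½) S.:* (x S.:* (g S.:* p)) S.:+ S.con ¼ S.:* (x S.:* (x S.:* (g S.:* p)))
           S.:+ S.con ⅛ S.:* (x S.:* (x S.:* (x S.:* (g S.:* p))))) ≈-refl X g p)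
    (⊕-cong (⊕-cong (⊕-cong g⋆p (⋆-congˡ (C (- ½)) (⋆-congˡ X g⋆p))) (⋆-congˡ (C ¼) (⋆-congˡ X (⋆-congˡ X g⋆p))))
      (⋆-congˡ (C ⅛) (⋆-congˡ X (⋆-congˡ X (⋆-congˡ X g⋆p)))))
    where
    module S = PowerSeries.Solver
    ⊕-cong : ∀ {f f′ h h′} → f ≈ f′ → h ≈ h′ → f ⊕ h ≈ f′ ⊕ h′
    ⊕-cong u v = pointwise λ n → cong₂ _+_ (at u n) (at v n)

  -- As `ones` is 1/(1 - X), the part of the multiplier divisible by 1 - X leaves no partial sums
  -- but only the decaying `r`; its value 7/8 at X = 1 remains in front of `G`.
  κg⋆ones : κ g ⋆ ones ≈ C ⅞ ⋆ G ⊕ r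
  κg⋆ones = ≈-trans (S.solve 3 (λ x g o →
       (g S.:+ S.con (- ½) S.:* (x S.:* g) S.:+ S.con ¼ S.:* (x S.:* (x S.:* g)) S.:+ S.con ⅛ S.:* (x S.:* (x S.:* (x S.:* g)))) S.:* o
       S.:= S.con ⅞ S.:* (g S.:* o) S.:+ (S.con ⅛ S.:* g S.:+ S.con (- ⅜) S.:* (x S.:* g) S.:+ S.con (- ⅛) S.:* (x S.:* (x S.:* g))) S.:* (o S.:* (S.con 1ℚ S.:- x)))
       ≈-refl X g ones)
    (≈-trans (⊕-congˡ (C ⅞ ⋆ G) (⋆-congˡ r ones⋆[1-X]))
      (S.solve 2 (λ a r → a S.:+ r S.:* S.con 1ℚ S.:= a S.:+ r) ≈-refl (C ⅞ ⋆ G) r))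
    where module S = PowerSeries.Solver

  g-decays : Decays 1ℚ g
  g-decays = decays λ n → subst (∣ g n ∣ ≤_) (sym (*-identityˡ (⅘^ n))) (g-decay n)

  κg-decays : Decays (ι 3) (κ g)
  κg-decays = decays-≤ (≤-by {K} (ι 3 - K) (nonNegative⁻¹ (ι 3 - K)) refl)
    (decays-⊕ (decays-⊕ (decays-⊕ g-decays (decays-C (- ½) Xg)) (decays-C ¼ XXg)) (decays-C ⅛ (decays-X (nonNegative⁻¹ _) XXg)))
    where
    Xg = decays-X 0≤1 g-decays
    XXg = decays-X (nonNegative⁻¹ _) Xg
    K = 1ℚ + ½ * (ℤ.+ 5 / 4) + ¼ * (ℤ.+ 25 / 16) + ⅛ * (ℤ.+ 125 / 64)

  r-decays : Decays 1ℚ r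
  r-decays = decays-≤ (≤-by {K} (1ℚ - K) (nonNegative⁻¹ (1ℚ - K)) refl)
    (decays-⊕ (decays-⊕ (decays-C ⅛ g-decays) (decays-C (- ⅜) Xg)) (decays-C (- ⅛) (decays-X (nonNegative⁻¹ _) Xg)))
    where
    Xg = decays-X 0≤1 g-decays
    K = ⅛ + ⅜ * (ℤ.+ 5 / 4) + ⅛ * (ℤ.+ 25 / 16)

  -- 650 is 200 · 3, from `⋆p-asymptotic` with the constant of `κg-decays`, plus 50 for the term
  -- `r n * p n`.
  T-asymptotic : ∀ n → ι n * ∣ T n - ⅞ * G n * p n ∣ ≤ ι 650 * p n
  T-asymptotic n = begin
    ι n * ∣ T n - ⅞ * G n * p n ∣
      ≡⟨ cong (λ a → ι n * ∣ a ∣) (trans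
           (solve 4 (λ t a r b → t :- a :* b := t :- (a :+ r) :* b :+ r :* b) refl (T n) (⅞ * G n) (r n) (p n))
           (cong₂ (λ t a → t - a * p n + r n * p n) (sym (at κg⋆p n))
             (sym (trans (at κg⋆ones n) (cong (_+ r n) (C⋆-at ⅞ G n)))))) ⟩
    ι n * ∣ (κ g ⋆ p) n - (κ g ⋆ ones) n * p n + r n * p n ∣
      ≤⟨ *-monoˡ (0≤ι n) (∣p+q∣≤∣p∣+∣q∣ ((κ g ⋆ p) n - (κ g ⋆ ones) n * p n) (r n * p n)) ⟩
    ι n * (∣ (κ g ⋆ p) n - (κ g ⋆ ones) n * p n ∣ + ∣ r n * p n ∣)
      ≡⟨ *-distribˡ-+ (ι n) ∣ (κ g ⋆ p) n - (κ g ⋆ ones) n * p n ∣ ∣ r n * p n ∣ ⟩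
    ι n * ∣ (κ g ⋆ p) n - (κ g ⋆ ones) n * p n ∣ + ι n * ∣ r n * p n ∣
      ≤⟨ +-mono-≤ (⋆p-asymptotic (κ g) (0≤ι 3) κg-decays n)
           (*-monoˡ (0≤ι n) (∣p*q∣≤ {r n} {p n} (bound r-decays n) (≤-reflexive (0≤p⇒∣p∣≡p (0≤p n))))) ⟩
    ι 200 * ι 3 * p n + ι n * (1ℚ * ⅘^ n * p n)
      ≡⟨ cong (ι 200 * ι 3 * p n +_) (solve 3 (λ i a b → i :* (con 1ℚ :* a :* b) := i :* a :* b) refl (ι n) (⅘^ n) (p n)) ⟩
    ι 200 * ι 3 * p n + ι n * ⅘^ n * p n
      ≤⟨ +-monoʳ-≤ (ι 200 * ι 3 * p n) (*-monoʳ (0≤p n) (n⅘^n≤50 n)) ⟩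
    ι 200 * ι 3 * p n + ι 50 * p n
      ≡⟨ *-distribʳ-+ (p n) (ι 200 * ι 3) (ι 50) ⟨
    (ι 200 * ι 3 + ι 50) * p n
      ≡⟨⟩
    ι 650 * p n ∎
    where open ≤-Reasoning

-- Counting flimsy numbers by the carry walk

module Counting where

  open import Data.Bool.Base using (Bool; true; false)
  open import Data.Digit using (toDigits; fromDigits; Expansion; 0b; 1b)
  open import Data.Empty using (⊥-elim)
  open import Data.Fin.Base using (Fin; zero; suc; toℕ)
  open import Data.List.Base using (List; []; _∷_; filter; length; map; applyUpTo)
  open import Data.Nat.Base using (ℕ; zero; suc; _+_; _*_; _^_; _≤_; _<_; _<ᵇ_)
  open import Data.Nat.Properties
  open import Data.Nat.ListAction using (sum)
  open import Data.Nat.Solver using (module +-*-Solver)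
  open import Data.Rational.Base as ℚ using (ℚ; 0ℚ; 1ℚ; ½)
  import Data.Rational.Properties as ℚ
  open import Data.Rational.Solver using () renaming (module +-*-Solver to ℚ-Solver)
  open import Relation.Nullary.Decidable using (yes; no; does; Dec; _×-dec_)
  open import Relation.Unary using (Decidable)
  open import Defs using (s₂; flimsyCount; flimsy?)
  open Rationals using (ι; ι-+; 0≤+; 0≤*)
  open PowerSeries using (X; _⋆_; C⋆-at; X⋆-zero; X⋆-suc)
  open WalkSeries using (W; V; 0≤W; ¼; X²⋆-at; X³⋆-at)
  open Asymptotics using (T; ⅛)

  digit-unique : ∀ (d e : Fin 2) x y → toℕ d + x * 2 ≡ toℕ e + y * 2 → toℕ d ≡ toℕ e × x ≡ y
  digit-unique zero       zero       x y eq = refl , *-cancelʳ-≡ x y 2 eq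
  digit-unique (suc zero) (suc zero) x y eq = refl , *-cancelʳ-≡ x y 2 (suc-injective eq)
  digit-unique zero       (suc zero) x y eq = ⊥-elim (even≢odd x y (trans (*-comm 2 x) (trans eq (cong suc (*-comm y 2)))))
  digit-unique (suc zero) zero       x y eq = ⊥-elim (even≢odd y x (trans (*-comm 2 y) (trans (sym eq) (cong suc (*-comm x 2)))))

  digitSum : Expansion 2 → ℕ
  digitSum ds = sum (map toℕ ds)

  -- Leading zeros do not matter, so `s₂` may be computed from any expansion of a number and not
  -- only from the one that `toDigits` returns.
  digitSum-unique : ∀ ds es → fromDigits ds ≡ fromDigits es → digitSum ds ≡ digitSum es
  digitSum-unique []       []       eq = refl
  digitSum-unique []       (e ∷ es) eq =
    let d≡e , x≡y = digit-unique zero e 0 (fromDigits es) eq in cong₂ _+_ d≡e (digitSum-unique [] es x≡y)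
  digitSum-unique (d ∷ ds) []       eq =
    let d≡e , x≡y = digit-unique d zero (fromDigits ds) 0 eq in cong₂ _+_ d≡e (digitSum-unique ds [] x≡y)
  digitSum-unique (d ∷ ds) (e ∷ es) eq =
    let d≡e , x≡y = digit-unique d e (fromDigits ds) (fromDigits es) eq in cong₂ _+_ d≡e (digitSum-unique ds es x≡y)

  s₂-even : ∀ m → s₂ (m * 2) ≡ s₂ m
  s₂-even m with toDigits 2 (m * 2) | toDigits 2 m
  ... | ds , p | es , q = digitSum-unique ds (0b ∷ es) (trans p (cong (_* 2) (sym q)))

  s₂-odd : ∀ m → s₂ (1 + m * 2) ≡ 1 + s₂ m
  s₂-odd m with toDigits 2 (1 + m * 2) | toDigits 2 m
  ... | ds , p | es , q = digitSum-unique ds (1b ∷ es) (trans p (cong (λ a → 1 + a * 2) (sym q)))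

  bit : Bool → ℕ
  bit true  = 1
  bit false = 0

  bit-×-no : ∀ {P Q : Set} (P? : Dec P) (Q? : Dec Q) → ¬ P → bit (does (P? ×-dec Q?)) ≡ 0
  bit-×-no (yes p) Q? ¬p = contradiction p ¬p
  bit-×-no (no  _) Q? ¬p = refl

  bit-×-yes : ∀ {P Q : Set} (P? : Dec P) (Q? : Dec Q) → P → bit (does (P? ×-dec Q?)) ≡ bit (does Q?)
  bit-×-yes (yes _) Q? p = refl
  bit-×-yes (no ¬p) Q? p = contradiction p ¬p

  Σ< : ℕ → (ℕ → ℕ) → ℕ
  Σ< zero    f = 0
  Σ< (suc n) f = f 0 + Σ< n (λ i → f (suc i))

  Σ<-cong : ∀ {f g} → (∀ i → f i ≡ g i) → ∀ n → Σ< n f ≡ Σ< n g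
  Σ<-cong eq zero    = refl
  Σ<-cong eq (suc n) = cong₂ _+_ (eq 0) (Σ<-cong (λ i → eq (suc i)) n)

  Σ<-zero : ∀ f n → (∀ i → i < n → f i ≡ 0) → Σ< n f ≡ 0
  Σ<-zero f zero    h = refl
  Σ<-zero f (suc n) h = cong₂ _+_ (h 0 (ℕ.s≤s ℕ.z≤n)) (Σ<-zero (λ i → f (suc i)) n (λ i i<n → h (suc i) (ℕ.s≤s i<n)))

  Σ<-+ : ∀ m n f → Σ< (m + n) f ≡ Σ< m f + Σ< n (λ i → f (m + i))
  Σ<-+ zero    n f = refl
  Σ<-+ (suc m) n f = trans (cong (f 0 +_) (Σ<-+ m n (λ i → f (suc i)))) (sym (+-assoc (f 0) _ _))

  Σ<-*2 : ∀ n f → Σ< (n * 2) f ≡ Σ< n (λ i → f (i * 2)) + Σ< n (λ i → f (1 + i * 2))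
  Σ<-*2 zero    f = refl
  Σ<-*2 (suc n) f = trans (cong (λ a → f 0 + (f 1 + a)) (Σ<-*2 n (λ i → f (2 + i))))
    (solve 4 (λ a b c d → a :+ (b :+ (c :+ d)) := a :+ c :+ (b :+ d)) refl
      (f 0) (f 1) (Σ< n (λ i → f (2 + i * 2))) (Σ< n (λ i → f (3 + i * 2))))
    where open +-*-Solver

  length-filter : ∀ {P : ℕ → Set} (P? : Decidable P) f n →
    length (filter P? (applyUpTo f n)) ≡ Σ< n (λ i → bit (does (P? (f i))))
  length-filter P? f zero    = refl
  length-filter P? f (suc n) with does (P? (f 0))
  ... | true  = cong suc (length-filter P? (λ i → f (suc i)) n)
  ... | false = length-filter P? (λ i → f (suc i)) n

  -- With the Boolean comparison a common successor on both sides cancels by computation, as happens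
  -- when a digit 1 is read and a digit 1 is output.
  lt : ℕ → ℕ → ℕ
  lt a b = bit (a <ᵇ b)

  -- c is the carry into the least significant digit of n in the
  -- multiplication by 3, and p and q are the numbers of ones already
  -- output and read, respectively.
  test : (c p q n : ℕ) → ℕ
  test c p q n = lt (s₂ (3 * n + c) + p) (s₂ n + q)

  open +-*-Solver

  test₀-even : ∀ p q n → test 0 p q (n * 2) ≡ test 0 p q n
  test₀-even p q n = cong₂ (λ a b → lt (a + p) (b + q))
    (trans (cong s₂ (solve 1 (λ n → con 3 :* (n :* con 2) :+ con 0 := (con 3 :* n :+ con 0) :* con 2) refl n)) (s₂-even (3 * n + 0)))
    (s₂-even n)

  test₀-odd : ∀ p q n → test 0 p q (1 + n * 2) ≡ test 1 p q n
  test₀-odd p q n = cong₂ (λ a b → lt (a + p) (b + q))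
    (trans (cong s₂ (solve 1 (λ n → con 3 :* (con 1 :+ n :* con 2) :+ con 0 := con 1 :+ (con 3 :* n :+ con 1) :* con 2) refl n)) (s₂-odd (3 * n + 1)))
    (s₂-odd n)

  test₁-even : ∀ p q n → test 1 p q (n * 2) ≡ test 0 (suc p) q n
  test₁-even p q n = cong₂ (λ a b → lt a (b + q))
    (trans (cong (_+ p) (trans (cong s₂ (solve 1 (λ n → con 3 :* (n :* con 2) :+ con 1 := con 1 :+ (con 3 :* n :+ con 0) :* con 2) refl n)) (s₂-odd (3 * n + 0))))
      (sym (+-suc (s₂ (3 * n + 0)) p)))
    (s₂-even n)

  test₁-odd : ∀ p q n → test 1 p q (1 + n * 2) ≡ test 2 p (suc q) n
  test₁-odd p q n = cong₂ (λ a b → lt (a + p) b)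
    (trans (cong s₂ (solve 1 (λ n → con 3 :* (con 1 :+ n :* con 2) :+ con 1 := (con 3 :* n :+ con 2) :* con 2) refl n)) (s₂-even (3 * n + 2)))
    (trans (cong (_+ q) (s₂-odd n)) (sym (+-suc (s₂ n) q)))

  test₂-even : ∀ p q n → test 2 p q (n * 2) ≡ test 1 p q n
  test₂-even p q n = cong₂ (λ a b → lt (a + p) (b + q))
    (trans (cong s₂ (solve 1 (λ n → con 3 :* (n :* con 2) :+ con 2 := (con 3 :* n :+ con 1) :* con 2) refl n)) (s₂-even (3 * n + 1)))
    (s₂-even n)

  test₂-odd : ∀ p q n → test 2 p q (1 + n * 2) ≡ test 2 p q n
  test₂-odd p q n = cong₂ (λ a b → lt (a + p) (b + q))
    (trans (cong s₂ (solve 1 (λ n → con 3 :* (con 1 :+ n :* con 2) :+ con 2 := con 1 :+ (con 3 :* n :+ con 2) :* con 2) refl n)) (s₂-odd (3 * n + 2)))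
    (s₂-odd n)

  -- Numbers with a given binary length are split by their least significant digit, the one that the
  -- walk reads next.
  Σ-block : ∀ M f → Σ< (2 ^ suc M) (λ i → f (2 ^ suc M + i))
    ≡ Σ< (2 ^ M) (λ i → f ((2 ^ M + i) * 2)) + Σ< (2 ^ M) (λ i → f (1 + (2 ^ M + i) * 2))
  Σ-block M f = trans (cong (λ K → Σ< K (λ i → f (K + i))) (*-comm 2 (2 ^ M)))
    (trans (Σ<-*2 (2 ^ M) (λ i → f (2 ^ M * 2 + i)))
    (cong₂ _+_
      (Σ<-cong (λ i → cong f (sym (*-distribʳ-+ 2 (2 ^ M) i))) (2 ^ M))
      (Σ<-cong (λ i → cong f (trans (+-suc (2 ^ M * 2) (i * 2)) (cong suc (sym (*-distribʳ-+ 2 (2 ^ M) i))))) (2 ^ M))))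

  -- The values of test summed over a binary block, for the carries 0 and 2,
  -- which agree, and for the carry 1.
  A B : ℕ → ℕ → ℕ → ℕ
  A zero    p q = lt (suc p) q
  A (suc M) p q = A M p q + B M p q
  B zero    p q = lt p q
  B (suc M) p q = A M (suc p) q + A M p (suc q)

  Σtest : (c p q M : ℕ) → ℕ
  Σtest c p q M = Σ< (2 ^ M) (λ i → test c p q (2 ^ M + i))

  Σtest-suc : ∀ {c p q c₀ p₀ q₀ c₁ p₁ q₁} →
    (∀ n → test c p q (n * 2) ≡ test c₀ p₀ q₀ n) → (∀ n → test c p q (1 + n * 2) ≡ test c₁ p₁ q₁ n) →
    ∀ M → Σtest c p q (suc M) ≡ Σtest c₀ p₀ q₀ M + Σtest c₁ p₁ q₁ M
  Σtest-suc {c} {p} {q} even odd M = trans (Σ-block M (test c p q))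
    (cong₂ _+_ (Σ<-cong (λ i → even (2 ^ M + i)) (2 ^ M)) (Σ<-cong (λ i → odd (2 ^ M + i)) (2 ^ M)))

  Σtest₀ : ∀ p q M → Σtest 0 p q M ≡ A M p q
  Σtest₁ : ∀ p q M → Σtest 1 p q M ≡ B M p q
  Σtest₂ : ∀ p q M → Σtest 2 p q M ≡ A M p q
  -- The block is {1}. Here 3 and 3 + 2 have two binary ones and 3 + 1 has one, hence `suc p` in
  -- `A zero` and `p` in `B zero`.
  Σtest₀ p q zero    = +-identityʳ (lt (suc p) q)
  Σtest₀ p q (suc M) = trans (Σtest-suc {0} (test₀-even p q) (test₀-odd p q) M) (cong₂ _+_ (Σtest₀ p q M) (Σtest₁ p q M))
  Σtest₁ p q zero    = +-identityʳ (lt p q)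
  Σtest₁ p q (suc M) = trans (Σtest-suc {1} (test₁-even p q) (test₁-odd p q) M) (cong₂ _+_ (Σtest₀ (suc p) q M) (Σtest₂ p (suc q) M))
  Σtest₂ p q zero    = +-identityʳ (lt (suc p) q)
  Σtest₂ p q (suc M) = trans (Σtest-suc {2} (test₂-even p q) (test₂-odd p q) M)
    (trans (cong₂ _+_ (Σtest₁ p q M) (Σtest₂ p q M)) (+-comm (B M p q) (A M p q)))

  flimsyCount≡A : ∀ M → flimsyCount 3 (suc M) ≡ A M 0 0
  flimsyCount≡A M = begin
    flimsyCount 3 (suc M)
      ≡⟨ length-filter (λ n → (2 ^ M ≤? n) ×-dec flimsy? 3 n) (λ i → i) (2 ^ suc M) ⟩
    Σ< (2 ^ M + (2 ^ M + 0)) f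
      ≡⟨ cong (λ m → Σ< (2 ^ M + m) f) (+-identityʳ (2 ^ M)) ⟩
    Σ< (2 ^ M + 2 ^ M) f
      ≡⟨ Σ<-+ (2 ^ M) (2 ^ M) f ⟩
    Σ< (2 ^ M) f + Σ< (2 ^ M) (λ i → f (2 ^ M + i))
      ≡⟨ cong₂ _+_ (Σ<-zero f (2 ^ M) below) (Σ<-cong above (2 ^ M)) ⟩
    Σtest 0 0 0 M
      ≡⟨ Σtest₀ 0 0 M ⟩
    A M 0 0 ∎
    where
    open ≡-Reasoning
    f : ℕ → ℕ
    f n = bit (does ((2 ^ M ≤? n) ×-dec flimsy? 3 n))
    below : ∀ i → i < 2 ^ M → f i ≡ 0
    below i i<2^M = bit-×-no (2 ^ M ≤? i) (flimsy? 3 i) (<⇒≱ i<2^M)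
    above : ∀ i → f (2 ^ M + i) ≡ test 0 0 0 (2 ^ M + i)
    above i = trans (bit-×-yes (2 ^ M ≤? 2 ^ M + i) (flimsy? 3 (2 ^ M + i)) (m≤m+n (2 ^ M) i)) (cong₂ lt
      (trans (cong s₂ (sym (+-identityʳ (3 * (2 ^ M + i))))) (sym (+-identityʳ (s₂ (3 * (2 ^ M + i) + 0)))))
      (sym (+-identityʳ (s₂ (2 ^ M + i)))))

  -- The walk depends only on its position p - q.
  A-shift : ∀ M p q → A M (suc p) (suc q) ≡ A M p q
  B-shift : ∀ M p q → B M (suc p) (suc q) ≡ B M p q
  A-shift zero    p q = refl
  A-shift (suc M) p q = cong₂ _+_ (A-shift M p q) (B-shift M p q)
  B-shift zero    p q = refl
  B-shift (suc M) p q = cong₂ _+_ (A-shift M (suc p) q) (A-shift M p (suc q))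

  -- The symmetrised count and its defect from 1

  ½^_ : ℕ → ℚ
  ½^ zero    = 1ℚ
  ½^ (suc n) = ½ ℚ.* ½^ n

  -- Adding the counts for the positions j and -j gives a solution of the recurrence of `W`,
  -- including its boundary case at 0.
  symmetric : ℕ → ℕ → ℚ
  symmetric M j = ½^ M ℚ.* (ι (A M j 0) ℚ.+ ι (A M 0 j))

  -- The value 0 before the start makes `defect` meaningful at M = 0.
  W⁻ : ℕ → ℕ → ℚ
  W⁻ zero    j = 0ℚ
  W⁻ (suc M) j = W M j

  -- The mass of the walks started at j that neither sign counts: those ending at 0 with carry 1,
  -- `½ * W⁻ M j`; those ending at 0 with carry 0 or 2, `W M j`; and those ending at 1 or -1 with
  -- carry 0 or 2, whose mass the recurrence of `W` expresses by the first two terms.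
  defect : ℕ → ℕ → ℚ
  defect M j = ι 4 ℚ.* W (2 + M) j ℚ.- ι 2 ℚ.* W (1 + M) j ℚ.+ W M j ℚ.+ ½ ℚ.* W⁻ M j

  W⁻-zero : ∀ M → W⁻ (2 + M) 0 ≡ ½ ℚ.* W⁻ (1 + M) 0 ℚ.+ ½ ℚ.* W⁻ M 1
  W⁻-zero zero    = refl
  W⁻-zero (suc M) = refl

  W⁻-suc : ∀ M j → W⁻ (2 + M) (suc j) ≡ ½ ℚ.* W⁻ (1 + M) (suc j) ℚ.+ ¼ ℚ.* (W⁻ M j ℚ.+ W⁻ M (2 + j))
  W⁻-suc zero    j = refl
  W⁻-suc (suc M) j = refl

  symmetric-zero : ∀ M → symmetric (2 + M) 0 ≡ ½ ℚ.* symmetric (1 + M) 0 ℚ.+ ½ ℚ.* symmetric M 1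
  symmetric-zero M = trans (cong (λ a → ½^ (2 + M) ℚ.* (a ℚ.+ a)) (trans (ι-+ (A (1 + M) 0 0) (A M 1 0 + A M 0 1))
      (cong (ι (A (1 + M) 0 0) ℚ.+_) (ι-+ (A M 1 0) (A M 0 1)))))
    (S.solve 4 (λ h a b c → S.con ½ S.:* (S.con ½ S.:* h) S.:* ((a S.:+ (b S.:+ c)) S.:+ (a S.:+ (b S.:+ c)))
      S.:= S.con ½ S.:* (S.con ½ S.:* h S.:* (a S.:+ a)) S.:+ S.con ½ S.:* (h S.:* (b S.:+ c))) refl
      (½^ M) (ι (A (1 + M) 0 0)) (ι (A M 1 0)) (ι (A M 0 1)))
    where module S = ℚ-Solver

  symmetric-suc : ∀ M j → symmetric (2 + M) (suc j) ≡ ½ ℚ.* symmetric (1 + M) (suc j) ℚ.+ ¼ ℚ.* (symmetric M j ℚ.+ symmetric M (2 + j))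
  symmetric-suc M j = trans (cong₂ (λ a b → ½^ (2 + M) ℚ.* (a ℚ.+ b))
      (trans (ι-+ (A (1 + M) (suc j) 0) (A M (2 + j) 0 + A M (suc j) 1)) (cong (ι (A (1 + M) (suc j) 0) ℚ.+_)
        (trans (ι-+ (A M (2 + j) 0) (A M (suc j) 1)) (cong (λ a → ι (A M (2 + j) 0) ℚ.+ ι a) (A-shift M j 0)))))
      (trans (ι-+ (A (1 + M) 0 (suc j)) (A M 1 (suc j) + A M 0 (2 + j))) (cong (ι (A (1 + M) 0 (suc j)) ℚ.+_)
        (trans (ι-+ (A M 1 (suc j)) (A M 0 (2 + j))) (cong (λ a → ι a ℚ.+ ι (A M 0 (2 + j))) (A-shift M 0 j))))))
    (S.solve 7 (λ h a b c d e f → S.con ½ S.:* (S.con ½ S.:* h) S.:* ((a S.:+ (b S.:+ c)) S.:+ (d S.:+ (e S.:+ f)))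
      S.:= S.con ½ S.:* (S.con ½ S.:* h S.:* (a S.:+ d)) S.:+ S.con ¼ S.:* (h S.:* (c S.:+ e) S.:+ h S.:* (b S.:+ f))) refl
      (½^ M) (ι (A (1 + M) (suc j) 0)) (ι (A M (2 + j) 0)) (ι (A M j 0)) (ι (A (1 + M) 0 (suc j))) (ι (A M 0 j)) (ι (A M 0 (2 + j))))
    where module S = ℚ-Solver

  defect-zero : ∀ M → defect (2 + M) 0 ≡ ½ ℚ.* defect (1 + M) 0 ℚ.+ ½ ℚ.* defect M 1
  defect-zero M = trans (cong (λ a → ι 4 ℚ.* W (4 + M) 0 ℚ.- ι 2 ℚ.* W (3 + M) 0 ℚ.+ W (2 + M) 0 ℚ.+ ½ ℚ.* a) (W⁻-zero M))
    (S.solve 8 (λ a b c d e f g h →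
       S.con (ι 4) S.:* (S.con ½ S.:* a S.:+ S.con ½ S.:* b) S.:- S.con (ι 2) S.:* (S.con ½ S.:* c S.:+ S.con ½ S.:* d)
         S.:+ (S.con ½ S.:* e S.:+ S.con ½ S.:* f) S.:+ S.con ½ S.:* (S.con ½ S.:* g S.:+ S.con ½ S.:* h)
       S.:= S.con ½ S.:* (S.con (ι 4) S.:* a S.:- S.con (ι 2) S.:* c S.:+ e S.:+ S.con ½ S.:* g)
            S.:+ S.con ½ S.:* (S.con (ι 4) S.:* b S.:- S.con (ι 2) S.:* d S.:+ f S.:+ S.con ½ S.:* h)) refl
       (W (3 + M) 0) (W (2 + M) 1) (W (2 + M) 0) (W (1 + M) 1) (W (1 + M) 0) (W M 1) (W⁻ (1 + M) 0) (W⁻ M 1))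
    where module S = ℚ-Solver

  defect-suc : ∀ M j → defect (2 + M) (suc j) ≡ ½ ℚ.* defect (1 + M) (suc j) ℚ.+ ¼ ℚ.* (defect M j ℚ.+ defect M (2 + j))
  defect-suc M j = trans (cong (λ a → ι 4 ℚ.* W (4 + M) (suc j) ℚ.- ι 2 ℚ.* W (3 + M) (suc j) ℚ.+ W (2 + M) (suc j) ℚ.+ ½ ℚ.* a) (W⁻-suc M j))
    (S.solve 12 (λ a b b′ c d d′ e f f′ g h h′ →
       S.con (ι 4) S.:* (S.con ½ S.:* a S.:+ S.con ¼ S.:* (b S.:+ b′)) S.:- S.con (ι 2) S.:* (S.con ½ S.:* c S.:+ S.con ¼ S.:* (d S.:+ d′))
         S.:+ (S.con ½ S.:* e S.:+ S.con ¼ S.:* (f S.:+ f′)) S.:+ S.con ½ S.:* (S.con ½ S.:* g S.:+ S.con ¼ S.:* (h S.:+ h′))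
       S.:= S.con ½ S.:* (S.con (ι 4) S.:* a S.:- S.con (ι 2) S.:* c S.:+ e S.:+ S.con ½ S.:* g)
            S.:+ S.con ¼ S.:* ((S.con (ι 4) S.:* b S.:- S.con (ι 2) S.:* d S.:+ f S.:+ S.con ½ S.:* h)
               S.:+ (S.con (ι 4) S.:* b′ S.:- S.con (ι 2) S.:* d′ S.:+ f′ S.:+ S.con ½ S.:* h′))) refl
       (W (3 + M) (suc j)) (W (2 + M) j) (W (2 + M) (2 + j)) (W (2 + M) (suc j)) (W (1 + M) j) (W (1 + M) (2 + j))
       (W (1 + M) (suc j)) (W M j) (W M (2 + j)) (W⁻ (1 + M) (suc j)) (W⁻ M j) (W⁻ M (2 + j)))
    where module S = ℚ-Solver

  -- Both summands and the constant 1 solve the same linear recurrence of order two in M, so the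
  -- cases M = 0 and M = 1 decide.
  symmetric+defect : ∀ M j → symmetric M j ℚ.+ defect M j ≡ 1ℚ
  symmetric+defect 0 0             = refl
  symmetric+defect 0 1             = refl
  symmetric+defect 0 (suc (suc j)) = refl
  symmetric+defect 1 0             = refl
  symmetric+defect 1 1             = refl
  symmetric+defect 1 2             = refl
  symmetric+defect 1 (suc (suc (suc j))) = refl
  symmetric+defect (suc (suc M)) zero    = trans (cong₂ ℚ._+_ (symmetric-zero M) (defect-zero M))
    (trans (S.solve 4 (λ a b c d → S.con ½ S.:* a S.:+ S.con ½ S.:* b S.:+ (S.con ½ S.:* c S.:+ S.con ½ S.:* d)
        S.:= S.con ½ S.:* (a S.:+ c) S.:+ S.con ½ S.:* (b S.:+ d)) refl
        (symmetric (1 + M) 0) (symmetric M 1) (defect (1 + M) 0) (defect M 1))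
      (cong₂ (λ a b → ½ ℚ.* a ℚ.+ ½ ℚ.* b) (symmetric+defect (suc M) 0) (symmetric+defect M 1)))
    where module S = ℚ-Solver
  symmetric+defect (suc (suc M)) (suc j) = trans (cong₂ ℚ._+_ (symmetric-suc M j) (defect-suc M j))
    (trans (S.solve 6 (λ a b b′ c d d′ → S.con ½ S.:* a S.:+ S.con ¼ S.:* (b S.:+ b′) S.:+ (S.con ½ S.:* c S.:+ S.con ¼ S.:* (d S.:+ d′))
        S.:= S.con ½ S.:* (a S.:+ c) S.:+ S.con ¼ S.:* ((b S.:+ d) S.:+ (b′ S.:+ d′))) refl
        (symmetric (1 + M) (suc j)) (symmetric M j) (symmetric M (2 + j)) (defect (1 + M) (suc j)) (defect M j) (defect M (2 + j)))
      (cong₂ (λ a b → ½ ℚ.* a ℚ.+ ¼ ℚ.* b) (symmetric+defect (suc M) (suc j))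
        (cong₂ ℚ._+_ (symmetric+defect M j) (symmetric+defect M (2 + j)))))
    where module S = ℚ-Solver

  T-at : ∀ M → ι 4 ℚ.* T (2 + M) ≡ defect M 0
  T-at M = trans (cong (λ a → ι 4 ℚ.* a) (cong₂ ℚ._+_ (cong₂ ℚ._+_ (cong (W (2 + M) 0 ℚ.+_)
        (trans (C⋆-at (ℚ.- ½) (X ⋆ V 0) (2 + M)) (cong (ℚ.- ½ ℚ.*_) (X⋆-suc (V 0) (suc M)))))
        (trans (C⋆-at ¼ (X ⋆ (X ⋆ V 0)) (2 + M)) (cong (¼ ℚ.*_) (X²⋆-at (V 0) M))))
        (trans (C⋆-at ⅛ (X ⋆ (X ⋆ (X ⋆ V 0))) (2 + M)) (cong (⅛ ℚ.*_) (X³V M)))))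
    (S.solve 4 (λ a b c d → S.con (ι 4) S.:* (a S.:+ S.con (ℚ.- ½) S.:* b S.:+ S.con ¼ S.:* c S.:+ S.con ⅛ S.:* d)
        S.:= S.con (ι 4) S.:* a S.:- S.con (ι 2) S.:* b S.:+ c S.:+ S.con ½ S.:* d) refl
        (W (2 + M) 0) (W (1 + M) 0) (W M 0) (W⁻ M 0))
    where
    module S = ℚ-Solver
    X³V : ∀ M → (X ⋆ (X ⋆ (X ⋆ V 0))) (2 + M) ≡ W⁻ M 0
    X³V zero    = trans (X²⋆-at (X ⋆ V 0) 0) (X⋆-zero (V 0))
    X³V (suc M) = X³⋆-at (V 0) M

  flimsyCount+T : ∀ M → ½^ M ℚ.* (ι (flimsyCount 3 (suc M)) ℚ.+ ι (flimsyCount 3 (suc M))) ℚ.+ ι 4 ℚ.* T (2 + M) ≡ 1ℚ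
  flimsyCount+T M = trans (cong₂ (λ a t → ½^ M ℚ.* (ι a ℚ.+ ι a) ℚ.+ t) (flimsyCount≡A M) (T-at M)) (symmetric+defect M 0)

  -- The negative term of `defect` cancels when the recurrence of `W` is applied to the leading one.
  0≤T : ∀ M → 0ℚ ℚ.≤ T (2 + M)
  0≤T M = Rationals.*-cancelˡ-≤ (Rationals.0<ι 3) (subst₂ ℚ._≤_ (sym (ℚ.*-zeroʳ (ι 4))) (sym (trans (T-at M) (eq M)))
    (0≤+ (0≤+ (0≤* (Rationals.0≤ι 2) (0≤W M 1)) (0≤W M 0)) (0≤* (ℚ.nonNegative⁻¹ ½) (0≤W⁻ M))))
    where
    module S = ℚ-Solver
    0≤W⁻ : ∀ M → 0ℚ ℚ.≤ W⁻ M 0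
    0≤W⁻ zero    = ℚ.≤-refl
    0≤W⁻ (suc M) = 0≤W M 0
    eq : ∀ M → defect M 0 ≡ ι 2 ℚ.* W M 1 ℚ.+ W M 0 ℚ.+ ½ ℚ.* W⁻ M 0
    eq M = S.solve 4 (λ a b c d → S.con (ι 4) S.:* (S.con ½ S.:* a S.:+ S.con ½ S.:* b) S.:- S.con (ι 2) S.:* a S.:+ c S.:+ S.con ½ S.:* d
        S.:= S.con (ι 2) S.:* b S.:+ c S.:+ S.con ½ S.:* d) refl (W (1 + M) 0) (W M 1) (W M 0) (W⁻ M 0)

-- The weighted Leibniz series and its exact value

module WallisLeibniz where

  open import Data.Rational.Base
  open import Data.Rational.Properties
  open import Data.Rational.Solver using (module +-*-Solver)
  open import Defs
    using (odd⁻¹; odd⁻¹-antimono; leibniz; leibniz-bounds; archimedean; ∣p-q∣≤r; 0≤/; 0<p*q; *-mono-≤; p≤∣p∣;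
      p-q≤r⇒p≤q+r; p≤q+r⇒p-q≤r; ∣p-q∣≡∣q-p∣)
  open import Relation.Nullary.Decidable using (from-yes)
  open Rationals
  open WalkSeries using (¼; p; p-suc)

  open +-*-Solver

  odd⁻¹-inverse : ∀ k → (ι k + ι k + 1ℚ) * odd⁻¹ k ≡ 1ℚ
  odd⁻¹-inverse k = trans (cong (λ a → (a + 1ℚ) * odd⁻¹ k) (sym (trans (ι-+ k (k ℕ.+ 0)) (cong (λ a → ι k + ι a) (ℕ.+-identityʳ k)))))
    (ι*recip (2 ℕ.* k))

  0≤odd⁻¹ : ∀ k → 0ℚ ≤ odd⁻¹ k
  0≤odd⁻¹ k = 0≤/ 1 (2 ℕ.* k)

  odd⁻¹≤1 : ∀ k → odd⁻¹ k ≤ 1ℚ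
  odd⁻¹≤1 k = subst (odd⁻¹ k ≤_) (odd⁻¹-inverse k) (≤-by ((ι k + ι k) * odd⁻¹ k) (0≤* (0≤+ (0≤ι k) (0≤ι k)) (0≤odd⁻¹ k))
    (solve 2 (λ i o → o :+ i :* o := (i :+ con 1ℚ) :* o) refl (ι k + ι k) (odd⁻¹ k)))

  alternating : (ℕ → ℚ) → ℕ → ℚ
  alternating f zero    = 0ℚ
  alternating f (suc n) = f 0 - alternating (λ j → f (suc j)) n

  sgn : ℕ → ℚ
  sgn zero    = 1ℚ
  sgn (suc n) = - sgn n

  alternating-suc : ∀ f n → alternating f (suc n) ≡ alternating f n + sgn n * f n
  alternating-suc f zero    = solve 1 (λ a → a :- con 0ℚ := con 0ℚ :+ con 1ℚ :* a) refl (f 0)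
  alternating-suc f (suc n) = trans (cong (λ t → f 0 - t) (alternating-suc (λ j → f (suc j)) n))
    (solve 4 (λ a b c d → a :- (b :+ c :* d) := a :- b :+ :- c :* d) refl
      (f 0) (alternating (λ j → f (suc j)) n) (sgn n) (f (suc n)))

  alternating-cong : ∀ {f h} → (∀ j → f j ≡ h j) → ∀ n → alternating f n ≡ alternating h n
  alternating-cong eq zero    = refl
  alternating-cong eq (suc n) = cong₂ _-_ (eq 0) (alternating-cong (λ j → eq (suc j)) n)

  alternating-linear : ∀ a b f h n → alternating (λ j → a * f j - b * h j) n ≡ a * alternating f n - b * alternating h n
  alternating-linear a b f h zero    = solve 2 (λ a b → con 0ℚ := a :* con 0ℚ :- b :* con 0ℚ) refl a b
  alternating-linear a b f h (suc n) = trans (cong (λ t → a * f 0 - b * h 0 - t) (alternating-linear a b (λ j → f (suc j)) (λ j → h (suc j)) n))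
    (solve 6 (λ a b f h u v → a :* f :- b :* h :- (a :* u :- b :* v) := a :* (f :- u) :- b :* (h :- v)) refl
      a b (f 0) (h 0) (alternating (λ j → f (suc j)) n) (alternating (λ j → h (suc j)) n))

  alternating-bounds : ∀ f → (∀ j → 0ℚ ≤ f j) → (∀ j → f (suc j) ≤ f j) → ∀ n →
    0ℚ ≤ alternating f n × alternating f n ≤ f 0
  alternating-bounds f f≥0 f↓ zero    = ≤-refl , f≥0 0
  alternating-bounds f f≥0 f↓ (suc n) =
    let l , u = alternating-bounds (λ j → f (suc j)) (λ j → f≥0 (suc j)) (λ j → f↓ (suc j)) n
        t = alternating (λ j → f (suc j)) n
    in diff≥0 (≤-trans u (f↓ 0)) ,
       ≤-by t l (solve 2 (λ a t → a :- t :+ t := a) refl (f 0) t)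

  -- ρ m j = Π_{1≤i≤j} (m - i)/(m + i), which tends to 1 as m → ∞.
  ρ : ℕ → ℕ → ℚ
  ρ m zero    = 1ℚ
  ρ m (suc j) = ρ m j * (ι m - ι (suc j)) * recip (m ℕ.+ j)

  ρ-suc : ∀ m j → (ι m + ι (suc j)) * ρ m (suc j) ≡ (ι m - ι (suc j)) * ρ m j
  ρ-suc m j = begin
    (ι m + ι (suc j)) * (ρ m j * (ι m - ι (suc j)) * recip (m ℕ.+ j))
      ≡⟨ cong (_* (ρ m j * (ι m - ι (suc j)) * recip (m ℕ.+ j)))
           (trans (sym (+-assoc (ι m) (ι j) 1ℚ)) (cong (_+ 1ℚ) (sym (ι-+ m j)))) ⟩
    ι (suc (m ℕ.+ j)) * (ρ m j * (ι m - ι (suc j)) * recip (m ℕ.+ j))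
      ≡⟨ solve 4 (λ a b c d → a :* (b :* c :* d) := a :* d :* (c :* b)) refl
           (ι (suc (m ℕ.+ j))) (ρ m j) (ι m - ι (suc j)) (recip (m ℕ.+ j)) ⟩
    ι (suc (m ℕ.+ j)) * recip (m ℕ.+ j) * ((ι m - ι (suc j)) * ρ m j)
      ≡⟨ cong (_* ((ι m - ι (suc j)) * ρ m j)) (ι*recip (m ℕ.+ j)) ⟩
    1ℚ * ((ι m - ι (suc j)) * ρ m j)
      ≡⟨ *-identityˡ _ ⟩
    (ι m - ι (suc j)) * ρ m j ∎
    where open ≡-Reasoning

  0<m+suc : ∀ m j → 0ℚ < ι m + ι (suc j)
  0<m+suc m j = +-mono-≤-< (0≤ι m) (0<ι j)

  -- Relates the weights of consecutive m; the factors stay multiplied out because m - j may vanish.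
  ρ-step : ∀ m j → (ι m - ι j) * (ι (suc m) + ι j) * ρ (suc m) j ≡ ι m * ι (suc m) * ρ m j
  ρ-step m zero    = solve 2 (λ a b → (a :- con 0ℚ) :* (b :+ con 0ℚ) :* con 1ℚ := a :* b :* con 1ℚ) refl (ι m) (ι (suc m))
  ρ-step m (suc j) = *-cancelˡ-≡ (0<m+suc m j) (begin
    (ι m + ι (suc j)) * ((ι m - ι (suc j)) * (ι (suc m) + ι (suc j)) * ρ (suc m) (suc j))
      ≡⟨ solve 4 (λ a b c d → a :* (b :* c :* d) := a :* b :* (c :* d)) refl
           (ι m + ι (suc j)) (ι m - ι (suc j)) (ι (suc m) + ι (suc j)) (ρ (suc m) (suc j)) ⟩
    (ι m + ι (suc j)) * (ι m - ι (suc j)) * ((ι (suc m) + ι (suc j)) * ρ (suc m) (suc j))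
      ≡⟨ cong ((ι m + ι (suc j)) * (ι m - ι (suc j)) *_) (ρ-suc (suc m) j) ⟩
    (ι m + ι (suc j)) * (ι m - ι (suc j)) * ((ι (suc m) - ι (suc j)) * ρ (suc m) j)
      ≡⟨ solve 3 (λ m j r → (m :+ (j :+ con 1ℚ)) :* (m :- (j :+ con 1ℚ)) :* (((m :+ con 1ℚ) :- (j :+ con 1ℚ)) :* r)
           := (m :- (j :+ con 1ℚ)) :* ((m :- j) :* (m :+ con 1ℚ :+ j) :* r)) refl (ι m) (ι j) (ρ (suc m) j) ⟩
    (ι m - ι (suc j)) * ((ι m - ι j) * (ι (suc m) + ι j) * ρ (suc m) j)
      ≡⟨ cong ((ι m - ι (suc j)) *_) (ρ-step m j) ⟩
    (ι m - ι (suc j)) * (ι m * ι (suc m) * ρ m j)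
      ≡⟨ solve 3 (λ a b c → a :* (b :* c) := b :* (a :* c)) refl (ι m - ι (suc j)) (ι m * ι (suc m)) (ρ m j) ⟩
    ι m * ι (suc m) * ((ι m - ι (suc j)) * ρ m j)
      ≡⟨ cong (ι m * ι (suc m) *_) (ρ-suc m j) ⟨
    ι m * ι (suc m) * ((ι m + ι (suc j)) * ρ m (suc j))
      ≡⟨ solve 3 (λ a b c → b :* (a :* c) := a :* (b :* c)) refl (ι m + ι (suc j)) (ι m * ι (suc m)) (ρ m (suc j)) ⟩
    (ι m + ι (suc j)) * (ι m * ι (suc m) * ρ m (suc j)) ∎)
    where open ≡-Reasoning

  ρ-zero : ∀ m d → ρ (suc m) (suc m ℕ.+ d) ≡ 0ℚ
  ρ-zero m zero    rewrite ℕ.+-identityʳ m | +-inverseʳ (ι (suc m)) | *-zeroʳ (ρ (suc m) m) = *-zeroˡ (recip (suc m ℕ.+ m))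
  ρ-zero m (suc d) rewrite ℕ.+-suc m d | ρ-zero m d | *-zeroˡ (ι (suc m) - ι (suc (suc (m ℕ.+ d)))) =
    *-zeroˡ (recip (suc m ℕ.+ suc (m ℕ.+ d)))

  0≤ρ : ∀ m j → 0ℚ ≤ ρ (suc m) j
  0≤ρ m zero    = 0≤1
  0≤ρ m (suc j) with ℕ.≤-total (suc j) (suc m)
  ... | inj₁ j≤m = 0≤* (0≤* (0≤ρ m j) (diff≥0 (ι-mono-≤ j≤m))) (<⇒≤ (0<recip (suc m ℕ.+ j)))
  ... | inj₂ m≤j = ≤-reflexive (sym (trans (cong (ρ (suc m)) (sym (ℕ.m+[n∸m]≡n m≤j))) (ρ-zero m (suc j ℕ.∸ suc m))))

  ρ-difference : ∀ m j → (ι m + ι (suc j)) * (ρ m j - ρ m (suc j)) ≡ ι 2 * ι (suc j) * ρ m j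
  ρ-difference m j = trans
    (solve 4 (λ m j a b → (m :+ j) :* (a :- b) := (m :+ j) :* a :- (m :+ j) :* b) refl (ι m) (ι (suc j)) (ρ m j) (ρ m (suc j)))
    (trans (cong (λ t → (ι m + ι (suc j)) * ρ m j - t) (ρ-suc m j))
    (solve 3 (λ m j a → (m :+ j) :* a :- (m :- j) :* a := con (ι 2) :* j :* a) refl (ι m) (ι (suc j)) (ρ m j)))

  ρ-antimono : ∀ m j → ρ (suc m) (suc j) ≤ ρ (suc m) j
  ρ-antimono m j = diff≥0⁻¹ (*-cancelˡ-≤ (0<m+suc (suc m) j) (≤-trans (≤-reflexive (*-zeroʳ (ι (suc m) + ι (suc j))))
    (≤-trans (0≤* (0≤* (0≤ι 2) (0≤ι (suc j))) (0≤ρ m j)) (≤-reflexive (sym (ρ-difference (suc m) j))))))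

  ρ≤1 : ∀ m j → ρ (suc m) j ≤ 1ℚ
  ρ≤1 m zero    = ≤-refl
  ρ≤1 m (suc j) = ≤-trans (ρ-antimono m j) (ρ≤1 m j)

  ρ-near-1 : ∀ m j → ι (suc m) * (1ℚ - ρ (suc m) j) ≤ ι j * ι (suc j)
  ρ-near-1 m zero    = ≤-reflexive (solve 1 (λ a → a :* (con 1ℚ :- con 1ℚ) := con 0ℚ :* (con 0ℚ :+ con 1ℚ)) refl (ι (suc m)))
  ρ-near-1 m (suc j) = begin
    ι (suc m) * (1ℚ - ρ (suc m) (suc j))
      ≡⟨ solve 3 (λ i a b → i :* (con 1ℚ :- b) := i :* (con 1ℚ :- a) :+ i :* (a :- b)) refl (ι (suc m)) (ρ (suc m) j) (ρ (suc m) (suc j)) ⟩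
    ι (suc m) * (1ℚ - ρ (suc m) j) + ι (suc m) * (ρ (suc m) j - ρ (suc m) (suc j))
      ≤⟨ +-mono-≤ (ρ-near-1 m j) (*-monoʳ (diff≥0 (ρ-antimono m j))
           (≤-by {ι (suc m)} (ι (suc j)) (0≤ι (suc j)) refl)) ⟩
    ι j * ι (suc j) + (ι (suc m) + ι (suc j)) * (ρ (suc m) j - ρ (suc m) (suc j))
      ≡⟨ cong (ι j * ι (suc j) +_) (ρ-difference (suc m) j) ⟩
    ι j * ι (suc j) + ι 2 * ι (suc j) * ρ (suc m) j
      ≤⟨ +-monoʳ-≤ (ι j * ι (suc j)) (*-monoˡ (0≤* (0≤ι 2) (0≤ι (suc j))) (ρ≤1 m j)) ⟩
    ι j * ι (suc j) + ι 2 * ι (suc j) * 1ℚ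
      ≡⟨ solve 1 (λ j → j :* (j :+ con 1ℚ) :+ con (ι 2) :* (j :+ con 1ℚ) :* con 1ℚ := (j :+ con 1ℚ) :* (j :+ con 1ℚ :+ con 1ℚ)) refl (ι j) ⟩
    ι (suc j) * ι (2 ℕ.+ j) ∎
    where open ≤-Reasoning

  -- The sum telescopes: the right side is an antidifference of the summand, and it vanishes at J =
  -- m + 1 because `ρ` does.
  Σodd*ρ : ∀ m J → ι m * alternating (λ j → (ι j + ι j + 1ℚ) * ρ (suc m) j) J
                 ≡ - (sgn J * (ι J * ((ι (suc m) + ι J) * ρ (suc m) J)))
  Σodd*ρ m zero    = solve 3 (λ a b c → a :* con 0ℚ := :- (con 1ℚ :* (con 0ℚ :* ((b :+ con 0ℚ) :* c)))) refl (ι m) (ι (suc m)) 1ℚ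
  Σodd*ρ m (suc J) = begin
    ι m * alternating f (suc J)
      ≡⟨ cong (ι m *_) (alternating-suc f J) ⟩
    ι m * (alternating f J + sgn J * f J)
      ≡⟨ *-distribˡ-+ (ι m) (alternating f J) (sgn J * f J) ⟩
    ι m * alternating f J + ι m * (sgn J * f J)
      ≡⟨ cong (_+ ι m * (sgn J * f J)) (Σodd*ρ m J) ⟩
    - (sgn J * (ι J * ((ι (suc m) + ι J) * ρ (suc m) J))) + ι m * (sgn J * f J)
      ≡⟨ solve 4 (λ m J s r → :- (s :* (J :* ((m :+ con 1ℚ :+ J) :* r))) :+ m :* (s :* ((J :+ J :+ con 1ℚ) :* r))
           := :- (:- s :* ((J :+ con 1ℚ) :* ((m :+ con 1ℚ :- (J :+ con 1ℚ)) :* r)))) refl (ι m) (ι J) (sgn J) (ρ (suc m) J) ⟩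
    - (- sgn J * (ι (suc J) * ((ι (suc m) - ι (suc J)) * ρ (suc m) J)))
      ≡⟨ cong (λ a → - (- sgn J * (ι (suc J) * a))) (ρ-suc (suc m) J) ⟨
    - (- sgn J * (ι (suc J) * ((ι (suc m) + ι (suc J)) * ρ (suc m) (suc J)))) ∎
    where
    open ≡-Reasoning
    f = λ j → (ι j + ι j + 1ℚ) * ρ (suc m) j

  -- Wallis' integral of cos^(2m-1) over [0, π/2], divided by 2 p(m): as ρ m j = binomial(2m-1, m+j)
  -- / binomial(2m-1, m), the terms are those of the expansion of the power in cosines of odd
  -- multiples, integrated one by one.
  S : ℕ → ℚ
  S m = alternating (λ j → ρ m j * odd⁻¹ j) m

  -- Creative telescoping. By `ρ-step` and (2i+1)² - 4(i-j)(i+1+j) = (2j+1)², the combination of the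
  -- two summands loses its denominator 2j + 1 and becomes the summand of `Σodd*ρ`, whose sum is 0.
  S-recurrence : ∀ m → let i = ι (suc m) in
    (i + i + 1ℚ) * (i + i + 1ℚ) * S (2 ℕ.+ m) ≡ ι 4 * (i * (i + 1ℚ)) * S (suc m)
  S-recurrence m = begin
    A * S (suc n)
      ≡⟨ solve 2 (λ a b → a := b :+ (a :- b)) refl (A * S (suc n)) (B * alternating h (suc n)) ⟩
    B * alternating h (suc n) + (A * S (suc n) - B * alternating h (suc n))
      ≡⟨ cong (B * alternating h (suc n) +_) (alternating-linear A B (λ j → ρ (suc n) j * odd⁻¹ j) h (suc n)) ⟨
    B * alternating h (suc n) + alternating (λ j → A * (ρ (suc n) j * odd⁻¹ j) - B * h j) (suc n)
      ≡⟨ cong₂ (λ a b → B * a + b) last-term (trans (alternating-cong summand (suc n)) total) ⟩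
    B * S n + 0ℚ
      ≡⟨ +-identityʳ (B * S n) ⟩
    B * S n ∎
    where
    open ≡-Reasoning
    n = suc m
    i = ι n
    A = (i + i + 1ℚ) * (i + i + 1ℚ)
    B = ι 4 * (i * (i + 1ℚ))
    h = λ j → ρ n j * odd⁻¹ j
    last-term : alternating h (suc n) ≡ S n
    last-term = trans (alternating-suc h n) (trans
      (cong (λ a → S n + sgn n * (a * odd⁻¹ n)) (trans (cong (ρ n) (sym (ℕ.+-identityʳ n))) (ρ-zero m 0)))
      (solve 3 (λ s t o → s :+ t :* (con 0ℚ :* o) := s) refl (S n) (sgn n) (odd⁻¹ n)))
    summand : ∀ j → A * (ρ (suc n) j * odd⁻¹ j) - B * h j ≡ (ι j + ι j + 1ℚ) * ρ (suc n) j
    summand j = begin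
      A * (ρ (suc n) j * odd⁻¹ j) - B * (ρ n j * odd⁻¹ j)
        ≡⟨ solve 5 (λ i r′ r o f → (i :+ i :+ con 1ℚ) :* (i :+ i :+ con 1ℚ) :* (r′ :* o) :- con (ι 4) :* (i :* (i :+ con 1ℚ)) :* (r :* o)
             := ((i :+ i :+ con 1ℚ) :* (i :+ i :+ con 1ℚ) :* r′ :- con (ι 4) :* (i :* (i :+ con 1ℚ) :* r)) :* o)
             refl i (ρ (suc n) j) (ρ n j) (odd⁻¹ j) 1ℚ ⟩
      (A * ρ (suc n) j - ι 4 * (i * (i + 1ℚ) * ρ n j)) * odd⁻¹ j
        ≡⟨ cong (λ a → (A * ρ (suc n) j - ι 4 * a) * odd⁻¹ j) (ρ-step n j) ⟨
      (A * ρ (suc n) j - ι 4 * ((i - ι j) * (ι (suc n) + ι j) * ρ (suc n) j)) * odd⁻¹ j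
        ≡⟨ solve 4 (λ i j r o → ((i :+ i :+ con 1ℚ) :* (i :+ i :+ con 1ℚ) :* r :- con (ι 4) :* ((i :- j) :* (i :+ con 1ℚ :+ j) :* r)) :* o
             := (j :+ j :+ con 1ℚ) :* o :* ((j :+ j :+ con 1ℚ) :* r)) refl i (ι j) (ρ (suc n) j) (odd⁻¹ j) ⟩
      (ι j + ι j + 1ℚ) * odd⁻¹ j * ((ι j + ι j + 1ℚ) * ρ (suc n) j)
        ≡⟨ cong (_* ((ι j + ι j + 1ℚ) * ρ (suc n) j)) (odd⁻¹-inverse j) ⟩
      1ℚ * ((ι j + ι j + 1ℚ) * ρ (suc n) j)
        ≡⟨ *-identityˡ _ ⟩
      (ι j + ι j + 1ℚ) * ρ (suc n) j ∎
    total : alternating (λ j → (ι j + ι j + 1ℚ) * ρ (suc n) j) (suc n) ≡ 0ℚ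
    total = *-cancelˡ-≡ (0<ι m) (trans (Σodd*ρ n (suc n)) (trans
      (cong (λ a → - (sgn (suc n) * (ι (suc n) * ((ι (suc n) + ι (suc n)) * a))))
        (trans (cong (ρ (suc n)) (sym (ℕ.+-identityʳ (suc n)))) (ρ-zero n 0)))
      (solve 3 (λ s a i → :- (s :* (a :* ((a :+ a) :* con 0ℚ))) := i :* con 0ℚ) refl (sgn (suc n)) (ι (suc n)) i)))

  -- The factors in `p-suc` and `S-recurrence` cancel, so the product keeps its value at m = 0.
  p²*S : ∀ m → ι 4 * ι (suc m) * (p (suc m) * p (suc m)) * S (suc m) ≡ 1ℚ
  p²*S zero    = refl
  p²*S (suc m) = *-cancelˡ-≡ (0<ι (suc m)) (begin
    ι (2 ℕ.+ m) * (ι 4 * ι (2 ℕ.+ m) * (p (2 ℕ.+ m) * p (2 ℕ.+ m)) * S (2 ℕ.+ m))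
      ≡⟨ solve 3 (λ i a s → i :* (con (ι 4) :* i :* (a :* a) :* s) := con (ι 4) :* (i :* a) :* (i :* a) :* s) refl
           (ι (2 ℕ.+ m)) (p (2 ℕ.+ m)) (S (2 ℕ.+ m)) ⟩
    ι 4 * (ι (2 ℕ.+ m) * p (2 ℕ.+ m)) * (ι (2 ℕ.+ m) * p (2 ℕ.+ m)) * S (2 ℕ.+ m)
      ≡⟨ cong (λ a → ι 4 * a * a * S (2 ℕ.+ m)) (p-suc (suc m)) ⟩
    ι 4 * ((ι (suc m) + ½) * p (suc m)) * ((ι (suc m) + ½) * p (suc m)) * S (2 ℕ.+ m)
      ≡⟨ solve 3 (λ i a s → con (ι 4) :* ((i :+ con ½) :* a) :* ((i :+ con ½) :* a) :* s
           := a :* a :* ((i :+ i :+ con 1ℚ) :* (i :+ i :+ con 1ℚ) :* s)) refl (ι (suc m)) (p (suc m)) (S (2 ℕ.+ m)) ⟩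
    p (suc m) * p (suc m) * ((ι (suc m) + ι (suc m) + 1ℚ) * (ι (suc m) + ι (suc m) + 1ℚ) * S (2 ℕ.+ m))
      ≡⟨ cong (p (suc m) * p (suc m) *_) (S-recurrence m) ⟩
    p (suc m) * p (suc m) * (ι 4 * (ι (suc m) * (ι (suc m) + 1ℚ)) * S (suc m))
      ≡⟨ solve 3 (λ i a s → a :* a :* (con (ι 4) :* (i :* (i :+ con 1ℚ)) :* s) := (i :+ con 1ℚ) :* (con (ι 4) :* i :* (a :* a) :* s))
           refl (ι (suc m)) (p (suc m)) (S (suc m)) ⟩
    ι (2 ℕ.+ m) * (ι 4 * ι (suc m) * (p (suc m) * p (suc m)) * S (suc m))
      ≡⟨ cong (ι (2 ℕ.+ m) *_) (p²*S m) ⟩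
    ι (2 ℕ.+ m) * 1ℚ ∎)
    where open ≡-Reasoning

  0≤S : ∀ m → 0ℚ ≤ S (suc m)
  0≤S m = proj₁ (alternating-bounds (λ j → ρ (suc m) j * odd⁻¹ j) (λ j → 0≤* (0≤ρ m j) (0≤odd⁻¹ j))
    (λ j → *-mono-≤ (0≤ρ m (suc j)) (0≤odd⁻¹ j) (ρ-antimono m j) (odd⁻¹-antimono (ℕ.n≤1+n j))) (suc m))

  -- The first J terms differ by at most δ each, and both alternating tails lie between 0 and
  -- `odd⁻¹ (k + J)`.
  leibniz-near : ∀ {δ} J r k h → (∀ j → 0ℚ ≤ h j) → (∀ j → h (suc j) ≤ h j) → (∀ j → h j ≤ odd⁻¹ (k ℕ.+ j)) →
    (∀ j → j ℕ.< J → odd⁻¹ (k ℕ.+ j) - h j ≤ δ) →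
    ∣ leibniz k (J ℕ.+ r) - alternating h (J ℕ.+ r) ∣ ≤ ι J * δ + odd⁻¹ (k ℕ.+ J)
  leibniz-near {δ} zero r k h h≥0 h↓ h≤ close =
    let l , u = leibniz-bounds k r
        l′ , u′ = alternating-bounds h h≥0 h↓ r
        o = odd⁻¹ (k ℕ.+ 0)
        L≤o = subst (λ i → leibniz k r ≤ odd⁻¹ i) (sym (ℕ.+-identityʳ k)) u
        A≤o = ≤-trans u′ (h≤ 0)
    in ≤-trans (∣p-q∣≤r (leibniz k r) (alternating h r)
          (≤-trans L≤o (≤-by (alternating h r) l′ (+-comm o (alternating h r))))
          (≤-trans A≤o (≤-by (leibniz k r) l (+-comm o (leibniz k r)))))
        (≤-reflexive (solve 2 (λ o d → o := con 0ℚ :* d :+ o) refl o δ))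
  leibniz-near {δ} (suc J) r k h h≥0 h↓ h≤ close = begin
    ∣ odd⁻¹ k - leibniz (suc k) (J ℕ.+ r) - (h 0 - alternating h′ (J ℕ.+ r)) ∣
      ≡⟨ cong ∣_∣ (solve 4 (λ o l a b → o :- l :- (a :- b) := o :- a :- (l :- b)) refl
           (odd⁻¹ k) (leibniz (suc k) (J ℕ.+ r)) (h 0) (alternating h′ (J ℕ.+ r))) ⟩
    ∣ odd⁻¹ k - h 0 - (leibniz (suc k) (J ℕ.+ r) - alternating h′ (J ℕ.+ r)) ∣
      ≤⟨ ∣p-q∣≤ head-close (leibniz-near J r (suc k) h′ (λ j → h≥0 (suc j)) (λ j → h↓ (suc j))
           (λ j → subst (λ i → h (suc j) ≤ odd⁻¹ i) (ℕ.+-suc k j) (h≤ (suc j)))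
           (λ j j<J → subst (λ i → odd⁻¹ i - h (suc j) ≤ δ) (ℕ.+-suc k j) (close (suc j) (ℕ.s≤s j<J)))) ⟩
    δ + (ι J * δ + odd⁻¹ (suc k ℕ.+ J))
      ≡⟨ solve 3 (λ d j o → d :+ (j :* d :+ o) := (j :+ con 1ℚ) :* d :+ o) refl δ (ι J) (odd⁻¹ (suc k ℕ.+ J)) ⟩
    ι (suc J) * δ + odd⁻¹ (suc k ℕ.+ J)
      ≡⟨ cong (λ i → ι (suc J) * δ + odd⁻¹ i) (ℕ.+-suc k J) ⟨
    ι (suc J) * δ + odd⁻¹ (k ℕ.+ suc J) ∎
    where
    open ≤-Reasoning
    h′ = λ j → h (suc j)
    head-close : ∣ odd⁻¹ k - h 0 ∣ ≤ δ
    head-close = subst (λ i → ∣ odd⁻¹ i - h 0 ∣ ≤ δ) (ℕ.+-identityʳ k)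
      (≤-trans (≤-reflexive (0≤p⇒∣p∣≡p (diff≥0 (h≤ 0)))) (close 0 (ℕ.s≤s ℕ.z≤n)))

  S-near : ∀ m J → J ℕ.≤ suc m → ∣ leibniz 0 (suc m) - S (suc m) ∣ ≤ ι J * (ι J * ι J * recip m) + odd⁻¹ J
  S-near m J J≤m = subst (λ n → ∣ leibniz 0 n - alternating h n ∣ ≤ ι J * δ + odd⁻¹ J) (ℕ.m+[n∸m]≡n J≤m)
    (leibniz-near J (suc m ℕ.∸ J) 0 h (λ j → 0≤* (0≤ρ m j) (0≤odd⁻¹ j))
      (λ j → *-mono-≤ (0≤ρ m (suc j)) (0≤odd⁻¹ j) (ρ-antimono m j) (odd⁻¹-antimono (ℕ.n≤1+n j)))
      (λ j → ≤-trans (*-monoʳ (0≤odd⁻¹ j) (ρ≤1 m j)) (≤-reflexive (*-identityˡ (odd⁻¹ j))))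
      close)
    where
    h = λ j → ρ (suc m) j * odd⁻¹ j
    δ = ι J * ι J * recip m
    open ≤-Reasoning
    close : ∀ j → j ℕ.< J → odd⁻¹ j - h j ≤ δ
    close j j<J = *-cancelˡ-≤ (0<ι m) (begin
      ι (suc m) * (odd⁻¹ j - h j)
        ≡⟨ solve 3 (λ i r o → i :* (o :- r :* o) := i :* (con 1ℚ :- r) :* o) refl (ι (suc m)) (ρ (suc m) j) (odd⁻¹ j) ⟩
      ι (suc m) * (1ℚ - ρ (suc m) j) * odd⁻¹ j
        ≤⟨ *-mono-≤ (0≤* (0≤ι (suc m)) (diff≥0 (ρ≤1 m j))) 0≤1 (ρ-near-1 m j) (odd⁻¹≤1 j) ⟩
      ι j * ι (suc j) * 1ℚ
        ≡⟨ *-identityʳ (ι j * ι (suc j)) ⟩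
      ι j * ι (suc j)
        ≤⟨ *-mono-≤ (0≤ι j) (0≤ι J) (ι-mono-≤ (ℕ.<⇒≤ j<J)) (ι-mono-≤ j<J) ⟩
      ι J * ι J
        ≡⟨ trans (sym (*-identityʳ (ι J * ι J))) (cong (ι J * ι J *_) (sym (ι*recip m))) ⟩
      ι J * ι J * (ι (suc m) * recip m)
        ≡⟨ solve 3 (λ a b c → a :* (b :* c) := b :* (a :* c)) refl (ι J * ι J) (ι (suc m)) (recip m) ⟩
      ι (suc m) * δ ∎)

  S-limit : ∀ ε → 0ℚ < ε → ∃[ M ] (∀ m → M ℕ.≤ m → ∣ leibniz 0 (suc m) - S (suc m) ∣ ≤ ε)
  S-limit ε 0<ε = J ℕ.⊔ ↧ₙ η , λ m h → begin
      ∣ leibniz 0 (suc m) - S (suc m) ∣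
        ≤⟨ S-near m J (ℕ.m≤n⇒m≤1+n (ℕ.m⊔n≤o⇒m≤o J (↧ₙ η) h)) ⟩
      ι J * (ι J * ι J * recip m) + odd⁻¹ J
        ≤⟨ +-mono-≤ (small m (ℕ.m⊔n≤o⇒n≤o J (↧ₙ η) h)) (archimedean 0<½ε (2 ℕ.* J) (ℕ.m≤n*m J 2)) ⟩
      ½ * ε + ½ * ε
        ≡⟨ solve 1 (λ e → con ½ :* e :+ con ½ :* e := e) refl ε ⟩
      ε ∎
    where
    open ≤-Reasoning
    0<½ε = 0<p*q (positive⁻¹ ½) 0<ε
    -- This J makes the tail at most ε/2. With J fixed, `η` makes the head J³/(m+1) at most ε/2 as
    -- well.
    J = ↧ₙ (½ * ε)
    J³ = J ℕ.* (J ℕ.* J)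
    η = recip J³ * (½ * ε)
    small : ∀ m → ↧ₙ η ℕ.≤ m → ι J * (ι J * ι J * recip m) ≤ ½ * ε
    small m h = begin
      ι J * (ι J * ι J * recip m)
        ≡⟨ trans (sym (*-assoc (ι J) (ι J * ι J) (recip m)))
             (cong (_* recip m) (sym (trans (ι-* J (J ℕ.* J)) (cong (ι J *_) (ι-* J J))))) ⟩
      ι J³ * recip m
        ≤⟨ *-mono-≤ (0≤ι J³) (<⇒≤ (0<p*q (0<recip J³) 0<½ε)) (ι-mono-≤ (ℕ.n≤1+n J³)) (archimedean (0<p*q (0<recip J³) 0<½ε) m h) ⟩
      ι (suc J³) * (recip J³ * (½ * ε))
        ≡⟨ trans (sym (*-assoc (ι (suc J³)) (recip J³) (½ * ε))) (trans (cong (_* (½ * ε)) (ι*recip J³)) (*-identityˡ (½ * ε))) ⟩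
      ½ * ε ∎

  -- Monotone bounds enclosing 1/π

  -- Both tend to 1/π, the first from below and the second from above.
  np² [n+½]p² : ℕ → ℚ
  np² n      = ι n * (p n * p n)
  [n+½]p² n = (ι n + ½) * (p n * p n)

  np²-suc : ∀ n → np² n ≤ np² (suc n)
  np²-suc n = *-cancelˡ-≤ (0<ι n) (≤-by (¼ * (p n * p n)) (0≤* (nonNegative⁻¹ ¼) (0≤p² (p n)))
    (trans (solve 2 (λ i a → (i :+ con 1ℚ) :* (i :* (a :* a)) :+ con ¼ :* (a :* a) := (i :+ con ½) :* a :* ((i :+ con ½) :* a)) refl (ι n) (p n))
    (trans (cong (λ a → a * a) (sym (p-suc n)))
      (solve 2 (λ i a → i :* a :* (i :* a) := i :* (i :* (a :* a))) refl (ι (suc n)) (p (suc n))))))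

  [n+½]p²-suc : ∀ n → [n+½]p² (suc n) ≤ [n+½]p² n
  [n+½]p²-suc n = *-cancelˡ-≤ (0<p*q (0<ι n) (0<ι n)) (≤-by (¼ * [n+½]p² n)
    (0≤* (nonNegative⁻¹ ¼) (0≤* (0≤+ (0≤ι n) (nonNegative⁻¹ ½)) (0≤p² (p n))))
    (trans (cong (_+ ¼ * [n+½]p² n) (trans
        (solve 2 (λ i a → i :* i :* ((i :+ con ½) :* (a :* a)) := (i :+ con ½) :* (i :* a :* (i :* a))) refl (ι (suc n)) (p (suc n)))
        (cong (λ a → (ι (suc n) + ½) * (a * a)) (p-suc n))))
      (solve 2 (λ i a → (i :+ con 1ℚ :+ con ½) :* ((i :+ con ½) :* a :* ((i :+ con ½) :* a)) :+ con ¼ :* ((i :+ con ½) :* (a :* a))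
        := (i :+ con 1ℚ) :* (i :+ con 1ℚ) :* ((i :+ con ½) :* (a :* a))) refl (ι n) (p n))))

  np²-mono : ∀ n d → np² n ≤ np² (d ℕ.+ n)
  np²-mono n zero    = ≤-refl
  np²-mono n (suc d) = ≤-trans (np²-mono n d) (np²-suc (d ℕ.+ n))

  [n+½]p²-antimono : ∀ n d → [n+½]p² (d ℕ.+ n) ≤ [n+½]p² n
  [n+½]p²-antimono n zero    = ≤-refl
  [n+½]p²-antimono n (suc d) = ≤-trans ([n+½]p²-suc (d ℕ.+ n)) ([n+½]p²-antimono n d)

  np²≤[n+½]p² : ∀ n → np² n ≤ [n+½]p² n
  np²≤[n+½]p² n = *-monoʳ (0≤p² (p n)) (≤-by {ι n} ½ (nonNegative⁻¹ ½) refl)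

  np²≤1 : ∀ n → np² n ≤ 1ℚ
  np²≤1 n = ≤-trans (np²≤[n+½]p² n) (subst (λ m → [n+½]p² m ≤ 1ℚ) (ℕ.+-identityʳ n)
    (≤-trans ([n+½]p²-antimono 0 n) (≤-by ½ (nonNegative⁻¹ ½) refl)))

  4npp*S : ∀ m → ι 4 * S (suc m) * np² (suc m) ≡ 1ℚ
  4npp*S m = trans (solve 4 (λ f s i a → f :* s :* (i :* a) := f :* i :* a :* s) refl (ι 4) (S (suc m)) (ι (suc m)) (p (suc m) * p (suc m))) (p²*S m)

  -- The identity `4npp*S` at a larger index, weakened by monotonicity to the fixed index n.
  S-upper : ∀ n d → ι 4 * S (suc (d ℕ.+ n)) * np² n ≤ 1ℚ
  S-upper n d = ≤-trans (*-monoˡ (0≤* (0≤ι 4) (0≤S (d ℕ.+ n))) (np²-mono n (suc d))) (≤-reflexive (4npp*S (d ℕ.+ n)))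

  S-lower : ∀ n d → 1ℚ ≤ ι 4 * S (suc (d ℕ.+ n)) * [n+½]p² n
  S-lower n d = ≤-trans (≤-reflexive (sym (4npp*S (d ℕ.+ n)))) (*-monoˡ (0≤* (0≤ι 4) (0≤S (d ℕ.+ n)))
    (≤-trans (np²≤[n+½]p² (suc d ℕ.+ n)) ([n+½]p²-antimono n (suc d))))

  -- Numerical bounds for π

  -- k/(4k² + 1), a convergent of the continued fraction of
  -- Σ_{i≥0} (-1)^i/(2(k+i)+1).
  lo : ℕ → ℚ
  lo k = ι k * recip (4 ℕ.* (k ℕ.* k))

  lo-inverse : ∀ k → (ι 4 * (ι k * ι k) + 1ℚ) * recip (4 ℕ.* (k ℕ.* k)) ≡ 1ℚ
  lo-inverse k = trans (cong (λ a → (a + 1ℚ) * recip (4 ℕ.* (k ℕ.* k))) (sym (trans (ι-* 4 (k ℕ.* k)) (cong (ι 4 *_) (ι-* k k)))))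
    (ι*recip (4 ℕ.* (k ℕ.* k)))

  -- The two sides differ by exactly 40 over the product of the four denominators. Each `1ℚ` in the
  -- calculation is a denominator times its inverse, inserted to reduce the claim to a polynomial
  -- identity.
  lo-step : ∀ k → lo k ≤ odd⁻¹ k - odd⁻¹ (1 ℕ.+ k) + lo (2 ℕ.+ k)
  lo-step k = ≤-by (ι 40 * (z * z′ * l * l″)) (0≤* (0≤ι 40) (0≤* (0≤* (0≤* (0≤odd⁻¹ k) (0≤odd⁻¹ (1 ℕ.+ k)))
      (<⇒≤ (0<recip (4 ℕ.* (k ℕ.* k))))) (<⇒≤ (0<recip (4 ℕ.* ((2 ℕ.+ k) ℕ.* (2 ℕ.+ k))))))) (begin
    k′ * l + ι 40 * (z * z′ * l * l″)
      ≡⟨ solve 5 (λ k z z′ l l″ →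
           k :* l :+ con (ι 40) :* (z :* z′ :* l :* l″)
           := k :* l :* (con 1ℚ :* con 1ℚ :* con 1ℚ) :+ con (ι 40) :* (z :* z′ :* l :* l″)) refl k′ z z′ l l″ ⟩
    k′ * l * (1ℚ * 1ℚ * 1ℚ) + ι 40 * (z * z′ * l * l″)
      ≡⟨ cong (λ a → k′ * l * a + ι 40 * (z * z′ * l * l″))
           (sym (cong₂ _*_ (cong₂ _*_ (odd⁻¹-inverse k) (odd⁻¹-inverse (1 ℕ.+ k))) (lo-inverse (2 ℕ.+ k)))) ⟩
    k′ * l * (Z * z * (Z′ * z′) * (L″ * l″)) + ι 40 * (z * z′ * l * l″)
      ≡⟨ solve 5 (λ k z z′ l l″ → let Z = k :+ k :+ con 1ℚ
                                      Z′ = k :+ con 1ℚ :+ (k :+ con 1ℚ) :+ con 1ℚ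
                                      L = con (ι 4) :* (k :* k) :+ con 1ℚ
                                      K = k :+ con 1ℚ :+ con 1ℚ
                                      L″ = con (ι 4) :* (K :* K) :+ con 1ℚ in
           k :* l :* (Z :* z :* (Z′ :* z′) :* (L″ :* l″)) :+ con (ι 40) :* (z :* z′ :* l :* l″)
           := z :* (Z′ :* z′ :* (L :* l) :* (L″ :* l″)) :- z′ :* (Z :* z :* (L :* l) :* (L″ :* l″))
              :+ K :* l″ :* (Z :* z :* (Z′ :* z′) :* (L :* l))) refl k′ z z′ l l″ ⟩
    z * (Z′ * z′ * (L * l) * (L″ * l″)) - z′ * (Z * z * (L * l) * (L″ * l″)) + ι (2 ℕ.+ k) * l″ * (Z * z * (Z′ * z′) * (L * l))
      ≡⟨ cong₂ _+_ (cong₂ _-_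
           (cong (z *_) (cong₂ _*_ (cong₂ _*_ (odd⁻¹-inverse (1 ℕ.+ k)) (lo-inverse k)) (lo-inverse (2 ℕ.+ k))))
           (cong (z′ *_) (cong₂ _*_ (cong₂ _*_ (odd⁻¹-inverse k) (lo-inverse k)) (lo-inverse (2 ℕ.+ k)))))
           (cong (ι (2 ℕ.+ k) * l″ *_) (cong₂ _*_ (cong₂ _*_ (odd⁻¹-inverse k) (odd⁻¹-inverse (1 ℕ.+ k))) (lo-inverse k))) ⟩
    z * (1ℚ * 1ℚ * 1ℚ) - z′ * (1ℚ * 1ℚ * 1ℚ) + ι (2 ℕ.+ k) * l″ * (1ℚ * 1ℚ * 1ℚ)
      ≡⟨ solve 3 (λ a b c → a :* (con 1ℚ :* con 1ℚ :* con 1ℚ) :- b :* (con 1ℚ :* con 1ℚ :* con 1ℚ) :+ c :* (con 1ℚ :* con 1ℚ :* con 1ℚ)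
           := a :- b :+ c) refl z z′ (ι (2 ℕ.+ k) * l″) ⟩
    z - z′ + lo (2 ℕ.+ k) ∎)
    where
    open ≡-Reasoning
    k′ = ι k
    z = odd⁻¹ k
    z′ = odd⁻¹ (1 ℕ.+ k)
    l = recip (4 ℕ.* (k ℕ.* k))
    l″ = recip (4 ℕ.* ((2 ℕ.+ k) ℕ.* (2 ℕ.+ k)))
    Z = ι k + ι k + 1ℚ
    Z′ = ι (1 ℕ.+ k) + ι (1 ℕ.+ k) + 1ℚ
    L = ι 4 * (ι k * ι k) + 1ℚ
    L″ = ι 4 * (ι (2 ℕ.+ k) * ι (2 ℕ.+ k)) + 1ℚ


  lo≤odd⁻¹ : ∀ k → lo k ≤ odd⁻¹ k
  lo≤odd⁻¹ k = *-cancelˡ-≤ (0<p*q 0<Z 0<L) (≤-by D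
    (0≤+ (0≤+ (0≤p² (k′ - ½)) (0≤* (0≤ι k) (0≤ι k))) (nonNegative⁻¹ (ℤ.+ 3 / 4))) (begin
    Z * L * (k′ * l) + D
      ≡⟨ solve 4 (λ k l Z L → Z :* L :* (k :* l) :+ D[ k ] := Z :* k :* (L :* l) :+ D[ k ]) refl k′ l Z L ⟩
    Z * k′ * (L * l) + D
      ≡⟨ cong (λ a → Z * k′ * a + D) (lo-inverse k) ⟩
    Z * k′ * 1ℚ + D
      ≡⟨ solve 1 (λ k → (k :+ k :+ con 1ℚ) :* k :* con 1ℚ :+ D[ k ] := (con (ι 4) :* (k :* k) :+ con 1ℚ) :* con 1ℚ) refl k′ ⟩
    L * 1ℚ
      ≡⟨ cong (L *_) (odd⁻¹-inverse k) ⟨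
    L * (Z * odd⁻¹ k)
      ≡⟨ solve 3 (λ a b c → a :* (b :* c) := b :* a :* c) refl L Z (odd⁻¹ k) ⟩
    Z * L * odd⁻¹ k ∎))
    where
    open ≡-Reasoning
    k′ = ι k
    l = recip (4 ℕ.* (k ℕ.* k))
    Z = k′ + k′ + 1ℚ
    L = ι 4 * (k′ * k′) + 1ℚ
    D = (k′ - ½) * (k′ - ½) + k′ * k′ + ℤ.+ 3 / 4
    D[_] : ∀ {n} → Polynomial n → Polynomial n
    D[ k ] = (k :- con ½) :* (k :- con ½) :+ k :* k :+ con (ℤ.+ 3 / 4)
    0<Z : 0ℚ < Z
    0<Z = +-mono-≤-< (0≤+ (0≤ι k) (0≤ι k)) 0<1
    0<L : 0ℚ < L
    0<L = +-mono-≤-< (0≤* (0≤ι 4) (0≤* (0≤ι k) (0≤ι k))) 0<1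

  -- For the infinite tail `lo k` itself is a lower bound; `odd⁻¹ (k + r)` pays for the truncation.
  -- Steps of two preserve the sign of the remaining sum.
  leibniz-lower : ∀ k r → lo k ≤ leibniz k r + odd⁻¹ (k ℕ.+ r)
  leibniz-lower k 0 = subst (lo k ≤_) (sym (trans (+-identityˡ (odd⁻¹ (k ℕ.+ 0))) (cong odd⁻¹ (ℕ.+-identityʳ k)))) (lo≤odd⁻¹ k)
  leibniz-lower k 1 = ≤-trans (lo≤odd⁻¹ k) (≤-by (odd⁻¹ (k ℕ.+ 1)) (0≤odd⁻¹ (k ℕ.+ 1))
    (solve 2 (λ a b → a :+ b := a :- con 0ℚ :+ b) refl (odd⁻¹ k) (odd⁻¹ (k ℕ.+ 1))))
  leibniz-lower k (suc (suc r)) = ≤-trans (lo-step k) (≤-trans (+-monoʳ-≤ (odd⁻¹ k - odd⁻¹ (1 ℕ.+ k)) (leibniz-lower (2 ℕ.+ k) r))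
    (≤-reflexive (trans (solve 4 (λ a b c d → a :- b :+ (c :+ d) := a :- (b :- c) :+ d) refl
        (odd⁻¹ k) (odd⁻¹ (1 ℕ.+ k)) (leibniz (2 ℕ.+ k) r) (odd⁻¹ (2 ℕ.+ k ℕ.+ r)))
      (cong (λ i → leibniz k (2 ℕ.+ r) + odd⁻¹ i) (sym (trans (ℕ.+-suc k (suc r)) (cong suc (ℕ.+-suc k r))))))))

  leibniz-upper : ∀ k r → leibniz k (suc r) ≤ odd⁻¹ k - lo (suc k) + odd⁻¹ (suc k ℕ.+ r)
  leibniz-upper k r = subst (odd⁻¹ k - leibniz (suc k) r ≤_)
    (solve 3 (λ o a b → o :- (a :- b) := o :- a :+ b) refl (odd⁻¹ k) (lo (suc k)) e)
    (+-monoʳ-≤ (odd⁻¹ k) (neg-antimono-≤ (p≤q+r⇒p-q≤r (lo (suc k)) e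
      (subst (lo (suc k) ≤_) (+-comm (leibniz (suc k) r) e) (leibniz-lower (suc k) r)))))
    where e = odd⁻¹ (suc k ℕ.+ r)

  -- The offset is even so that the remaining sum keeps its sign.
  leibniz-+ : ∀ j k r → leibniz k (j ℕ.* 2 ℕ.+ r) ≡ leibniz k (j ℕ.* 2) + leibniz (j ℕ.* 2 ℕ.+ k) r
  leibniz-+ zero    k r = sym (+-identityˡ (leibniz k r))
  leibniz-+ (suc j) k r = trans (cong (λ t → odd⁻¹ k - (odd⁻¹ (1 ℕ.+ k) - t))
      (trans (leibniz-+ j (2 ℕ.+ k) r) (cong (λ i → leibniz (2 ℕ.+ k) (j ℕ.* 2) + leibniz i r)
        (trans (ℕ.+-suc (j ℕ.* 2) (suc k)) (cong suc (ℕ.+-suc (j ℕ.* 2) k))))))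
    (solve 4 (λ a b c d → a :- (b :- (c :+ d)) := a :- (b :- c) :+ d) refl
      (odd⁻¹ k) (odd⁻¹ (1 ℕ.+ k)) (leibniz (2 ℕ.+ k) (j ℕ.* 2)) (leibniz (2 ℕ.+ (j ℕ.* 2 ℕ.+ k)) r))

  πₙ : ℕ → ℚ
  πₙ m = ι 4 * leibniz 0 m

  -- In the limit, 1/a ≤ π and π ≤ 1/a respectively.
  _⁻¹≤π π≤_⁻¹ : ℚ → Set
  a ⁻¹≤π = ∀ ε → 0ℚ < ε → ∃[ M ] (∀ m → M ℕ.≤ m → 1ℚ ≤ πₙ m * a + ε)
  π≤ a ⁻¹ = ∀ ε → 0ℚ < ε → ∃[ M ] (∀ m → M ℕ.≤ m → πₙ m * a ≤ 1ℚ + ε)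

  module _ (n : ℕ) where

    private
      witness : ∀ {P : ℕ → Set} M → (∀ d → M ℕ.≤ d ℕ.+ n → P (suc (d ℕ.+ n))) → ∃[ M′ ] (∀ m → M′ ℕ.≤ m → P m)
      witness {P} M h = suc (M ℕ.⊔ n) , λ
        { (suc m) (ℕ.s≤s M′≤m) → subst (λ i → P (suc i)) (ℕ.m∸n+n≡m (ℕ.m⊔n≤o⇒n≤o M n M′≤m))
            (h (m ℕ.∸ n) (subst (M ℕ.≤_) (sym (ℕ.m∸n+n≡m (ℕ.m⊔n≤o⇒n≤o M n M′≤m))) (ℕ.m⊔n≤o⇒m≤o M n M′≤m))) }

      shift : ∀ {ε x} y a → 0ℚ ≤ ε → 0ℚ ≤ a → a ≤ 1ℚ → x ≤ y + ¼ * ε → ι 4 * x * a ≤ ι 4 * y * a + ε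
      shift {ε} {x} y a 0≤ε 0≤a a≤1 h = ≤-trans (*-monoʳ 0≤a (*-monoˡ (0≤ι 4) h))
        (≤-by ((1ℚ - a) * ε) (0≤* (diff≥0 a≤1) 0≤ε)
          (solve 3 (λ a e y → con (ι 4) :* (y :+ con ¼ :* e) :* a :+ (con 1ℚ :- a) :* e := con (ι 4) :* y :* a :+ e) refl a ε y))

    [n+½]p²⁻¹≤π : [n+½]p² n ⁻¹≤π
    [n+½]p²⁻¹≤π ε 0<ε =
      let M , near = S-limit (¼ * ε) (0<p*q (positive⁻¹ ¼) 0<ε)
      in witness M λ d M≤ → ≤-trans (S-lower n d)
           (shift (leibniz 0 (suc (d ℕ.+ n))) ([n+½]p² n) (<⇒≤ 0<ε) (0≤* (0≤+ (0≤ι n) (nonNegative⁻¹ ½)) (0≤p² (p n)))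
             (subst (λ m → [n+½]p² m ≤ 1ℚ) (ℕ.+-identityʳ n) (≤-trans ([n+½]p²-antimono 0 n) (≤-by ½ (nonNegative⁻¹ ½) refl)))
             (p-q≤r⇒p≤q+r (S (suc (d ℕ.+ n))) (leibniz 0 (suc (d ℕ.+ n)))
               (≤-trans (p≤∣p∣ _) (subst (_≤ ¼ * ε) (∣p-q∣≡∣q-p∣ (leibniz 0 (suc (d ℕ.+ n))) (S (suc (d ℕ.+ n)))) (near (d ℕ.+ n) M≤)))))

    π≤np²⁻¹ : π≤ np² n ⁻¹
    π≤np²⁻¹ ε 0<ε =
      let M , near = S-limit (¼ * ε) (0<p*q (positive⁻¹ ¼) 0<ε)
      in witness M λ d M≤ → ≤-trans
           (shift (S (suc (d ℕ.+ n))) (np² n) (<⇒≤ 0<ε) (0≤* (0≤ι n) (0≤p² (p n))) (np²≤1 n)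
             (p-q≤r⇒p≤q+r (leibniz 0 (suc (d ℕ.+ n))) (S (suc (d ℕ.+ n))) (≤-trans (p≤∣p∣ _) (near (d ℕ.+ n) M≤))))
           (+-monoˡ-≤ ε (S-upper n d))

  -- The reciprocals of the bounds 3.1415925 and 3.1415928, in the form in which the two relations
  -- with π take them.
  π⁻ π⁺ : ℚ
  π⁻ = ℤ.+ 10000000 / 31415925
  π⁺ = ℤ.+ 10000000 / 31415928

  private
    -- Twenty terms are evaluated exactly. With the correction `lo` of the tail this determines π up
    -- to an error below 10^-7 on either side.
    from-20 : ∀ {P : ℕ → Set} ε → 0ℚ < ε → (∀ r → odd⁻¹ (21 ℕ.+ r) ≤ ¼ * ε → P (20 ℕ.+ suc r)) → ∃[ M ] (∀ m → M ℕ.≤ m → P m)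
    from-20 {P} ε 0<ε h = 21 ℕ.+ d , λ m 21+d≤m → let k = m ℕ.∸ 21 in
        subst P (trans (ℕ.+-suc 20 k) (ℕ.m+[n∸m]≡n (ℕ.m+n≤o⇒m≤o 21 21+d≤m)))
          (h k (archimedean 0<¼ε (2 ℕ.* (21 ℕ.+ k))
            (ℕ.≤-trans (ℕ.≤-trans (ℕ.m≤n+m d 21) (subst (21 ℕ.+ d ℕ.≤_) (sym (ℕ.m+[n∸m]≡n (ℕ.m+n≤o⇒m≤o 21 21+d≤m))) 21+d≤m))
              (ℕ.m≤n*m (21 ℕ.+ k) 2))))
      where
      0<¼ε = 0<p*q (positive⁻¹ ¼) 0<ε
      d = ↧ₙ (¼ * ε)

  π⁻≤π : π⁻ ⁻¹≤π
  π⁻≤π ε 0<ε = from-20 {λ m → 1ℚ ≤ πₙ m * π⁻ + ε} ε 0<ε λ r small →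
    let o = odd⁻¹ (21 ℕ.+ r)
        L = leibniz 20 (suc r)
        L₀ = leibniz 0 20
    in begin
      1ℚ
        ≤⟨ from-yes (1ℚ ≤? ι 4 * (L₀ + lo 20) * π⁻) ⟩
      ι 4 * (L₀ + lo 20) * π⁻
        ≤⟨ *-monoʳ 0≤π⁻ (*-monoˡ (0≤ι 4) (+-monoʳ-≤ L₀ (subst (λ i → lo 20 ≤ L + odd⁻¹ i) (ℕ.+-suc 20 r) (leibniz-lower 20 (suc r))))) ⟩
      ι 4 * (L₀ + (L + o)) * π⁻
        ≡⟨ solve 4 (λ a b o c → con (ι 4) :* (a :+ (b :+ o)) :* c := con (ι 4) :* (a :+ b) :* c :+ con (ι 4) :* o :* c) refl L₀ L o π⁻ ⟩
      ι 4 * (L₀ + L) * π⁻ + ι 4 * o * π⁻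
        ≤⟨ +-mono-≤ (≤-reflexive (cong (λ a → ι 4 * a * π⁻) (sym (leibniz-+ 10 0 (suc r)))))
             (*-mono-≤ (0≤* (0≤ι 4) (0≤odd⁻¹ (21 ℕ.+ r))) 0≤1 (*-monoˡ (0≤ι 4) small) (from-yes (π⁻ ≤? 1ℚ))) ⟩
      πₙ (20 ℕ.+ suc r) * π⁻ + ι 4 * (¼ * ε) * 1ℚ
        ≡⟨ cong (πₙ (20 ℕ.+ suc r) * π⁻ +_) (solve 1 (λ e → con (ι 4) :* (con ¼ :* e) :* con 1ℚ := e) refl ε) ⟩
      πₙ (20 ℕ.+ suc r) * π⁻ + ε ∎
    where
    open ≤-Reasoning
    0≤π⁻ = nonNegative⁻¹ π⁻

  π≤π⁺ : π≤ π⁺ ⁻¹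
  π≤π⁺ ε 0<ε = from-20 {λ m → πₙ m * π⁺ ≤ 1ℚ + ε} ε 0<ε λ r small →
    let o = odd⁻¹ (21 ℕ.+ r)
        L = leibniz 20 (suc r)
        L₀ = leibniz 0 20
        u = odd⁻¹ 20 - lo 21
    in begin
      πₙ (20 ℕ.+ suc r) * π⁺
        ≡⟨ cong (λ a → ι 4 * a * π⁺) (leibniz-+ 10 0 (suc r)) ⟩
      ι 4 * (L₀ + L) * π⁺
        ≤⟨ *-monoʳ 0≤π⁺ (*-monoˡ (0≤ι 4) (+-monoʳ-≤ L₀ (leibniz-upper 20 r))) ⟩
      ι 4 * (L₀ + (u + o)) * π⁺
        ≡⟨ solve 4 (λ a b o c → con (ι 4) :* (a :+ (b :+ o)) :* c := con (ι 4) :* (a :+ b) :* c :+ con (ι 4) :* o :* c) refl L₀ u o π⁺ ⟩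
      ι 4 * (L₀ + u) * π⁺ + ι 4 * o * π⁺
        ≤⟨ +-mono-≤ (from-yes (ι 4 * (L₀ + u) * π⁺ ≤? 1ℚ))
             (*-mono-≤ (0≤* (0≤ι 4) (0≤odd⁻¹ (21 ℕ.+ r))) 0≤1 (*-monoˡ (0≤ι 4) small) (from-yes (π⁺ ≤? 1ℚ))) ⟩
      1ℚ + ι 4 * (¼ * ε) * 1ℚ
        ≡⟨ cong (1ℚ +_) (solve 1 (λ e → con (ι 4) :* (con ¼ :* e) :* con 1ℚ := e) refl ε) ⟩
      1ℚ + ε ∎
    where
    open ≤-Reasoning
    0≤π⁺ = nonNegative⁻¹ π⁺

-- T² against 49/(96πN), as rational inequalities

module Bounds where

  open import Data.Rational.Base
  open import Data.Rational.Properties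
  open import Data.Rational.Solver using (module +-*-Solver)
  open import Defs using (p≤∣p∣; 0<p*q; p-q≤r⇒p≤q+r; ∣p-q∣≡∣q-p∣)
  open Rationals
  open WalkSeries using (p; 0≤p; G; ⅔)
  open Asymptotics using (T; T-asymptotic; G²-limit; ⅞)
  open Counting using (0≤T)
  open WallisLeibniz using (np²; [n+½]p²)

  open +-*-Solver

  -- Of the constant 1000, 650 covers `T-asymptotic`; the other 350 absorbs the error of G² and the
  -- differences between N, N + 1 and N + 3/2.
  error : ℕ → ℚ
  error N = (ℤ.+ 1000 / 1) * p (suc N) * recip N

  0≤error : ∀ N → 0ℚ ≤ error N
  0≤error N = 0≤* (0≤* (nonNegative⁻¹ (ℤ.+ 1000 / 1)) (0≤p (suc N))) (<⇒≤ (0<recip N))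

  module _ (M : ℕ) (1000≤N : 1000 ℕ.≤ suc M) where

    private
      N = suc M
      n = suc N
      ν i P t a d : ℚ
      ν = ι N
      i = ι n
      P = p n
      t = T n
      a = ⅞ * ∣ G n ∣
      d = error N
      -- The limit (7/8)² · 2/3 of a².
      s : ℚ
      s = ℤ.+ 49 / 96

      0≤i : 0ℚ ≤ i
      0≤i = 0≤ι n
      0≤P : 0ℚ ≤ P
      0≤P = 0≤p n
      0≤a : 0ℚ ≤ a
      0≤a = 0≤* (nonNegative⁻¹ ⅞) (0≤∣p∣ (G n))
      0≤ν-1000 : 0ℚ ≤ ν - (ℤ.+ 1000 / 1)
      0≤ν-1000 = diff≥0 (subst (_≤ ν) (ι≡/1 1000) (ι-mono-≤ 1000≤N))

      δ = ∣ t - ⅞ * G n * P ∣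

      t≤ : t ≤ a * P + δ
      t≤ = p-q≤r⇒p≤q+r t (a * P) (≤-trans (+-monoʳ-≤ t (neg-antimono-≤ (*-monoʳ 0≤P (*-monoˡ (nonNegative⁻¹ ⅞) (p≤∣p∣ (G n))))))
             (p≤∣p∣ (t - ⅞ * G n * P)))

      -- The sign of `G n` is left open: if it is negative, then a P = -⅞ G n P is at most δ
      -- already, because t ≥ 0.
      t≥ : a * P ≤ t + δ
      t≥ with ∣p∣≡p∨∣p∣≡-p (G n)
      ... | inj₁ eq = subst (λ h → ⅞ * h * P ≤ t + δ) (sym eq) (p-q≤r⇒p≤q+r (⅞ * G n * P) t
              (subst (⅞ * G n * P - t ≤_) (∣p-q∣≡∣q-p∣ (⅞ * G n * P) t) (p≤∣p∣ (⅞ * G n * P - t))))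
      ... | inj₂ eq = subst (λ h → ⅞ * h * P ≤ t + δ) (sym eq) (≤-trans (≤-by t (0≤T M) (solve 3 (λ g c t → con ⅞ :* (:- g) :* c :+ t := t :- con ⅞ :* g :* c) refl (G n) P t))
              (≤-trans (p≤∣p∣ (t - ⅞ * G n * P)) (≤-by t (0≤T M) (+-comm δ t))))

      iδ≤ : i * δ ≤ ι 650 * P
      iδ≤ = T-asymptotic n

      it≤ : i * t ≤ i * (a * P) + ι 650 * P
      it≤ = ≤-trans (*-monoˡ 0≤i t≤) (≤-trans (≤-reflexive (*-distribˡ-+ i (a * P) δ)) (+-monoʳ-≤ (i * (a * P)) iδ≤))

      it≥ : i * (a * P) ≤ i * t + ι 650 * P
      it≥ = ≤-trans (*-monoˡ 0≤i t≥) (≤-trans (≤-reflexive (*-distribˡ-+ i t δ)) (+-monoʳ-≤ (i * t) iδ≤))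

      id≡ : i * d ≡ (ℤ.+ 1000 / 1) * P
      id≡ = trans (solve 4 (λ i k c r → i :* (k :* c :* r) := i :* r :* (k :* c)) refl i ((ℤ.+ 1000 / 1)) P (recip N))
        (trans (cong (_* ((ℤ.+ 1000 / 1) * P)) (ι*recip N)) (*-identityˡ ((ℤ.+ 1000 / 1) * P)))

      a²≡ : a * a ≡ ℤ.+ 49 / 64 * (G n * G n)
      a²≡ = trans (solve 1 (λ g → con ⅞ :* g :* (con ⅞ :* g) := con (ℤ.+ 49 / 64) :* (g :* g)) refl ∣ G n ∣)
        (cong (ℤ.+ 49 / 64 *_) (∣p∣² (G n)))

      -- 192 is (49/64) · 250 rounded up.
      ia²≤ : 0ℚ ≤ s * i + (ℤ.+ 192 / 1) - i * (a * a)
      ia²≤ = subst (λ b → 0ℚ ≤ s * i + (ℤ.+ 192 / 1) - i * b) (sym a²≡) (≤-trans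
        (0≤+ (0≤* (nonNegative⁻¹ (ℤ.+ 49 / 64)) (diff≥0 (≤-trans (*-monoˡ 0≤i (p≤∣p∣ (G n * G n - ⅔))) (G²-limit n))))
             (nonNegative⁻¹ ((ℤ.+ 192 / 1) - ℤ.+ 49 / 64 * (ℤ.+ 250 / 1))))
        (≤-reflexive (solve 2 (λ i g → con (ℤ.+ 49 / 64) :* (con ((ℤ.+ 250 / 1)) :- i :* (g :- con ⅔)) :+ con ((ℤ.+ 192 / 1) - ℤ.+ 49 / 64 * (ℤ.+ 250 / 1))
            := con s :* i :+ con ((ℤ.+ 192 / 1)) :- i :* (con (ℤ.+ 49 / 64) :* g)) refl i (G n * G n))))

      ia²≥ : 0ℚ ≤ i * (a * a) + (ℤ.+ 192 / 1) - s * i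
      ia²≥ = subst (λ b → 0ℚ ≤ i * b + (ℤ.+ 192 / 1) - s * i) (sym a²≡) (≤-trans
        (0≤+ (0≤* (nonNegative⁻¹ (ℤ.+ 49 / 64)) (diff≥0 (≤-trans (*-monoˡ 0≤i
                (subst (- (G n * G n - ⅔) ≤_) (∣-p∣≡∣p∣ (G n * G n - ⅔)) (p≤∣p∣ (- (G n * G n - ⅔))))) (G²-limit n))))
             (nonNegative⁻¹ ((ℤ.+ 192 / 1) - ℤ.+ 49 / 64 * (ℤ.+ 250 / 1))))
        (≤-reflexive (solve 2 (λ i g → con (ℤ.+ 49 / 64) :* (con ((ℤ.+ 250 / 1)) :- i :* (:- (g :- con ⅔))) :+ con ((ℤ.+ 192 / 1) - ℤ.+ 49 / 64 * (ℤ.+ 250 / 1))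
            := i :* (con (ℤ.+ 49 / 64) :* g) :+ con ((ℤ.+ 192 / 1)) :- con s :* i) refl i (G n * G n))))

      -- The bound i a² ≥ (49/96) i - 192 exceeds i/4 once i ≥ 738, which the threshold 1000
      -- ensures.
      0≤a-½ : 0ℚ ≤ a - ½
      0≤a-½ = diff≥0 (square-cancel-≤ {½} 0≤a (*-cancelˡ-≤ (0<ι N) (≤-by
        (i * (a * a) + (ℤ.+ 192 / 1) - s * i + ℤ.+ 25 / 96 * (ν - (ℤ.+ 1000 / 1)) + (ℤ.+ 25 / 96 * ((ℤ.+ 1001 / 1)) - (ℤ.+ 192 / 1)))
        (0≤+ (0≤+ ia²≥ (0≤* (nonNegative⁻¹ (ℤ.+ 25 / 96)) 0≤ν-1000)) (nonNegative⁻¹ (ℤ.+ 25 / 96 * ((ℤ.+ 1001 / 1)) - (ℤ.+ 192 / 1))))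
        (solve 2 (λ v b → (v :+ con 1ℚ) :* (con ½ :* con ½) :+ ((v :+ con 1ℚ) :* b :+ con ((ℤ.+ 192 / 1)) :- con s :* (v :+ con 1ℚ)
            :+ con (ℤ.+ 25 / 96) :* (v :- con ((ℤ.+ 1000 / 1))) :+ con (ℤ.+ 25 / 96 * ((ℤ.+ 1001 / 1)) - (ℤ.+ 192 / 1)))
          := (v :+ con 1ℚ) :* b) refl ν (a * a)))))

    -- Since i d = 1000 P, i (t + d) is at least P (i a + 350). In the square the cross term 700 i a
    -- ≥ 350 i outweighs the error 192 i of i² a², and the surplus 158 i compensates for the factor
    -- ν in place of i + ½.
    upper : (ℤ.+ 49 / 1) * [n+½]p² n ≤ (ℤ.+ 96 / 1) * ν * ((t + d) * (t + d))
    upper = *-cancelˡ-≤ (0<p*q (0<ι N) (0<ι N)) (≤-trans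
      (≤-by (P * P * ((ℤ.+ 96 / 1) * ν * (i * (i * (a * a) + (ℤ.+ 192 / 1) - s * i) + (ℤ.+ 700 / 1) * i * (a - ½)) + ℤ.+ 11760000 / 1 * ν
               + (ℤ.+ 30189 / 2) * (ν * ν) + (ℤ.+ 15021 / 1 * (ν - (ℤ.+ 1000 / 1)) + (ℤ.+ 30041853 / 2))))
        (0≤* (0≤p² P) (0≤+ (0≤+ (0≤+ (0≤* (0≤* (nonNegative⁻¹ (ℤ.+ 96 / 1)) (0≤ι N)) (0≤+ (0≤* 0≤i ia²≥) (0≤* (0≤* (nonNegative⁻¹ (ℤ.+ 700 / 1)) 0≤i) 0≤a-½)))
            (0≤* (nonNegative⁻¹ (ℤ.+ 11760000 / 1)) (0≤ι N)))
            (0≤* (nonNegative⁻¹ (ℤ.+ 30189 / 2)) (0≤p² ν)))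
            (0≤+ (0≤* (nonNegative⁻¹ (ℤ.+ 15021 / 1)) 0≤ν-1000) (nonNegative⁻¹ (ℤ.+ 30041853 / 2)))))
        (solve 3 (λ v a c → let i = v :+ con 1ℚ in
            i :* i :* (con ((ℤ.+ 49 / 1)) :* ((i :+ con ½) :* (c :* c)))
            :+ c :* c :* (con ((ℤ.+ 96 / 1)) :* v :* (i :* (i :* (a :* a) :+ con ((ℤ.+ 192 / 1)) :- con s :* i) :+ con ((ℤ.+ 700 / 1)) :* i :* (a :- con ½))
               :+ con (ℤ.+ 11760000 / 1) :* v
               :+ con (ℤ.+ 30189 / 2) :* (v :* v) :+ (con (ℤ.+ 15021 / 1) :* (v :- con ((ℤ.+ 1000 / 1))) :+ con (ℤ.+ 30041853 / 2)))
            := con ((ℤ.+ 96 / 1)) :* v :* (c :* (i :* a :+ con ((ℤ.+ 350 / 1))) :* (c :* (i :* a :+ con ((ℤ.+ 350 / 1))))))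
          refl ν a P))
      (≤-trans (*-monoˡ (0≤* (nonNegative⁻¹ (ℤ.+ 96 / 1)) (0≤ι N)) (square-mono (0≤* 0≤P (0≤+ (0≤* 0≤i 0≤a) (nonNegative⁻¹ (ℤ.+ 350 / 1)))) below))
        (≤-reflexive (solve 3 (λ i v x → con ((ℤ.+ 96 / 1)) :* v :* (i :* x :* (i :* x)) := i :* i :* (con ((ℤ.+ 96 / 1)) :* v :* (x :* x))) refl i ν (t + d)))))
      where
      below : P * (i * a + (ℤ.+ 350 / 1)) ≤ i * (t + d)
      below = ≤-trans (≤-reflexive (solve 3 (λ i a c → c :* (i :* a :+ con ((ℤ.+ 350 / 1))) := i :* (a :* c) :+ con ((ℤ.+ 350 / 1)) :* c) refl i a P))
        (≤-trans (+-monoˡ-≤ ((ℤ.+ 350 / 1) * P) it≥) (≤-reflexive (trans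
          (solve 2 (λ x c → x :+ con (ι 650) :* c :+ con ((ℤ.+ 350 / 1)) :* c := x :+ con ((ℤ.+ 1000 / 1)) :* c) refl (i * t) P)
          (trans (cong (i * t +_) (sym id≡)) (sym (*-distribˡ-+ i t d))))))

    -- The cross term now has the other sign: (i a - 350)² is at most s i² - 158 i + 350², and the
    -- threshold 1000 makes 158 i exceed 350².
    lower : 0ℚ ≤ t - d → (ℤ.+ 96 / 1) * ν * ((t - d) * (t - d)) ≤ (ℤ.+ 49 / 1) * np² n
    lower 0≤t-d = *-cancelˡ-≤ (0<p*q (0<ι N) (0<ι N)) (≤-trans
      (≤-reflexive (solve 3 (λ i v x → i :* i :* (con ((ℤ.+ 96 / 1)) :* v :* (x :* x)) := con ((ℤ.+ 96 / 1)) :* v :* (i :* x :* (i :* x))) refl i ν (t - d)))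
      (≤-trans (*-monoˡ (0≤* (nonNegative⁻¹ (ℤ.+ 96 / 1)) (0≤ι N)) (square-mono (0≤* 0≤i 0≤t-d) above))
      (≤-by (P * P * ((ℤ.+ 49 / 1) * (i * i) + (ℤ.+ 96 / 1) * ν * (i * (s * i + (ℤ.+ 192 / 1) - i * (a * a)) + (ℤ.+ 700 / 1) * i * (a - ½) + (ℤ.+ 158 / 1) * (ν - (ℤ.+ 1000 / 1)) + ℤ.+ 35658 / 1)))
        (0≤* (0≤p² P) (0≤+ (0≤* (nonNegative⁻¹ (ℤ.+ 49 / 1)) (0≤p² i)) (0≤* (0≤* (nonNegative⁻¹ (ℤ.+ 96 / 1)) (0≤ι N))
          (0≤+ (0≤+ (0≤+ (0≤* 0≤i ia²≤) (0≤* (0≤* (nonNegative⁻¹ (ℤ.+ 700 / 1)) 0≤i) 0≤a-½)) (0≤* (nonNegative⁻¹ (ℤ.+ 158 / 1)) 0≤ν-1000)) (nonNegative⁻¹ (ℤ.+ 35658 / 1))))))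
        (solve 3 (λ v a c → let i = v :+ con 1ℚ in
            con ((ℤ.+ 96 / 1)) :* v :* (c :* (i :* a :- con ((ℤ.+ 350 / 1))) :* (c :* (i :* a :- con ((ℤ.+ 350 / 1)))))
            :+ c :* c :* (con ((ℤ.+ 49 / 1)) :* (i :* i) :+ con ((ℤ.+ 96 / 1)) :* v :* (i :* (con s :* i :+ con ((ℤ.+ 192 / 1)) :- i :* (a :* a))
               :+ con ((ℤ.+ 700 / 1)) :* i :* (a :- con ½) :+ con ((ℤ.+ 158 / 1)) :* (v :- con ((ℤ.+ 1000 / 1))) :+ con (ℤ.+ 35658 / 1)))
            := i :* i :* (con ((ℤ.+ 49 / 1)) :* (i :* (c :* c)))) refl ν a P))))
      where
      above : i * (t - d) ≤ P * (i * a - (ℤ.+ 350 / 1))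
      above = ≤-trans (≤-reflexive (trans (solve 3 (λ i t d → i :* (t :- d) := i :* t :- i :* d) refl i t d) (cong (λ b → i * t - b) id≡)))
        (≤-trans (+-monoˡ-≤ (- ((ℤ.+ 1000 / 1) * P)) it≤) (≤-reflexive
          (solve 3 (λ i a c → i :* (a :* c) :+ con (ι 650) :* c :- con ((ℤ.+ 1000 / 1)) :* c := c :* (i :* a :- con ((ℤ.+ 350 / 1)))) refl i a P)))

-- From the Cauchy sequences of c and c/√N to rational squares

module Reals where

  open import Data.Rational.Base hiding (Positive; NonZero)
  open import Data.Rational.Properties
  open import Data.Rational.Solver using (module +-*-Solver)
  open import Defs
    using (ℝ; seq; bounded; fromℕ; Positive; index; bound≤; √_; π; c; _^-½; module Inverse; sqrtℚ;
      sqrtℚ-spec; leibniz-bounds; archimedean; *-mono-≤; 0<p*q; 0<1/; p-q≤r⇒p≤q+r; ∣p-q∣≡∣q-p∣; √-positive)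
  import Defs as ℝ
  open Rationals
  open WallisLeibniz using (πₙ; _⁻¹≤π; π≤_⁻¹)

  open +-*-Solver

  Eventually : (ℕ → Set) → Set
  Eventually P = ∃[ M ] (∀ m → M ℕ.≤ m → P m)

  _∧_ : ∀ {P Q : ℕ → Set} → Eventually P → Eventually Q → Eventually (λ m → P m × Q m)
  (M , f) ∧ (N , g) = M ℕ.⊔ N , λ m h → f m (ℕ.m⊔n≤o⇒m≤o M N h) , g m (ℕ.m⊔n≤o⇒n≤o M N h)

  eventually-map : ∀ {P Q : ℕ → Set} → (∀ m → P m → Q m) → Eventually P → Eventually Q
  eventually-map f (M , h) = M , λ m M≤m → f m (h m M≤m)

  _⟶_ : (ℕ → ℚ) → ℚ → Set
  f ⟶ l = ∀ ε → 0ℚ < ε → Eventually (λ m → ∣ f m - l ∣ ≤ ε)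

  divide : ∀ {K ε} → 0ℚ < K → 0ℚ < ε → ∃[ η ] (0ℚ < η × K * η ≡ ε)
  divide {K} {ε} 0<K 0<ε = 1/ K * ε , 0<p*q (0<1/ 0<K) 0<ε ,
    trans (sym (*-assoc K (1/ K) ε)) (trans (cong (_* ε) (*-inverseʳ K)) (*-identityˡ ε))
    where instance _ = >-nonZero 0<K

  recip-small : ∀ {K ε} → 0ℚ < K → 0ℚ < ε → Eventually (λ m → K * recip m ≤ ε)
  recip-small 0<K 0<ε = let η , 0<η , Kη≡ε = divide 0<K 0<ε in
    ↧ₙ η , λ m h → ≤-trans (*-monoˡ (<⇒≤ 0<K) (archimedean 0<η m h)) (≤-reflexive Kη≡ε)

  recip≤1 : ∀ m → recip m ≤ 1ℚ
  recip≤1 m = ℝ./-mono-≤ 1 m 1 0 (ℕ.s≤s ℕ.z≤n)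

  -- The term linear in the root r is controlled by r ≤ 1 + r² ≤ 1 + q.
  sqrtℚ-error : ∀ q m → 0ℚ ≤ q → let r = sqrtℚ q m in
    0ℚ ≤ q - r * r × q - r * r ≤ (ι 2 * q + ι 3) * recip m
  sqrtℚ-error q m 0≤q = diff≥0 r²≤q , (begin
    q - r * r
      ≤⟨ +-monoˡ-≤ (- (r * r)) (<⇒≤ q<[r+δ]²) ⟩
    (r + δ) * (r + δ) - r * r
      ≡⟨ solve 2 (λ r d → (r :+ d) :* (r :+ d) :- r :* r := (con (ι 2) :* r :+ d) :* d) refl r δ ⟩
    (ι 2 * r + δ) * δ
      ≤⟨ *-monoʳ (<⇒≤ (0<recip m)) (+-mono-≤ (*-monoˡ (0≤ι 2) (≤-trans
           (≤-by {r} ((r - ½) * (r - ½) + ℤ.+ 3 / 4) (0≤+ (0≤p² (r - ½)) (nonNegative⁻¹ (ℤ.+ 3 / 4)))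
             (solve 1 (λ r → r :+ ((r :- con ½) :* (r :- con ½) :+ con (ℤ.+ 3 / 4)) := con 1ℚ :+ r :* r) refl r))
           (+-monoʳ-≤ 1ℚ r²≤q))) (recip≤1 m)) ⟩
    (ι 2 * (1ℚ + q) + 1ℚ) * δ
      ≡⟨ solve 2 (λ q d → (con (ι 2) :* (con 1ℚ :+ q) :+ con 1ℚ) :* d := (con (ι 2) :* q :+ con (ι 3)) :* d) refl q δ ⟩
    (ι 2 * q + ι 3) * δ ∎)
    where
    open ≤-Reasoning
    r = sqrtℚ q m
    δ = recip m
    r²≤q : r * r ≤ q
    r²≤q = subst (r * r ≤_) (p≤q⇒p⊔q≡q 0≤q) (proj₁ (proj₂ (sqrtℚ-spec q m)))
    q<[r+δ]² : q < (r + δ) * (r + δ)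
    q<[r+δ]² = subst (_< (r + δ) * (r + δ)) (p≤q⇒p⊔q≡q 0≤q) (proj₂ (proj₂ (sqrtℚ-spec q m)))

  inverse-exact : ∀ x (pos : Positive x) m → index pos ℕ.≤ m → seq x m * Inverse.inv x pos m ≡ 1ℚ
  inverse-exact x pos m h = trans (cong (_* Inverse.inv x pos m) (sym (p≤q⇒p⊔q≡q (bound≤ pos m h))))
    (*-inverseʳ (Inverse.s x pos m) {{>-nonZero (Inverse.0<s x pos m)}})

  square-bounded : ∀ x → ∃[ Y ] (0ℚ < Y × Eventually (λ m → seq x m * seq x m ≤ Y))
  square-bounded x = let B , 0<B , M , h = bounded x in
    B * B , 0<p*q 0<B 0<B , M , λ m M≤m → subst (_≤ B * B) (∣p∣² (seq x m)) (square-mono (0≤∣p∣ (seq x m)) (h m M≤m))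

  0≤πₙ : ∀ m → 0ℚ ≤ πₙ m
  0≤πₙ m = 0≤* (0≤ι 4) (proj₁ (leibniz-bounds 0 m))

  πₙ≤4 : ∀ m → πₙ m ≤ ι 4
  πₙ≤4 m = *-monoˡ (0≤ι 4) (proj₂ (leibniz-bounds 0 m))

  -- π₁, z, α and β stand for approximations to π, c, √6 and √π.
  96πz²-near : ∀ {Y δ} π₁ z α β → 0ℚ ≤ π₁ → 0ℚ ≤ Y → z * z ≤ Y →
    0ℚ ≤ ι 6 - α * α → ι 6 - α * α ≤ ι 15 * δ → 0ℚ ≤ π₁ - β * β → π₁ - β * β ≤ ι 11 * δ → ι 7 * α ≡ z * (ι 24 * β) →
    ∣ ι 96 * π₁ * (z * z) - ι 49 ∣ ≤ (ι 735 + ι 6336 * Y) * δ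
  96πz²-near {Y} {δ} π₁ z α β 0≤π₁ 0≤Y z²≤Y 0≤e₁ e₁≤ 0≤e₂ e₂≤ 7α≡ =
    ≤-trans (≤-by (ι 5 * ∣ w ∣) (0≤* (0≤ι 5) (0≤∣p∣ w))
        (trans (solve 1 (λ w → w :+ con (ι 5) :* w := con (ι 6) :* w) refl ∣ w ∣) (sym (∣p*q∣≡∣p∣*∣q∣ (ι 6) w))))
      (subst (λ a → ∣ a ∣ ≤ (ι 735 + ι 6336 * Y) * δ) (sym 6w≡) (begin
        ∣ k * (z * z) * e₂ - ι 49 * e₁ ∣
          ≤⟨ ∣p-q∣≤ {k * (z * z) * e₂} {ι 49 * e₁}
               (≤-trans (≤-reflexive (0≤p⇒∣p∣≡p (0≤* (0≤* 0≤k (0≤p² z)) 0≤e₂)))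
                 (*-mono-≤ (0≤* 0≤k (0≤p² z)) (≤-trans 0≤e₂ e₂≤) (*-monoˡ 0≤k z²≤Y) e₂≤))
               (≤-trans (≤-reflexive (0≤p⇒∣p∣≡p (0≤* (0≤ι 49) 0≤e₁))) (*-monoˡ (0≤ι 49) e₁≤)) ⟩
        k * Y * (ι 11 * δ) + ι 49 * (ι 15 * δ)
          ≡⟨ solve 2 (λ y d → con k :* y :* (con (ι 11) :* d) :+ con (ι 49) :* (con (ι 15) :* d)
               := (con (ι 735) :+ con (ι 6336) :* y) :* d) refl Y δ ⟩
        (ι 735 + ι 6336 * Y) * δ ∎))
    where
    open ≤-Reasoning
    k = ℤ.+ 576 / 1
    0≤k : 0ℚ ≤ k
    0≤k = nonNegative⁻¹ k
    w = ι 96 * π₁ * (z * z) - ι 49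
    e₁ = ι 6 - α * α
    e₂ = π₁ - β * β
    -- Squaring 7α = 24 z β expresses the error of 96 π z² by those of the two square roots; 576 is
    -- 24².
    6w≡ : ι 6 * w ≡ k * (z * z) * e₂ - ι 49 * e₁
    6w≡ = trans (solve 4 (λ π z a b → con (ι 6) :* (con (ι 96) :* π :* (z :* z) :- con (ι 49))
          := con k :* (z :* z) :* (π :- b :* b) :- con (ι 49) :* (con (ι 6) :- a :* a)
             :+ (z :* (con (ι 24) :* b) :* (z :* (con (ι 24) :* b)) :- con (ι 7) :* a :* (con (ι 7) :* a))) refl π₁ z α β)
      (trans (cong (λ a → k * (z * z) * e₂ - ι 49 * e₁ + (a * a - ι 7 * α * (ι 7 * α))) (sym 7α≡))
        (trans (cong (k * (z * z) * e₂ - ι 49 * e₁ +_) (+-inverseʳ (ι 7 * α * (ι 7 * α)))) (+-identityʳ (k * (z * z) * e₂ - ι 49 * e₁))))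

  -- As k inverts the approximation x of √ν, the factor (x k)² = 1 can be inserted, and only the
  -- error ν - x² is added; 384 is 96 · 4 from π₁ ≤ 4.
  96νπ[zk]²-near : ∀ {Y ε δ} ν π₁ z k x → 0ℚ ≤ π₁ → π₁ ≤ ι 4 → 0ℚ ≤ Y → z * k * (z * k) ≤ Y →
    0ℚ ≤ ν - x * x → ν - x * x ≤ δ → x * k ≡ 1ℚ → ∣ ι 96 * π₁ * (z * z) - ι 49 ∣ ≤ ε →
    ∣ ι 96 * ν * π₁ * (z * k * (z * k)) - ι 49 ∣ ≤ ε + ι 384 * Y * δ
  96νπ[zk]²-near {Y} {ε} {δ} ν π₁ z k x 0≤π₁ π₁≤4 0≤Y y²≤Y 0≤e e≤ xk≡1 near =
    subst (λ a → ∣ a ∣ ≤ ε + ι 384 * Y * δ) (sym split) (∣p+q∣≤ near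
      (≤-trans (≤-reflexive (0≤p⇒∣p∣≡p (0≤* (0≤* (0≤* (0≤ι 96) 0≤π₁) (0≤p² (z * k))) 0≤e)))
        (*-mono-≤ (0≤* (0≤* (0≤ι 96) 0≤π₁) (0≤p² (z * k))) (≤-trans 0≤e e≤)
          (*-mono-≤ (0≤* (0≤ι 96) 0≤π₁) 0≤Y (*-monoˡ (0≤ι 96) π₁≤4) y²≤Y) e≤)))
    where
    split : ι 96 * ν * π₁ * (z * k * (z * k)) - ι 49
      ≡ (ι 96 * π₁ * (z * z) - ι 49) + ι 96 * π₁ * (z * k * (z * k)) * (ν - x * x)
    split = trans (solve 5 (λ v π c k x → con (ι 96) :* v :* π :* (c :* k :* (c :* k)) :- con (ι 49)
          := con (ι 96) :* π :* (c :* c) :* (x :* k :* (x :* k)) :- con (ι 49)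
             :+ con (ι 96) :* π :* (c :* k :* (c :* k)) :* (v :- x :* x)) refl ν π₁ z k x)
      (trans (cong (λ a → ι 96 * π₁ * (z * z) * (a * a) - ι 49 + ι 96 * π₁ * (z * k * (z * k)) * (ν - x * x)) xk≡1)
        (cong (λ a → a - ι 49 + ι 96 * π₁ * (z * k * (z * k)) * (ν - x * x)) (*-identityʳ (ι 96 * π₁ * (z * z)))))

  7√6≡c*24√π : Eventually (λ m → ι 7 * sqrtℚ (ι 6) m ≡ seq c m * (ι 24 * sqrtℚ (πₙ m) m))
  7√6≡c*24√π = index den⁺ , λ m h → 7α≡ (inverse-exact den den⁺ m h)
    where
    den : ℝ
    den = fromℕ 24 ℝ.* √ π
    den⁺ : Positive den
    den⁺ = ℝ.*-positive
    7α≡ : ∀ {a b i} → b * i ≡ 1ℚ → a ≡ a * i * b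
    7α≡ {a} {b} {i} bi≡1 = trans (sym (*-identityʳ a)) (trans (cong (a *_) (sym bi≡1))
      (solve 3 (λ a b i → a :* (b :* i) := a :* i :* b) refl a b i))

  -- The constants 15 and 11 of `96πz²-near` are 2q + 3 from `sqrtℚ-error`, at q = 6 and at the
  -- bound q = 4 of `πₙ`.
  96πz²⟶49 : ∀ (z : ℕ → ℚ) Y → 0ℚ ≤ Y → Eventually (λ m → z m * z m ≤ Y) →
    Eventually (λ m → ι 7 * sqrtℚ (ι 6) m ≡ z m * (ι 24 * sqrtℚ (πₙ m) m)) →
    (λ m → ι 96 * πₙ m * (z m * z m)) ⟶ ι 49
  96πz²⟶49 z Y 0≤Y z²≤Y eq ε 0<ε = eventually-map
    (λ m (b , e , Kδ≤ε) → ≤-trans (96πz²-near (πₙ m) (z m) (sqrtℚ (ι 6) m) (sqrtℚ (πₙ m) m) (0≤πₙ m) 0≤Y b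
        (proj₁ (sqrtℚ-error (ι 6) m (0≤ι 6))) (proj₂ (sqrtℚ-error (ι 6) m (0≤ι 6)))
        (proj₁ (sqrtℚ-error (πₙ m) m (0≤πₙ m)))
        (≤-trans (proj₂ (sqrtℚ-error (πₙ m) m (0≤πₙ m)))
          (*-monoʳ (<⇒≤ (0<recip m)) (+-monoˡ-≤ (ι 3) (*-monoˡ (0≤ι 2) (πₙ≤4 m))))) e) Kδ≤ε)
    (z²≤Y ∧ (eq ∧ recip-small {ι 735 + ι 6336 * Y} (+-mono-<-≤ (0<ι 734) (0≤* (0≤ι 6336) 0≤Y)) 0<ε))

  96πc²⟶49 : (λ m → ι 96 * πₙ m * (seq c m * seq c m)) ⟶ ι 49
  96πc²⟶49 = let Y , 0<Y , b = square-bounded c in 96πz²⟶49 (seq c) Y (<⇒≤ 0<Y) b 7√6≡c*24√π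

  96νπ[zk]²⟶49 : ∀ ν (z k x : ℕ → ℚ) Y → 0ℚ ≤ ν → 0ℚ < Y → Eventually (λ m → z m * k m * (z m * k m) ≤ Y) →
    (∀ m → 0ℚ ≤ ν - x m * x m × ν - x m * x m ≤ (ι 2 * ν + ι 3) * recip m) → Eventually (λ m → x m * k m ≡ 1ℚ) →
    (λ m → ι 96 * πₙ m * (z m * z m)) ⟶ ι 49 → (λ m → ι 96 * ν * πₙ m * (z m * k m * (z m * k m))) ⟶ ι 49
  96νπ[zk]²⟶49 ν z k x Y 0≤ν 0<Y y²≤Y error inverse limit ε 0<ε = eventually-map
    (λ m ((b , i) , (near , Kδ≤)) → ≤-trans
      (96νπ[zk]²-near ν (πₙ m) (z m) (k m) (x m) (0≤πₙ m) (πₙ≤4 m) (<⇒≤ 0<Y) b (proj₁ (error m)) (proj₂ (error m)) i near)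
      (≤-trans (+-monoʳ-≤ (½ * ε) (≤-trans (≤-reflexive (sym (*-assoc (ι 384 * Y) (ι 2 * ν + ι 3) (recip m)))) Kδ≤))
          (≤-reflexive (solve 1 (λ e → con ½ :* e :+ con ½ :* e := e) refl ε))))
    ((y²≤Y ∧ inverse) ∧ (limit (½ * ε) 0<½ε ∧ recip-small {ι 384 * Y * (ι 2 * ν + ι 3)}
      (0<p*q (0<p*q (0<ι 383) 0<Y) (+-mono-≤-< (0≤* (0≤ι 2) 0≤ν) (0<ι 2))) 0<½ε))
    where
    0<½ε = 0<p*q (positive⁻¹ ½) 0<ε

  module _ (N : ℕ) .{{_ : NonZero N}} where

    y : ℝ
    y = c ℝ.* N ^-½

    √N⁺ : Positive (√ fromℕ N)
    √N⁺ = √-positive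

    √N-error : ∀ m → let x = seq (√ fromℕ N) m in 0ℚ ≤ ι N - x * x × ι N - x * x ≤ (ι 2 * ι N + ι 3) * recip m
    √N-error m = subst (λ q → let x = sqrtℚ (ℤ.+ N / 1) m in 0ℚ ≤ q - x * x × q - x * x ≤ (ι 2 * q + ι 3) * recip m)
      (sym (ι≡/1 N)) (sqrtℚ-error (ℤ.+ N / 1) m (subst (0ℚ ≤_) (ι≡/1 N) (0≤ι N)))

    96Nπy²⟶49 : (λ m → ι 96 * ι N * πₙ m * (seq y m * seq y m)) ⟶ ι 49
    96Nπy²⟶49 = let Y , 0<Y , b = square-bounded y in
      96νπ[zk]²⟶49 (ι N) (seq c) (Inverse.inv (√ fromℕ N) √N⁺) (seq (√ fromℕ N)) Y (0≤ι N) 0<Y b √N-error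
        (index √N⁺ , inverse-exact (√ fromℕ N) √N⁺) 96πc²⟶49

  -- Here z approximates √(49/(96 ν π)), which is c/√ν.
  module Compare (ν : ℚ) (0<ν : 0ℚ < ν) (z : ℕ → ℚ) (0≤z : ∀ m → 0ℚ ≤ z m) (Y : ℚ) (0<Y : 0ℚ < Y)
    (z²≤Y : Eventually (λ m → z m * z m ≤ Y)) (limit : (λ m → ι 96 * ν * πₙ m * (z m * z m)) ⟶ ι 49) where

    private
      0<96ν : 0ℚ < ι 96 * ν
      0<96ν = 0<p*q (0<ι 95) 0<ν

      -- The tolerance η uses up half of 96 ν ε², the least amount by which 96 ν q² changes when a
      -- nonnegative q moves up by ε.
      record Slack (a ε : ℚ) : Set where
        field
          η    : ℚ
          0<η  : 0ℚ < η
          eq   : (a + ι 96 * ν * Y) * η ≡ ι 48 * ν * (ε * ε)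
      open Slack

      slack : ∀ a ε → 0ℚ ≤ a → 0ℚ < ε → Slack a ε
      slack a ε 0≤a 0<ε =
        let η , 0<η , eq = divide {a + ι 96 * ν * Y} (+-mono-≤-< 0≤a (0<p*q 0<96ν 0<Y)) (0<p*q (0<p*q (0<ι 47) 0<ν) (0<p*q 0<ε 0<ε))
        in record { η = η ; 0<η = 0<η ; eq = eq }

      absurd : ∀ {a ε} (s : Slack a ε) → 0ℚ < ε → ∀ b d → b + ε * ε ≤ d →
        ι 96 * ν * d ≤ ι 96 * ν * b + (a + ι 96 * ν * Y) * η s → ∀ {P : Set} → P
      absurd {a} {ε} s 0<ε b d b+ε²≤d h = contradiction
        (<-≤-trans (0<p*q (0<p*q (0<ι 47) 0<ν) (0<p*q 0<ε 0<ε)) (diff≥0⁻¹ (subst (0ℚ ≤_)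
          (trans (cong (λ k → ι 96 * ν * b + k - ι 96 * ν * (b + ε * ε)) (eq s))
            (solve 3 (λ v b e → con (ι 96) :* v :* b :+ con (ι 48) :* v :* (e :* e) :- con (ι 96) :* v :* (b :+ e :* e)
              := con 0ℚ :- con (ι 48) :* v :* (e :* e)) refl ν b ε))
          (diff≥0 (≤-trans (*-monoˡ (<⇒≤ 0<96ν) b+ε²≤d) h))))) (<-irrefl refl)

      squares : ∀ {q w ε} → 0ℚ ≤ q → 0ℚ < ε → q + ε ≤ w → q * q + ε * ε ≤ w * w
      squares {q} {w} {ε} 0≤q 0<ε h = ≤-trans (≤-by (ι 2 * (q * ε)) (0≤* (0≤ι 2) (0≤* 0≤q (<⇒≤ 0<ε)))
        (solve 2 (λ q e → q :* q :+ e :* e :+ con (ι 2) :* (q :* e) := (q :+ e) :* (q :+ e)) refl q ε))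
        (square-mono (0≤+ 0≤q (<⇒≤ 0<ε)) h)

      -- If w ≥ q + ε, then 96 ν w² ≥ 96 ν q² + 96 ν ε². Multiplying by 1 ≤ π₁ a + η and using that
      -- 96 ν π₁ w² is near 49 gives instead at most 96 ν q² + 48 ν ε².
      upper-step : ∀ {a q ε} (s : Slack a ε) (π₁ w : ℚ) → 0ℚ < ε → 0ℚ ≤ a → 0ℚ ≤ q → ι 49 * a ≤ ι 96 * ν * (q * q) →
        w * w ≤ Y → ∣ ι 96 * ν * π₁ * (w * w) - ι 49 ∣ ≤ η s → 1ℚ ≤ π₁ * a + η s → w ≤ q + ε
      upper-step {a} {q} {ε} s π₁ w 0<ε 0≤a 0≤q h x≤Y near 1≤ with ≤-total w (q + ε)
      ... | inj₁ w≤q+ε = w≤q+ε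
      ... | inj₂ q+ε≤w = absurd s 0<ε (q * q) x (squares 0≤q 0<ε q+ε≤w) (begin
        v * x
          ≡⟨ *-identityʳ (v * x) ⟨
        v * x * 1ℚ
          ≤⟨ *-monoˡ (0≤* (<⇒≤ 0<96ν) (0≤p² w)) 1≤ ⟩
        v * x * (π₁ * a + e)
          ≡⟨ solve 5 (λ v x π a e → v :* x :* (π :* a :+ e) := v :* π :* x :* a :+ v :* x :* e) refl v x π₁ a e ⟩
        v * π₁ * x * a + v * x * e
          ≤⟨ +-mono-≤ (*-monoʳ 0≤a (p-q≤r⇒p≤q+r (v * π₁ * x) (ι 49) (∣p∣≤-upper near)))
               (*-monoʳ (<⇒≤ (0<η s)) (*-monoˡ (<⇒≤ 0<96ν) x≤Y)) ⟩
        (ι 49 + e) * a + v * Y * e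
          ≡⟨ solve 4 (λ a e v y → (con (ι 49) :+ e) :* a :+ v :* y :* e := con (ι 49) :* a :+ (a :+ v :* y) :* e) refl a e v Y ⟩
        ι 49 * a + (a + v * Y) * e
          ≤⟨ +-monoˡ-≤ ((a + v * Y) * e) h ⟩
        v * (q * q) + (a + v * Y) * e ∎)
        where
        open ≤-Reasoning
        x = w * w
        v = ι 96 * ν
        e = η s

      lower-step : ∀ {a q ε} (s : Slack a ε) (π₁ w : ℚ) → 0ℚ < ε → 0ℚ ≤ a → 0ℚ ≤ w → (0ℚ ≤ q → ι 96 * ν * (q * q) ≤ ι 49 * a) →
        w * w ≤ Y → ∣ ι 96 * ν * π₁ * (w * w) - ι 49 ∣ ≤ η s → π₁ * a ≤ 1ℚ + η s → q ≤ w + ε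
      lower-step {a} {q} {ε} s π₁ w 0<ε 0≤a 0≤w h x≤Y near ≤1 with ≤-total q (w + ε)
      ... | inj₁ q≤w+ε = q≤w+ε
      ... | inj₂ w+ε≤q = absurd s 0<ε x (q * q) (squares 0≤w 0<ε w+ε≤q) (begin
        v * (q * q)
          ≤⟨ h (≤-trans (0≤+ 0≤w (<⇒≤ 0<ε)) w+ε≤q) ⟩
        ι 49 * a
          ≤⟨ *-monoʳ 0≤a (p-q≤r⇒p≤q+r (ι 49) (v * π₁ * x) (∣p∣≤-upper (subst (_≤ e) (∣p-q∣≡∣q-p∣ (v * π₁ * x) (ι 49)) near))) ⟩
        (v * π₁ * x + e) * a
          ≡⟨ solve 5 (λ v x π a e → (v :* π :* x :+ e) :* a := v :* x :* (π :* a) :+ e :* a) refl v x π₁ a e ⟩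
        v * x * (π₁ * a) + e * a
          ≤⟨ +-monoˡ-≤ (e * a) (*-monoˡ (0≤* (<⇒≤ 0<96ν) (0≤p² w)) ≤1) ⟩
        v * x * (1ℚ + e) + e * a
          ≡⟨ solve 4 (λ v x a e → v :* x :* (con 1ℚ :+ e) :+ e :* a := v :* x :+ (a :+ v :* x) :* e) refl v x a e ⟩
        v * x + (a + v * x) * e
          ≤⟨ +-monoʳ-≤ (v * x) (*-monoʳ (<⇒≤ (0<η s)) (+-monoʳ-≤ a (*-monoˡ (<⇒≤ 0<96ν) x≤Y))) ⟩
        v * x + (a + v * Y) * e ∎)
        where
        open ≤-Reasoning
        x = w * w
        v = ι 96 * ν
        e = η s

    z≤ : ∀ {a q} → 0ℚ ≤ a → a ⁻¹≤π → 0ℚ ≤ q → ι 49 * a ≤ ι 96 * ν * (q * q) →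
      ∀ ε → 0ℚ < ε → Eventually (λ m → z m ≤ q + ε)
    z≤ {a} 0≤a a⁻¹≤π 0≤q h ε 0<ε = let s = slack a ε 0≤a 0<ε in eventually-map
      (λ m (b , near , 1≤) → upper-step s (πₙ m) (z m) 0<ε 0≤a 0≤q h b near 1≤)
      (z²≤Y ∧ (limit (η s) (0<η s) ∧ a⁻¹≤π (η s) (0<η s)))

    -- The squares are compared only for 0 ≤ q because the claim is immediate for negative q; this
    -- admits q = `T n - error N`, whose sign is not known.
    ≤z : ∀ {a q} → 0ℚ ≤ a → π≤ a ⁻¹ → (0ℚ ≤ q → ι 96 * ν * (q * q) ≤ ι 49 * a) →
      ∀ ε → 0ℚ < ε → Eventually (λ m → q ≤ z m + ε)
    ≤z {a} 0≤a π≤a⁻¹ h ε 0<ε = let s = slack a ε 0≤a 0<ε in eventually-map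
      (λ m (b , near , ≤1) → lower-step s (πₙ m) (z m) 0<ε 0≤a (0≤z m) h b near ≤1)
      (z²≤Y ∧ (limit (η s) (0<η s) ∧ π≤a⁻¹ (η s) (0<η s)))

-- The expansion and the numerical value of c

module Expansion where

  open import Data.Rational.Base hiding (Positive; NonZero)
  open import Data.Rational.Properties
  open import Data.Rational.Solver using (module +-*-Solver)
  open import Relation.Nullary.Decidable using (from-yes)
  open import Defs
    using (ℝ; seq; fromℕ; fromℚ; flimsyCount; Positive; index; √_; π; c; _^-½; _^-3/2; module Inverse;
      sqrtℚ-spec; *-mono-≤; ∣p-q∣≤r; p-q≤r⇒p≤q+r; _∈O[_]; Seq⁺)
  import Defs as ℝ
  open Rationals
  open WalkSeries using (p; ¼)
  open Asymptotics using (T)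
  open Counting using (½^_; flimsyCount+T; 0≤T)
  open WallisLeibniz using (πₙ; np²≤1; [n+½]p²⁻¹≤π; π≤np²⁻¹; π⁻; π⁺; π⁻≤π; π≤π⁺)
  open Bounds using (error; 0≤error; upper; lower)
  open Reals

  open +-*-Solver

  0≤c : ∀ m → 0ℚ ≤ seq c m
  0≤c m = 0≤* (0≤* (0≤ι 7) (proj₁ (sqrtℚ-spec (ι 6) m))) (<⇒≤ (Inverse.0<inv (fromℕ 24 ℝ.* √ π) ℝ.*-positive m))

  0≤y : ∀ N .{{_ : NonZero N}} m → 0ℚ ≤ seq (y N) m
  0≤y N m = 0≤* (0≤c m) (<⇒≤ (Inverse.0<inv (√ fromℕ N) (√N⁺ N) m))

  -- c/√N is bounded above by T + error through 1/π ≤ (n + ½) p(n)², and below by T - error through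
  -- n p(n)² ≤ 1/π, with n = N + 1.
  y-near-T : ∀ M → 1000 ℕ.≤ suc M → ∀ ε → 0ℚ < ε →
    Eventually (λ m → ∣ seq (y (suc M)) m - T (2 ℕ.+ M) ∣ ≤ error (suc M) + ε)
  y-near-T M 1000≤N ε 0<ε = let Y , 0<Y , b = square-bounded (y N) in compare (seq (y N)) (0≤y N) Y 0<Y b (96Nπy²⟶49 N)
    where
    N = suc M
    n = suc N
    t = T n
    d = error N
    compare : ∀ z → (∀ m → 0ℚ ≤ z m) → ∀ Y → 0ℚ < Y → Eventually (λ m → z m * z m ≤ Y) →
      (λ m → ι 96 * ι N * πₙ m * (z m * z m)) ⟶ ι 49 → Eventually (λ m → ∣ z m - t ∣ ≤ d + ε)
    compare z 0≤z Y 0<Y b limit = eventually-map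
      (λ m (u , l) → ∣p-q∣≤r (z m) t (≤-trans u (≤-reflexive (+-assoc t d ε)))
        (≤-trans (p-q≤r⇒p≤q+r t d l) (≤-reflexive (solve 3 (λ z d e → d :+ (z :+ e) := z :+ (d :+ e)) refl (z m) d ε))))
      (z≤ (0≤* (0≤+ (0≤ι n) (nonNegative⁻¹ ½)) (0≤p² (p n))) ([n+½]p²⁻¹≤π n) (0≤+ (0≤T M) (0≤error N)) (upper M 1000≤N) ε 0<ε
       ∧ ≤z (0≤* (0≤ι n) (0≤p² (p n))) (π≤np²⁻¹ n) (lower M 1000≤N) ε 0<ε)
      where open Compare (ι N) (0<ι M) z 0≤z Y 0<Y b limit

  -- p(n) √N ≤ 1, because n p(n)² ≤ 1 and N < n.
  error≤ : ∀ M → Eventually (λ m → error (suc M) ≤ ι 1000 * seq (suc M ^-3/2) m)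
  error≤ M = index den⁺ , λ m h → step (seq (√ fromℕ N) m) (Inverse.inv den den⁺ m)
      (proj₁ (sqrtℚ-spec (ℤ.+ N / 1) m)) (proj₁ (√N-error N m)) (<⇒≤ (Inverse.0<inv den den⁺ m))
      (trans (cong (λ k → k * seq (√ fromℕ N) m * Inverse.inv den den⁺ m) (ι≡/1 N)) (inverse-exact den den⁺ m h))
    where
    N = suc M
    n = suc N
    den : ℝ
    den = fromℕ N ℝ.* √ fromℕ N
    den⁺ : Positive den
    den⁺ = ℝ.*-positive
    open ≤-Reasoning
    step : ∀ x i → 0ℚ ≤ x → 0ℚ ≤ ι N - x * x → 0ℚ ≤ i → ι N * x * i ≡ 1ℚ → error N ≤ ι 1000 * i
    step x i 0≤x x²≤N 0≤i inverse = begin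
      ι 1000 * p n * recip N
        ≡⟨ *-identityʳ (ι 1000 * p n * recip N) ⟨
      ι 1000 * p n * recip N * 1ℚ
        ≡⟨ cong (ι 1000 * p n * recip N *_) inverse ⟨
      ι 1000 * p n * recip N * (ι N * x * i)
        ≡⟨ solve 6 (λ k p r v x i → k :* p :* r :* (v :* x :* i) := k :* (v :* r :* (p :* x) :* i)) refl (ι 1000) (p n) (recip N) (ι N) x i ⟩
      ι 1000 * (ι N * recip N * (p n * x) * i)
        ≤⟨ *-monoˡ (0≤ι 1000) (*-monoʳ 0≤i (*-mono-≤ (0≤* (0≤ι N) (<⇒≤ (0<recip N))) 0≤1 Nr≤1 px≤1)) ⟩
      ι 1000 * (1ℚ * 1ℚ * i)
        ≡⟨ cong (ι 1000 *_) (*-identityˡ i) ⟩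
      ι 1000 * i ∎
      where
      Nr≤1 : ι N * recip N ≤ 1ℚ
      Nr≤1 = ≤-by (recip N) (<⇒≤ (0<recip N)) (trans (solve 2 (λ v r → v :* r :+ r := (v :+ con 1ℚ) :* r) refl (ι N) (recip N)) (ι*recip N))
      px≤1 : p n * x ≤ 1ℚ
      px≤1 = square-cancel-≤ 0≤1 (≤-trans (≤-by (p n * p n * (ι N - x * x) + p n * p n) (0≤+ (0≤* (0≤p² (p n)) x²≤N) (0≤p² (p n)))
        (solve 3 (λ p v x → p :* x :* (p :* x) :+ (p :* p :* (v :- x :* x) :+ p :* p) := (v :+ con 1ℚ) :* (p :* p)) refl (p n) (ι N) x)) (np²≤1 n))

  2^*½^ : ∀ N → ι (2 ^ N) * ½^ N ≡ 1ℚ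
  2^*½^ zero    = refl
  2^*½^ (suc N) = trans (cong (_* ½^ (suc N)) (ι-* 2 (2 ^ N)))
    (trans (solve 2 (λ a h → con (ι 2) :* a :* (con ½ :* h) := a :* h) refl (ι (2 ^ N)) (½^ N)) (2^*½^ N))

  -- The exact remainder after scaling, so that `expansion` is an identity and all estimates lie in
  -- `E∈O`.
  E : Seq⁺
  E N = fromℕ (flimsyCount 3 N) ℝ.* fromℚ (½^ N) ℝ.- fromℚ ¼ ℝ.+ c ℝ.* N ^-½

  count-scaled : ∀ M → ℤ.+ flimsyCount 3 (suc M) / 1 * ½^ (suc M) ≡ ¼ - T (2 ℕ.+ M)
  count-scaled M = trans (cong (_* ½^ (suc M)) (sym (ι≡/1 (flimsyCount 3 (suc M)))))
    (rearrange (ι (flimsyCount 3 (suc M))) (½^ M) (T (2 ℕ.+ M)) (flimsyCount+T M))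
    where
    rearrange : ∀ f h t → h * (f + f) + ι 4 * t ≡ 1ℚ → f * (½ * h) ≡ ¼ - t
    rearrange f h t eq = trans (solve 3 (λ f h t → f :* (con ½ :* h) := con ¼ :* (h :* (f :+ f) :+ con (ι 4) :* t) :- t) refl f h t)
      (cong (λ a → ¼ * a - t) eq)

  E∈O : E ∈O[ _^-3/2 ]
  E∈O = fromℕ 1000 , 1000 , λ { (suc M) 1000≤N ε 0<ε → eventually-map
    (λ m (near , small) → bound M m ε (seq (y (suc M)) m) (seq (suc M ^-3/2) m) near small)
    (y-near-T M 1000≤N ε 0<ε ∧ error≤ M) }
    where
    bound : ∀ M m ε z i → ∣ z - T (2 ℕ.+ M) ∣ ≤ error (suc M) + ε → error (suc M) ≤ ι 1000 * i →
      ∣ ℤ.+ flimsyCount 3 (suc M) / 1 * ½^ (suc M) - ¼ + z ∣ ≤ ι 1000 * ∣ i ∣ + ε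
    bound M m ε z i near small = ≤-trans
      (≤-reflexive (cong ∣_∣ (trans (cong (λ a → a - ¼ + z) (count-scaled M))
        (solve 2 (λ t z → con ¼ :- t :- con ¼ :+ z := z :- t) refl (T (2 ℕ.+ M)) z))))
      (≤-trans near (+-monoˡ-≤ ε (≤-trans small (*-monoˡ (0≤ι 1000) (ℝ.p≤∣p∣ i)))))

  expansion : ∀ N .{{_ : NonZero N}} → fromℕ (flimsyCount 3 N) ℝ.≃ fromℕ (2 ^ N) ℝ.* (fromℚ ¼ ℝ.- c ℝ.* N ^-½ ℝ.+ E N)
  expansion N ε 0<ε = 0 , λ m _ → subst (_≤ ε) (sym (cong ∣_∣ (equal (ℤ.+ flimsyCount 3 N / 1) (seq (y N) m)))) (<⇒≤ 0<ε)
    where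
    equal : ∀ f z → f - ℤ.+ (2 ^ N) / 1 * (¼ - z + (f * ½^ N - ¼ + z)) ≡ 0ℚ
    equal f z = trans (solve 4 (λ f z a h → f :- a :* (con ¼ :- z :+ (f :* h :- con ¼ :+ z)) := f :- f :* (a :* h)) refl f z (ℤ.+ (2 ^ N) / 1) (½^ N))
      (trans (cong (λ a → f - f * a) (trans (cong (_* ½^ N) (sym (ι≡/1 (2 ^ N)))) (2^*½^ N)))
        (solve 1 (λ f → f :- f :* con 1ℚ := con 0ℚ) refl f))

  -- With ν = 1 the sequence compared is that of c itself, so it suffices to compare 96 (q ± r)²
  -- with 49 times the reciprocal bounds of π. The tolerance is half a unit of the seventh decimal.
  c-numeric : ℝ.∣ c ℝ.- fromℚ (ℤ.+ 4030765 / 10000000) ∣ ℝ.≤ fromℚ (ℤ.+ 1 / 20000000)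
  c-numeric ε 0<ε = let Y , 0<Y , b = square-bounded c in compare (seq c) 0≤c Y 0<Y b 96πc²⟶49
    where
    q = ℤ.+ 4030765 / 10000000
    r = ℤ.+ 1 / 20000000
    compare : ∀ z → (∀ m → 0ℚ ≤ z m) → ∀ Y → 0ℚ < Y → Eventually (λ m → z m * z m ≤ Y) →
      (λ m → ι 96 * πₙ m * (z m * z m)) ⟶ ι 49 → Eventually (λ m → ∣ z m - q ∣ ≤ r + ε)
    compare z 0≤z Y 0<Y b limit = eventually-map
      (λ m (u , l) → ∣p-q∣≤r (z m) q (≤-trans u (≤-reflexive (+-assoc q r ε)))
        (≤-trans (p-q≤r⇒p≤q+r q r l) (≤-reflexive (solve 3 (λ z d e → d :+ (z :+ e) := z :+ (d :+ e)) refl (z m) r ε))))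
      (z≤ {q = q + r} (nonNegative⁻¹ π⁻) π⁻≤π (nonNegative⁻¹ (q + r)) (from-yes (ι 49 * π⁻ ≤? ι 96 * 1ℚ * ((q + r) * (q + r)))) ε 0<ε
       ∧ ≤z {q = q - r} (nonNegative⁻¹ π⁺) π≤π⁺ (λ _ → from-yes (ι 96 * 1ℚ * ((q - r) * (q - r)) ≤? ι 49 * π⁺)) ε 0<ε)
      where open Compare 1ℚ 0<1 z 0≤z Y 0<Y b limit

open import Defs
open import Data.Integer.Base using (+_)
open import Data.Rational.Base using (_/_)

theorem17 : (∃[ E ] (E ∈O[ _^-3/2 ]
    × (∀ N .{{_ : NonZero N}} →
    fromℕ (flimsyCount 3 N) ≃ fromℕ (2 ^ N) * (fromℚ (+ 1 / 4) - c * N ^-½ + E N))))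
    × (∣ c - fromℚ (+ 4030765 / 10000000) ∣ ≤ fromℚ (+ 1 / 20000000))
theorem17 = (Expansion.E , Expansion.E∈O , Expansion.expansion) , Expansion.c-numeric
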